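{- For every constant $t$, the Independent Set Reconfiguration problem (ISR) restricted to input graphs of treewidth at most $t$ is fixed-parameter tractable parameterized by $k$.
   Context: Graphs are finite, simple and undirected; treewidth is the standard notion. The reconfiguration graph $R_{\mathrm{IS}}(G,k-1,k)$ has one node for each independent set of $G$ of size $k-1$ or $k$; two nodes $A,B$ are adjacent iff $|A \mathbin{\Delta} B| = 1$ (symmetric difference). ISR: given a graph $G$, a positive integer $k$, and two independent sets $I_s,I_t$ of $G$ of size $k$, decide whether there is a path from $I_s$ to $I_t$ in $R_{\mathrm{IS}}(G,k-1,k)$. A parameterized problem with inputs $(x,p)$, $|x|=n$, $p$ a positive integer, is fixed-parameter tractable if it can be decided in time $f(p)\,n^c$, where $f$ is an arbitrary function and $c$ is a constant independent of $n$ and $p$. -}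

module Defs where

open import Data.Bool.Base using (Bool; true; false; T; _xor_)
open import Data.Fin.Base using (Fin)
open import Data.Fin.Subset using (Subset; _∈_; ∣_∣)
open import Data.List.Base as List using (List; []; _∷_; _++_; _∷ʳ_; length; replicate)
open import Data.List.Extrema.Nat using (max)
open import Data.List.Relation.Unary.Linked using (Linked)
open import Data.List.Relation.Unary.Unique.Propositional using (Unique)
open import Data.Maybe.Base using (Maybe; just; nothing)
open import Data.Nat.Base using (ℕ; zero; suc; _*_; _∸_; _^_; _≤_; _<_)
open import Data.Product.Base using (Σ; ∃-syntax; _×_; _,_)
open import Data.Sum.Base as Sum using (_⊎_; [_,_]′)
open import Data.Vec.Base as Vec using (Vec)
open import Function.Base using (_∘_)
open import Function.Bundles using (_↔_)
open import Relation.Binary.Construct.Closure.ReflexiveTransitive using (Star)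
open import Relation.Binary.PropositionalEquality using (_≡_)
open import Relation.Nullary.Negation using (¬_)
open import Relation.Nullary.Reflects using (Reflects)

------------------------------------------------------------------------
-- Graphs and treewidth

record Graph : Set where
  field
    order       : ℕ
    adj         : Fin order → Fin order → Bool
    symmetric   : ∀ u v → adj u v ≡ adj v u
    irreflexive : ∀ v → adj v v ≡ false

  Vertex : Set
  Vertex = Fin order

  Adjacent : Vertex → Vertex → Set
  Adjacent u v = T (adj u v)

open Graph using (order; Vertex; Adjacent)

-- The cycle visits v, then the vertices of vs in order, then v again;
-- it has 1 + length vs ≥ 3 distinct vertices.
record Cycle (G : Graph) : Set where
  field
    v        : Vertex G
    vs       : List (Vertex G)
    long     : 2 ≤ length vs
    distinct : Unique (v ∷ vs)
    closed   : Linked (Adjacent G) (v ∷ (vs ∷ʳ v))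

record IsTree (G : Graph) : Set where
  field
    nonempty  : Vertex G
    connected : ∀ u v → Star (Adjacent G) u v
    acyclic   : ¬ Cycle G

record TreeDecomposition (G : Graph) : Set where
  field
    tree   : Graph
    isTree : IsTree tree
    bag    : Vertex tree → Subset (order G)

  -- Edges of the subgraph of the tree induced by the nodes whose bag
  -- contains v.
  AdjacentWithin : Vertex G → Vertex tree → Vertex tree → Set
  AdjacentWithin v i j = v ∈ bag i × v ∈ bag j × Adjacent tree i j

  field
    coversVertices : ∀ v → ∃[ i ] v ∈ bag i
    coversEdges    : ∀ u v → Adjacent G u v → ∃[ i ] (u ∈ bag i × v ∈ bag i)
    coherent       : ∀ v i j → v ∈ bag i → v ∈ bag j → Star (AdjacentWithin v) i j

  width : ℕ
  width = max 0 (List.tabulate (∣_∣ ∘ bag)) ∸ 1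

-- Treewidth is the minimum width of a tree decomposition, so it is at
-- most t exactly when some decomposition has width at most t.
TreewidthAtMost : Graph → ℕ → Set
TreewidthAtMost G t = Σ (TreeDecomposition G) λ D → TreeDecomposition.width D ≤ t

------------------------------------------------------------------------
-- Independent set reconfiguration

Independent : (G : Graph) → Subset (order G) → Set
Independent G A = ∀ u v → u ∈ A → v ∈ A → ¬ Adjacent G u v

_△_ : ∀ {n} → Subset n → Subset n → Subset n
_△_ = Vec.zipWith _xor_

-- The nodes and edges of R_IS(G, k-1, k).
module ReconfigurationGraph (G : Graph) (k : ℕ) where

  IsNode : Subset (order G) → Set
  IsNode A = Independent G A × (∣ A ∣ ≡ k ∸ 1 ⊎ ∣ A ∣ ≡ k)

  _~_ : Subset (order G) → Subset (order G) → Set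
  A ~ B = IsNode A × IsNode B × ∣ A △ B ∣ ≡ 1

record ISRInstance : Set where
  field
    graph              : Graph
    k                  : ℕ
    k-positive         : 0 < k
    source target      : Subset (order graph)
    source-independent : Independent graph source
    target-independent : Independent graph target
    source-size        : ∣ source ∣ ≡ k
    target-size        : ∣ target ∣ ≡ k

  Reconfigurable : Set
  Reconfigurable = Star _~_ source target
    where open ReconfigurationGraph graph k

------------------------------------------------------------------------
-- Deterministic multitape Turing machines

data TapeSymbol (marks : ℕ) : Set where
  blank : TapeSymbol marks
  bit   : Bool → TapeSymbol marks
  mark  : Fin marks → TapeSymbol marks

data Move : Set where
  moveLeft stay moveRight : Move

-- A two-way infinite tape: `left` is read outwards from the head, and
-- the cells beyond both lists are blank.
record Tape (marks : ℕ) : Set where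
  constructor tape
  field
    left  : List (TapeSymbol marks)
    head  : TapeSymbol marks
    right : List (TapeSymbol marks)

module _ {marks : ℕ} where

  shift : Move → Tape marks → Tape marks
  shift stay      t                   = t
  shift moveLeft  (tape []       h r) = tape [] blank (h ∷ r)
  shift moveLeft  (tape (x ∷ l)  h r) = tape l x (h ∷ r)
  shift moveRight (tape l h [])       = tape (h ∷ l) blank []
  shift moveRight (tape l h (x ∷ r))  = tape (h ∷ l) x r

  writeMove : TapeSymbol marks × Move → Tape marks → Tape marks
  writeMove (s , m) (tape l _ r) = shift m (tape l s r)

  emptyTape : Tape marks
  emptyTape = tape [] blank []

  inputTape : List Bool → Tape marks
  inputTape []       = emptyTape
  inputTape (b ∷ bs) = tape [] (bit b) (List.map bit bs)

record TuringMachine : Set₁ where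
  field
    State     : Set
    stateSize : ℕ
    finite    : State ↔ Fin stateSize
    marks     : ℕ
    workTapes : ℕ
    start     : State

  tapes : ℕ
  tapes = suc workTapes

  -- `inj₁ b` halts, accepting if b is true and rejecting otherwise.
  field
    δ : State → Vec (TapeSymbol marks) tapes →
        Bool ⊎ (State × Vec (TapeSymbol marks × Move) tapes)

  Configuration : Set
  Configuration = State × Vec (Tape marks) tapes

  initial : List Bool → Configuration
  initial w = start , inputTape w Vec.∷ Vec.replicate workTapes emptyTape

  step : Configuration → Bool ⊎ Configuration
  step (q , ts) =
    Sum.map₂ (λ (q′ , as) → q′ , Vec.zipWith writeMove as ts)
             (δ q (Vec.map Tape.head ts))

  -- The verdict, provided the machine halts within the given number of
  -- steps; the halting transition itself counts as a step.
  runFor : ℕ → Configuration → Maybe Bool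
  runFor zero    c = nothing
  runFor (suc s) c = [ just , runFor s ]′ (step c)

------------------------------------------------------------------------
-- Parameterized problems

-- `encode i` is the string x of the input (x , p), and `parameter i` is
-- p.  The behaviour of an algorithm on strings that encode no input is
-- not constrained.
record ParameterizedProblem : Set₁ where
  field
    Input              : Set
    encode             : Input → List Bool
    parameter          : Input → ℕ
    parameter-positive : ∀ i → 0 < parameter i
    Yes                : Input → Set

unary : ℕ → List Bool
unary n = replicate n true ∷ʳ false

-- The machine receives p in unary followed by x.
FixedParameterTractable : ParameterizedProblem → Set₁
FixedParameterTractable P =
  Σ TuringMachine λ M → let open TuringMachine M in
  Σ (ℕ → ℕ) λ f → Σ ℕ λ c →
  ∀ (i : Input) → Σ Bool λ b →
    runFor (f (parameter i) * length (encode i) ^ c)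
           (initial (unary (parameter i) ++ encode i)) ≡ just b
    × Reflects (Yes i) b
  where open ParameterizedProblem P

------------------------------------------------------------------------
-- ISR as a parameterized problem

encodeSubset : ∀ {n} → Subset n → List Bool
encodeSubset = Vec.toList

-- The number of vertices in unary, then the adjacency matrix row by row.
encodeGraph : Graph → List Bool
encodeGraph G =
  unary (order G) ++
  List.concat (List.tabulate λ u → List.tabulate λ v → Graph.adj G u v)

encodeISR : ISRInstance → List Bool
encodeISR I = encodeGraph graph ++ encodeSubset source ++ encodeSubset target
  where open ISRInstance I

-- The promise that the treewidth is at most t restricts the inputs; no
-- decomposition is part of the encoding.
ISR-treewidth≤ : ℕ → ParameterizedProblem
ISR-treewidth≤ t = record
  { Input              = Σ ISRInstance λ I → TreewidthAtMost (ISRInstance.graph I) t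
  ; encode             = λ (I , _) → encodeISR I
  ; parameter          = λ (I , _) → ISRInstance.k I
  ; parameter-positive = λ (I , _) → ISRInstance.k-positive I
  ; Yes                = λ (I , _) → ISRInstance.Reconfigurable I
  }

{-# OPTIONS --safe #-}

-- A graph of treewidth at most t has no biclique with more than t + 1 vertices on both sides:
-- root the tree of a decomposition and let v be the vertex of the biclique whose highest bag is
-- deepest; this bag contains all vertices on the other side.
--
-- Let W be the set of the vertices outside source and target.  Replace W by W ∩ N(x) as long as
-- some x makes it smaller, but by a factor of at most k + 2.  Each time the vertices of W gain a
-- common neighbour, so a large set W shrinks at most t + 1 times before the biclique bound makes
-- it small, and it stays large if it was large at first.  In the end every vertex that is not
-- adjacent to all of W is adjacent to less than a fraction 1 / (k + 2) of it.  If moreover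
-- |W| > (k + 1)², then any k + 1 such vertices leave some w ∈ W free, hence a token on v ∈ W can
-- always be replaced by one on another vertex of W, and v can be deleted.  When this stops, the
-- number of vertices is bounded in terms of k, and all their subsets can be explored.
--
-- The algorithm is a program with bounded loops, immutable counters and arrays of bits.  Each
-- array is a tape and each counter is the position of a head, so that the running time is
-- polynomial in the order of the graph and in the number 2 ^ g(k) of subsets.

module Submission where

open import Defs
open import Data.Nat.Base using (ℕ)

-- A decomposition serves only to exclude bicliques; none is ever computed, and `t` enters the
-- machine only through the constant `r = t + 1`, the largest possible size of a bag. The fraction 1
-- / (k + 2) is made for k + 1 vertices at once: the at most k tokens of the current set, and the
-- vertex that presently holds the token of v and may have to be exchanged. Source and target stay
-- outside W so that no deletion touches the two ends of the path. A running time of the form f(k)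
-- n^c needs the exponential part separated from the length. Hence 2 ^ g(k) is computed once and
-- kept as a number N beside n and k. What follows costs a polynomial in k + n + N whose degree is
-- fixed by the program text, because the bound of every loop is the value of an expression and such
-- values are bounded polynomially by the syntax. A power of k + n + N is at most a function of k
-- times a power of the length.

module TapePrograms where

  open import Data.Bool.Base using (Bool; true; false; if_then_else_)
  open import Data.Fin.Base using (Fin; zero; suc; toℕ)
  open import Data.Fin.Properties as Finₚ using (+↔⊎; 1↔⊤; toℕ-fromℕ<; toℕ-injective)
  open import Data.List.Base using (List; [])
  open import Data.Maybe.Base using (just)
  open import Data.Nat.Base
  open import Data.Nat.DivMod using (_mod_; m<n⇒m%n≡m; m%n<n)
  open import Data.Nat.Properties
  open import Data.Product.Base using (_×_; _,_)
  open import Data.Sum.Base as Sum using (_⊎_; inj₁; inj₂)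
  open import Data.Sum.Function.Propositional using (_⊎-↔_)
  open import Data.Unit.Base using (⊤; tt)
  open import Data.Vec.Base as Vec using (Vec; _∷_; lookup; tabulate)
  open import Data.Vec.Properties
  open import Function.Base using (_∘_)
  open import Function.Bundles using (_↔_)
  open import Function.Construct.Composition using (_↔-∘_)
  open import Function.Construct.Symmetry using (↔-sym)
  open import Relation.Binary.PropositionalEquality
  open import Relation.Nullary.Decidable using (Dec; does; yes; no; dec-true; dec-false)

  -- One mark is enough: it is the wall at which the head of every work tape starts.
  Sym : Set
  Sym = TapeSymbol 1

  Tapes : Set
  Tapes = ℕ → Tape 1

  -- Unlike _≟_, this one does not compute to _≡ᵇ_, so that `with` can abstract it.
  same? : (i j : ℕ) → Dec (i ≡ j)
  same? zero    zero    = yes refl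
  same? zero    (suc j) = no λ ()
  same? (suc i) zero    = no λ ()
  same? (suc i) (suc j) with same? i j
  ... | yes i≡j = yes (cong suc i≡j)
  ... | no  i≢j = no λ e → i≢j (suc-injective e)

  upd : {X : Set} → (ℕ → X) → ℕ → X → ℕ → X
  upd f i x j = if does (same? j i) then x else f j

  upd-at : {X : Set} (f : ℕ → X) (i : ℕ) {x : X} → upd f i x i ≡ x
  upd-at f i rewrite dec-true (same? i i) refl = refl

  upd-off : {X : Set} (f : ℕ → X) {i j : ℕ} {x : X} → j ≢ i → upd f i x j ≡ f j
  upd-off f {i} {j} j≢i rewrite dec-false (same? j i) j≢i = refl

  infixr 4 _⨟_

  -- Structured tape programs and their running time

  data Prog : Set where
    act   : ℕ → (Sym → Sym × Move) → Prog
    _⨟_   : Prog → Prog → Prog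
    while : ℕ → (Sym → Bool) → Prog → Prog

  infix 3 _⊢_⇓[_]_

  -- Every action and every loop test costs 1, as many steps as the machine spends on it, so the
  -- index is the exact running time and not merely a bound.
  data _⊢_⇓[_]_ : Prog → Tapes → ℕ → Tapes → Set where
    act  : ∀ {i f ts} → act i f ⊢ ts ⇓[ 1 ] upd ts i (writeMove (f (Tape.head (ts i))) (ts i))
    seq  : ∀ {p q ts us vs c d} →
           p ⊢ ts ⇓[ c ] us → q ⊢ us ⇓[ d ] vs → p ⨟ q ⊢ ts ⇓[ c + d ] vs
    stop : ∀ {i b p ts} → b (Tape.head (ts i)) ≡ false → while i b p ⊢ ts ⇓[ 1 ] ts
    loop : ∀ {i b p ts us vs c d} → b (Tape.head (ts i)) ≡ true →
           p ⊢ ts ⇓[ c ] us → while i b p ⊢ us ⇓[ d ] vs → while i b p ⊢ ts ⇓[ suc (c + d) ] vs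

  maxTape : Prog → ℕ
  maxTape (act i f)     = i
  maxTape (p ⨟ q)       = maxTape p ⊔ maxTape q
  maxTape (while i b p) = i ⊔ maxTape p

  -- Program counters: one for each action and one for each loop test, the places where the machine
  -- spends a step.
  Pos : Prog → Set
  Pos (act i f)     = ⊤
  Pos (p ⨟ q)       = Pos p ⊎ Pos q
  Pos (while i b p) = ⊤ ⊎ Pos p

  first : ∀ p → Pos p
  first (act i f)     = tt
  first (p ⨟ q)       = inj₁ (first p)
  first (while i b p) = inj₁ tt

  size : Prog → ℕ
  size (act i f)     = 1
  size (p ⨟ q)       = size p + size q
  size (while i b p) = 1 + size p

  ⊎-finite : ∀ {A B : Set} {m n} → A ↔ Fin m → B ↔ Fin n → (A ⊎ B) ↔ Fin (m + n)
  ⊎-finite f g = ↔-sym +↔⊎ ↔-∘ (f ⊎-↔ g)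

  Pos-finite : ∀ p → Pos p ↔ Fin (size p)
  Pos-finite (act i f)     = ↔-sym 1↔⊤
  Pos-finite (p ⨟ q)       = ⊎-finite (Pos-finite p) (Pos-finite q)
  Pos-finite (while i b p) = ⊎-finite (↔-sym 1↔⊤) (Pos-finite p)

  -- The test for a nonzero counter. A blank counts as positive, since only the wall stands for the
  -- value 0.
  positive : Sym → Bool
  positive (mark _) = false
  positive _        = true

  -- The tapes after the start transition, which marks every work tape.
  markedTapes : List Bool → Tapes
  markedTapes w zero    = inputTape w
  markedTapes w (suc _) = tape [] (mark zero) []

  -- Turing machines that simulate tape programs

  module Machine (P : Prog) (out W : ℕ) (P≤W : maxTape P ≤ W) (out≤W : out ≤ W) where

    -- Programs name tapes by arbitrary numbers; the remainder makes the index total and changes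
    -- nothing up to `W`.
    ix : ℕ → Fin (suc W)
    ix i = i mod suc W

    toℕ-ix : ∀ {i} → i ≤ W → toℕ (ix i) ≡ i
    toℕ-ix {i} i≤W = trans (toℕ-fromℕ< (m%n<n i (suc W))) (m<n⇒m%n≡m (s≤s i≤W))

    actions : Vec Sym (suc W) → ℕ → (Sym → Sym × Move) → Vec (Sym × Move) (suc W)
    actions ss i f = tabulate λ j →
      if does (j Finₚ.≟ ix i) then f (lookup ss j) else (lookup ss j , stay)

    -- `emb` places the counters of a subprogram among the states of the whole, and `exit` is where
    -- control goes afterwards: from the first half of a sequence to the start of the second, from
    -- the body of a loop back to its test.
    next : ∀ {S : Set} p → (Pos p → S) → S → Pos p → Vec Sym (suc W) →
           S × Vec (Sym × Move) (suc W)
    next (act i f) emb exit tt ss = exit , actions ss i f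
    next (p ⨟ q) emb exit (inj₁ x) ss = next p (emb ∘ inj₁) (emb (inj₂ (first q))) x ss
    next (p ⨟ q) emb exit (inj₂ y) ss = next q (emb ∘ inj₂) exit y ss
    next (while i b p) emb exit (inj₁ tt) ss =
      -- A test writes back the symbols that it has read, so it spends a step without changing a
      -- tape.
      (if b (lookup ss (ix i)) then emb (inj₂ (first p)) else exit) , actions ss 0 (_, stay)
    next (while i b p) emb exit (inj₂ y) ss = next p (emb ∘ inj₂) (emb (inj₁ tt)) y ss

    State : Set
    State = ⊤ ⊎ (Pos P ⊎ ⊤)

    δ : State → Vec Sym (suc W) → Bool ⊎ (State × Vec (Sym × Move) (suc W))
    δ (inj₁ _) (s ∷ _) = inj₂ (inj₂ (inj₁ (first P)) , (s , stay) ∷ Vec.replicate W (mark zero , stay))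
    δ (inj₂ (inj₁ x)) ss = inj₂ (next P (inj₂ ∘ inj₁) (inj₂ (inj₂ tt)) x ss)
    δ (inj₂ (inj₂ _)) ss = inj₁ (positive (lookup ss (ix out)))

    machine : TuringMachine
    machine = record
      { State     = State
      ; stateSize = 1 + (size P + 1)
      ; finite    = ⊎-finite (↔-sym 1↔⊤) (⊎-finite (Pos-finite P) (↔-sym 1↔⊤))
      ; marks     = 1
      ; workTapes = W
      ; start     = inj₁ tt
      ; δ         = δ
      }

    open TuringMachine machine using (runFor; step; initial)

    tab : Tapes → Vec (Tape 1) (suc W)
    tab ts = tabulate (ts ∘ toℕ)

    ≡-tabulate : ∀ {A : Set} {n} (xs : Vec A n) {g : Fin n → A} →
                 (∀ j → lookup xs j ≡ g j) → xs ≡ tabulate g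
    ≡-tabulate xs h = trans (sym (tabulate∘lookup xs)) (tabulate-cong h)

    lookup-heads : ∀ ts j → lookup (Vec.map Tape.head (tab ts)) j ≡ Tape.head (ts (toℕ j))
    lookup-heads ts j = trans (lookup-map j Tape.head (tab ts)) (cong Tape.head (lookup∘tabulate (ts ∘ toℕ) j))

    lookup-head : ∀ ts {i} → i ≤ W → lookup (Vec.map Tape.head (tab ts)) (ix i) ≡ Tape.head (ts i)
    lookup-head ts {i} i≤W = trans (lookup-heads ts (ix i)) (cong (Tape.head ∘ ts) (toℕ-ix i≤W))

    actions-correct : ∀ ts {i} f → i ≤ W →
      Vec.zipWith writeMove (actions (Vec.map Tape.head (tab ts)) i f) (tab ts) ≡
      tab (upd ts i (writeMove (f (Tape.head (ts i))) (ts i)))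
    actions-correct ts {i} f i≤W = ≡-tabulate _ λ j →
      trans (lookup-zipWith writeMove j (actions ss i f) (tab ts))
            (trans (cong₂ writeMove (lookup∘tabulate action j) (lookup∘tabulate (ts ∘ toℕ) j)) (at j))
      where
      ss = Vec.map Tape.head (tab ts)
      action : Fin (suc W) → Sym × Move
      action j = if does (j Finₚ.≟ ix i) then f (lookup ss j) else (lookup ss j , stay)
      at : ∀ j → writeMove (if does (j Finₚ.≟ ix i) then f (lookup ss j) else (lookup ss j , stay)) (ts (toℕ j))
               ≡ upd ts i (writeMove (f (Tape.head (ts i))) (ts i)) (toℕ j)
      at j rewrite lookup-heads ts j with j Finₚ.≟ ix i
      ... | yes refl rewrite toℕ-ix i≤W | dec-true (same? i i) refl = refl
      ... | no j≢i rewrite dec-false (same? (toℕ j) i) (λ e → j≢i (toℕ-injective (trans e (sym (toℕ-ix i≤W))))) = refl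

    tab-idle : ∀ ts → Vec.zipWith writeMove (actions (Vec.map Tape.head (tab ts)) 0 (_, stay)) (tab ts) ≡ tab ts
    tab-idle ts = trans (actions-correct ts (_, stay) z≤n) (tabulate-cong (unchanged ∘ toℕ))
      where
      unchanged : ∀ j → upd ts 0 (ts 0) j ≡ ts j
      unchanged zero    = refl
      unchanged (suc j) = refl

    one-step : ∀ {q q′ as ts} r → δ q (Vec.map Tape.head ts) ≡ inj₂ (q′ , as) →
               runFor (suc r) (q , ts) ≡ runFor r (q′ , Vec.zipWith writeMove as ts)
    one-step r eq rewrite eq = refl

    -- Induction on the derivation, for an arbitrary placement of the subprogram among the states.
    -- The surplus `r` of steps lets the claims for consecutive subprograms compose.
    simulate : ∀ {p ts ts′ c} (emb : Pos p → State) (exit : State) →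
      (∀ x ss → δ (emb x) ss ≡ inj₂ (next p emb exit x ss)) → maxTape p ≤ W →
      p ⊢ ts ⇓[ c ] ts′ → ∀ r →
      runFor (c + r) (emb (first p) , tab ts) ≡ runFor r (exit , tab ts′)
    simulate {ts = ts} emb exit hyp i≤W (act {f = f}) r =
      trans (one-step r (hyp tt _)) (cong (λ v → runFor r (exit , v)) (actions-correct ts f i≤W))
    simulate {p = p ⨟ q} emb exit hyp pq≤W (seq {c = c} {d} ⇓p ⇓q) r
      rewrite +-assoc c d r = trans
        (simulate (emb ∘ inj₁) (emb (inj₂ (first q))) (hyp ∘ inj₁) (m⊔n≤o⇒m≤o (maxTape p) _ pq≤W) ⇓p (d + r))
        (simulate (emb ∘ inj₂) exit (hyp ∘ inj₂) (m⊔n≤o⇒n≤o (maxTape p) _ pq≤W) ⇓q r)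
    simulate {ts = ts} emb exit hyp ip≤W (stop {i} {b} {p} eq) r =
      trans (one-step r (trans (hyp (inj₁ tt) _) (cong (λ z → inj₂ (z , _)) branch)))
            (cong (λ v → runFor r (exit , v)) (tab-idle ts))
      where
      branch : (if b (lookup (Vec.map Tape.head (tab ts)) (ix i)) then emb (inj₂ (first p)) else exit) ≡ exit
      branch = cong (λ z → if z then emb (inj₂ (first p)) else exit)
                    (trans (cong b (lookup-head ts (m⊔n≤o⇒m≤o i _ ip≤W))) eq)
    simulate {ts = ts} emb exit hyp ip≤W (loop {i} {b} {p} {c = c} {d} eq ⇓p ⇓w) r
      rewrite +-assoc c d r =
      trans (one-step (c + (d + r)) (trans (hyp (inj₁ tt) _) (cong (λ z → inj₂ (z , _)) branch))) (
      trans (cong (λ v → runFor (c + (d + r)) (emb (inj₂ (first p)) , v)) (tab-idle ts)) (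
      trans (simulate (emb ∘ inj₂) (emb (inj₁ tt)) (hyp ∘ inj₂) (m⊔n≤o⇒n≤o i _ ip≤W) ⇓p (d + r))
            (simulate emb exit hyp ip≤W ⇓w r)))
      where
      branch : (if b (lookup (Vec.map Tape.head (tab ts)) (ix i)) then emb (inj₂ (first p)) else exit) ≡ emb (inj₂ (first p))
      branch = cong (λ z → if z then emb (inj₂ (first p)) else exit)
                    (trans (cong b (lookup-head ts (m⊔n≤o⇒m≤o i _ ip≤W))) eq)

    startup : ∀ w r → runFor (suc r) (initial w) ≡ runFor r (inj₂ (inj₁ (first P)) , tab (markedTapes w))
    startup w r = cong (λ v → runFor r (inj₂ (inj₁ (first P)) , v)) (≡-tabulate _ pointwise)
      where
      pointwise : ∀ j → lookup (Vec.zipWith writeMove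
                    ((Tape.head (inputTape w) , stay) ∷ Vec.replicate W (mark zero , stay))
                    (inputTape w ∷ Vec.replicate W emptyTape)) j ≡ markedTapes w (toℕ j)
      pointwise zero = refl
      pointwise (suc j) = trans (lookup-zipWith writeMove j (Vec.replicate W _) (Vec.replicate W _))
        (cong₂ writeMove (lookup-replicate j _) (lookup-replicate j _))

    -- The two additional steps are the start transition, which writes the walls, and the halting
    -- transition.
    machine-correct : ∀ {w c ts} → P ⊢ markedTapes w ⇓[ c ] ts →
      runFor (2 + c) (initial w) ≡ just (positive (Tape.head (ts out)))
    machine-correct {w} {c} {ts} run = begin
      runFor (2 + c) (initial w)    ≡⟨ cong (λ s → runFor s (initial w)) (+-comm 1 (suc c)) ⟩
      runFor (suc (c + 1)) (initial w) ≡⟨ startup w (c + 1) ⟩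
      runFor (c + 1) _              ≡⟨ simulate (inj₂ ∘ inj₁) (inj₂ (inj₂ tt)) (λ _ _ → refl) P≤W run 1 ⟩
      just (positive (lookup (Vec.map Tape.head (tab ts)) (ix out)))
                                    ≡⟨ cong (just ∘ positive) (lookup-head ts out≤W) ⟩
      just (positive (Tape.head (ts out))) ∎
      where open ≡-Reasoning

  runFor-mono : ∀ M {r s c b} → let open TuringMachine M in
                r ≤ s → runFor r c ≡ just b → runFor s c ≡ just b
  runFor-mono M {suc r} {suc s} {c} (s≤s r≤s) eq with TuringMachine.step M c
  ... | inj₁ _ = eq
  ... | inj₂ _ = runFor-mono M r≤s eq

-- Tapes as counters and as arrays

module TapeStates where

  open TapePrograms
  open import Data.Bool.Base using (Bool; true; false; if_then_else_)
  open import Data.Fin.Base as Fin using ()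
  open import Data.List.Base as List using (List; []; _∷_; downFrom)
  open import Data.List.Properties using (∷-injective; map-cong)
  open import Data.Nat.Base
  open import Data.Nat.Properties
  open import Data.Product.Base using (∃-syntax; _×_; _,_)
  open import Function.Base using (_∘_)
  open import Relation.Binary.PropositionalEquality
  open import Relation.Nullary.Decidable using (yes; no)

  open Tape

  cell : List Sym → ℕ → Sym
  cell []       i       = blank
  cell (x ∷ xs) zero    = x
  cell (x ∷ xs) (suc i) = cell xs i

  -- The left side is the exact list, so that a head at position `p` has `p` cells to its left. The
  -- right side is compared cell by cell, because lists that differ only in trailing blanks describe
  -- the same half of a tape.
  record At (t : Tape 1) (p : ℕ) (f : ℕ → Sym) : Set where
    constructor at
    field
      leftAt  : left t ≡ List.map f (downFrom p)
      headAt  : head t ≡ f p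
      rightAt : ∀ i → cell (right t) i ≡ f (suc (i + p))

  open At

  at-cong : ∀ {t p f g} → f ≗ g → At t p f → At t p g
  at-cong f≗g (at l h r) = at (trans l (map-cong f≗g _)) (trans h (f≗g _)) (λ i → trans (r i) (f≗g _))

  moveRight-at : ∀ {t p f} → At t p f → At (writeMove (head t , moveRight) t) (suc p) f
  moveRight-at {tape l h []} {p} {f} (at refl refl r) =
    at refl (r 0) (λ i → trans (r (suc i)) (cong (f ∘ suc) (sym (+-suc i p))))
  moveRight-at {tape l h (x ∷ xs)} {p} {f} (at refl refl r) =
    at refl (r 0) (λ i → trans (r (suc i)) (cong (f ∘ suc) (sym (+-suc i p))))

  moveLeft-at : ∀ {t p f} → At t (suc p) f → At (writeMove (head t , moveLeft) t) p f
  moveLeft-at {tape (x ∷ l) h r₀} {p} {f} (at l≡ h≡ r) with ∷-injective l≡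
  ... | x≡ , l≡′ = at l≡′ x≡ λ where
    zero    → h≡
    (suc i) → trans (r i) (cong (f ∘ suc) (+-suc i p))

  map-upd-downFrom : ∀ (f : ℕ → Sym) s {p q} → p ≤ q → List.map f (downFrom p) ≡ List.map (upd f q s) (downFrom p)
  map-upd-downFrom f s {zero}  _   = refl
  map-upd-downFrom f s {suc p} p<q =
    cong₂ _∷_ (sym (upd-off f (<⇒≢ p<q))) (map-upd-downFrom f s (<⇒≤ p<q))

  write-at : ∀ {t p f} s → At t p f → At (writeMove (s , stay) t) p (upd f p s)
  write-at {p = p} {f} s (at l h r) =
    at (trans l (map-upd-downFrom f s ≤-refl)) (sym (upd-at f p))
       (λ i → trans (r i) (sym (upd-off f λ e → m≢1+n+m p (sym e))))

  -- The entry `false` is a blank, so a tape with nothing but the wall is an array filled with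
  -- `false`.
  symbol : Bool → Sym
  symbol true  = bit true
  symbol false = blank

  -- The wall (a mark) is at position 0, so entry i of an array is at position suc i.
  cells : (ℕ → Bool) → ℕ → Sym
  cells c zero    = mark Fin.zero
  cells c (suc i) = symbol (c i)

  isTrue : Sym → Bool
  isTrue (bit b) = b
  isTrue _       = false

  isTrue-symbol : ∀ b → isTrue (symbol b) ≡ b
  isTrue-symbol true  = refl
  isTrue-symbol false = refl

  positive-symbol : ∀ b → positive (symbol b) ≡ true
  positive-symbol true  = refl
  positive-symbol false = refl

  -- Work tape suc i serves both as a counter, whose value is the head position pos i,
  -- and as an array with entries con i; the input tape is tape 0.
  record State : Set where
    constructor state
    field
      inp : Tape 1
      pos : ℕ → ℕ
      con : ℕ → ℕ → Bool

  open State

  record Rep (ts : Tapes) (S : State) : Set where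
    constructor rep
    field
      input : ts 0 ≡ inp S
      work  : ∀ i → At (ts (suc i)) (pos S i) (cells (con S i))

  open Rep

  record _≐_ (S S′ : State) : Set where
    constructor eqv
    field
      inp≡ : inp S ≡ inp S′
      pos≡ : pos S ≗ pos S′
      con≡ : ∀ i → con S i ≗ con S′ i

  open _≐_

  cells-cong : ∀ {c d} → c ≗ d → cells c ≗ cells d
  cells-cong h zero    = refl
  cells-cong h (suc i) = cong symbol (h i)

  rep-cong : ∀ {ts S S′} → S ≐ S′ → Rep ts S → Rep ts S′
  rep-cong {ts} (eqv e p c) (rep i w) =
    rep (trans i e) (λ j → at-cong (cells-cong (c j)) (subst (λ q → At (ts (suc j)) q _) (p j) (w j)))

  -- Unlike the index of the semantics, `c` is only an upper bound; it can then be computed from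
  -- bounds on the values instead of the values themselves.
  Exec : Prog → ℕ → State → State → Set
  Exec p c S S′ = ∀ {ts} → Rep ts S → ∃[ ts′ ] ∃[ d ] (d ≤ c × p ⊢ ts ⇓[ d ] ts′ × Rep ts′ S′)

  exec-post : ∀ {p c S S′ S″} → S′ ≐ S″ → Exec p c S S′ → Exec p c S S″
  exec-post eq ex r with ex r
  ... | _ , _ , le , run , r′ = _ , _ , le , run , rep-cong eq r′

  exec-pre : ∀ {p c S S′ S″} → S ≐ S′ → Exec p c S′ S″ → Exec p c S S″
  exec-pre eq ex r = ex (rep-cong eq r)

  exec-≤ : ∀ {p c d S S′} → c ≤ d → Exec p c S S′ → Exec p d S S′
  exec-≤ c≤d ex r with ex r
  ... | _ , _ , le , rest = _ , _ , ≤-trans le c≤d , rest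

  infixr 4 _▷_

  _▷_ : ∀ {p q c d S S′ S″} → Exec p c S S′ → Exec q d S′ S″ → Exec (p ⨟ q) (c + d) S S″
  (ex ▷ ey) r with ex r
  ... | _ , _ , le , run , r′ with ey r′
  ... | _ , _ , le′ , run′ , r″ = _ , _ , +-mono-≤ le le′ , seq run run′ , r″

  setPos : State → ℕ → ℕ → State
  setPos S i v = record S { pos = upd (pos S) i v }

  setCon : State → ℕ → (ℕ → Bool) → State
  setCon S i c = record S { con = upd (con S) i c }

  rep-act : ∀ {ts S p c t} i → Rep ts S → At t p (cells c) →
            Rep (upd ts (suc i) t) (setCon (setPos S i p) i c)
  rep-act {ts} {S} {p} {c} {t} i (rep e w) h = rep e go
    where
    go : ∀ j → At (upd ts (suc i) t (suc j)) (upd (pos S) i p j) (cells (upd (con S) i c j))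
    go j with same? j i
    ... | yes refl = h
    ... | no j≢i = w j

  setCon-id : ∀ S i → setCon S i (con S i) ≐ S
  setCon-id S i = eqv refl (λ _ → refl) go
    where
    go : ∀ j → upd (con S) i (con S i) j ≗ con S j
    go j k with same? j i
    ... | yes refl = refl
    ... | no _     = refl

  setPos-id : ∀ S i → setPos S i (pos S i) ≐ S
  setPos-id S i = eqv refl go (λ _ _ → refl)
    where
    go : ∀ j → upd (pos S) i (pos S i) j ≡ pos S j
    go j with same? j i
    ... | yes refl = refl
    ... | no _     = refl

  -- On the wall, `dec` stays and `write` has no effect. So `dec` is the truncated predecessor, and
  -- neither of them destroys the wall.
  inc dec clear : ℕ → Prog
  inc i = act (suc i) (_, moveRight)
  dec i = act (suc i) (λ s → s , (if positive s then moveLeft else stay))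
  clear i = while (suc i) positive (dec i)

  nop : Prog
  nop = act 0 (_, stay)

  write : ℕ → Bool → Prog
  write i b = act (suc i) (λ s → (if positive s then symbol b else s) , stay)

  exec-nop : ∀ {S} → Exec nop 1 S S
  exec-nop {S} {ts} (rep e w) = _ , 1 , ≤-refl , act , rep e w

  exec-inc : ∀ {S} i → Exec (inc i) 1 S (setPos S i (suc (pos S i)))
  exec-inc {S} i {ts} r = _ , 1 , ≤-refl , act ,
    rep-cong (setCon-id (setPos S i (suc (pos S i))) i) (rep-act i r (moveRight-at (work r i)))

  head-positive : ∀ {t p c} → At t p (cells c) → positive (head t) ≡ (0 <ᵇ p)
  head-positive {p = zero}      (at _ h _) rewrite h = refl
  head-positive {p = suc p} {c} (at _ h _) rewrite h = positive-symbol (c p)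

  exec-dec : ∀ {S} i → Exec (dec i) 1 S (setPos S i (pred (pos S i)))
  exec-dec {S} i {ts} r = _ , 1 , ≤-refl , act ,
    rep-cong (setCon-id (setPos S i (pred (pos S i))) i) (rep-act i r (go (pos S i) (work r i)))
    where
    t = ts (suc i)
    go : ∀ p → At t p (cells (con S i)) →
         At (writeMove (head t , (if positive (head t) then moveLeft else stay)) t) (pred p) (cells (con S i))
    go zero    a rewrite head-positive a = a
    go (suc p) a rewrite head-positive a = moveLeft-at a

  exec-write : ∀ {S v} i b → pos S i ≡ suc v → Exec (write i b) 1 S (setCon S i (upd (con S i) v b))
  exec-write {S} {v} i b eq {ts} r = _ , 1 , ≤-refl , act ,
    rep-cong (eqv refl (λ j → trans (cong (λ p → upd (pos S) i p j) (sym eq)) (pos≡ (setPos-id S i) j)) (λ _ _ → refl))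
             (rep-act i r (go (subst (λ p → At (ts (suc i)) p _) eq (work r i))))
    where
    t = ts (suc i)
    written : upd (cells (con S i)) (suc v) (symbol b) ≗ cells (upd (con S i) v b)
    written zero = refl
    written (suc j) with same? j v
    ... | yes _ = refl
    ... | no  _ = refl
    go : At t (suc v) (cells (con S i)) →
         At (writeMove ((if positive (head t) then symbol b else head t) , stay) t) (suc v) (cells (upd (con S i) v b))
    go a rewrite head-positive a = at-cong written (write-at (symbol b) a)

  while-stop : ∀ {S p} i → pos S i ≡ 0 → Exec (while (suc i) positive p) 1 S S
  while-stop i eq r = _ , 1 , ≤-refl ,
    stop (trans (head-positive (work r i)) (cong (0 <ᵇ_) eq)) , r

  while-loop : ∀ {S S′ S″ p v c d} i → pos S i ≡ suc v → Exec p c S S′ →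
    Exec (while (suc i) positive p) d S′ S″ → Exec (while (suc i) positive p) (suc (c + d)) S S″
  while-loop i eq ex ey r with ex r
  ... | _ , _ , le , run , r′ with ey r′
  ... | _ , _ , le′ , run′ , r″ = _ , _ , s≤s (+-mono-≤ le le′) ,
    loop (trans (head-positive (work r i)) (cong (0 <ᵇ_) eq)) run run′ , r″

  head-isTrue : ∀ {t v c} → At t (suc v) (cells c) → isTrue (head t) ≡ c v
  head-isTrue {v = v} {c} (at _ h _) rewrite h = isTrue-symbol (c v)

  -- A one-shot conditional: the body leaves the head on the wall.
  exec-ifTrue : ∀ {S S′ p v c} i → pos S i ≡ suc v → pos S′ i ≡ 0 → Exec p c S S′ →
    Exec (while (suc i) isTrue p) (2 + c) S (if con S i v then S′ else S)
  exec-ifTrue {S} {S′} {p} {v} {c} i eq eq′ ex {ts} r with con S i v in cv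
  ... | false = _ , 1 , s≤s z≤n ,
    stop (trans (head-isTrue (subst (λ p → At (ts (suc i)) p _) eq (work r i))) cv) , r
  ... | true with ex r
  ... | ts′ , d , le , run , r′ = _ , suc (d + 1) , ≤-trans (≤-reflexive (cong suc (+-comm d 1))) (s≤s (s≤s le)) ,
    loop (trans (head-isTrue (subst (λ p → At (ts (suc i)) p _) eq (work r i))) cv) run
         (stop (cong isTrue (headAt (subst (λ p → At (ts′ (suc i)) p _) eq′ (work r′ i))))) , r′

  pos-cong : ∀ {S f g} → f ≗ g → record S { pos = f } ≐ record S { pos = g }
  pos-cong h = eqv refl h (λ _ _ → refl)

  countdown : ℕ → Prog → Prog
  countdown i p = while (suc i) positive (dec i ⨟ p)

  -- `S v` is the invariant when the counter shows `v`. The decrement precedes `p`, so the body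
  -- already sees `v` while everything else is still as in `S (suc v)`. A round pays for test,
  -- decrement and body; the final test pays for the extra 1.
  exec-countdown : ∀ {p c} i (S : ℕ → State) → (∀ v → pos (S v) i ≡ v) → ∀ n →
    (∀ v → v < n → Exec p c (setPos (S (suc v)) i v) (S v)) →
    Exec (countdown i p) (1 + n * (2 + c)) (S n) (S 0)
  exec-countdown i S posS zero body = while-stop i (posS 0)
  exec-countdown {p} {c} i S posS (suc v) body = exec-≤ (≤-reflexive cost)
    (while-loop i (posS (suc v))
      (exec-post (pos-cong {S = S (suc v)} (λ j → cong (λ q → upd (pos (S (suc v))) i q j) (cong pred (posS (suc v))))) (exec-dec i)
       ▷ body v ≤-refl)
      (exec-countdown i S posS v (λ w w<v → body w (m<n⇒m<1+n w<v))))
    where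
    cost : suc ((1 + c) + (1 + v * (2 + c))) ≡ 1 + (2 + c + v * (2 + c))
    cost = cong suc (trans (+-suc (suc c) _) refl)

  exec-clear : ∀ {S} i → Exec (clear i) (1 + 2 * pos S i) S (setPos S i 0)
  exec-clear {S} i = go (pos S i) refl
    where
    go : ∀ v {S} → pos S i ≡ v → Exec (clear i) (1 + 2 * v) S (setPos S i 0)
    go zero {S} eq = exec-post (eqv refl (λ j → trans (sym (pos≡ (setPos-id S i) j)) (cong (λ q → upd (pos S) i q j) eq)) (λ _ _ → refl))
                               (while-stop i eq)
    go (suc v) {S} eq = exec-≤ (≤-reflexive (cong suc (sym (trans (*-suc 2 v) refl))))
      (while-loop i eq (exec-dec i)
        (exec-post (pos-cong {S = S} twice) (go v (trans (upd-at (pos S) i) (cong pred eq)))))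
      where
      twice : ∀ j → upd (upd (pos S) i (pred (pos S i))) i 0 j ≡ upd (pos S) i 0 j
      twice j with same? j i
      ... | yes _ = refl
      ... | no _  = refl

  transfer : ℕ → ℕ → Prog
  transfer i k = countdown i (inc k)

  exec-transfer : ∀ {S} i k → i ≢ k →
    Exec (transfer i k) (1 + pos S i * 3) S (setPos (setPos S i 0) k (pos S k + pos S i))
  exec-transfer {S} i k i≢k = exec-pre start (exec-countdown i family atI (pos S i) body)
    where
    family : ℕ → State
    family v = setPos (setPos S i v) k (pos S k + (pos S i ∸ v))
    atI : ∀ v → pos (family v) i ≡ v
    atI v = trans (upd-off (upd (pos S) i v) i≢k) (upd-at (pos S) i)
    start : S ≐ family (pos S i)
    start = eqv refl go (λ _ _ → refl)
      where
      go : ∀ j → pos S j ≡ pos (family (pos S i)) j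
      go j with same? j k
      ... | yes refl rewrite n∸n≡0 (pos S i) = sym (+-identityʳ _)
      ... | no _ = sym (pos≡ (setPos-id S i) j)
    body : ∀ v → v < pos S i → Exec (inc k) 1 (setPos (family (suc v)) i v) (family v)
    body v v<i = exec-post (eqv refl go (λ _ _ → refl)) (exec-inc k)
      where
      T = setPos (family (suc v)) i v
      go : ∀ j → upd (pos T) k (suc (pos T k)) j ≡ pos (family v) j
      go j with same? j k | same? j i
      ... | no _     | yes _ = refl
      ... | no _     | no _  = refl
      ... | yes refl | _     = begin
        suc (pos T j)                  ≡⟨ cong suc (upd-off (pos (family (suc v))) (i≢k ∘ sym)) ⟩
        suc (pos (family (suc v)) j)   ≡⟨ cong suc (upd-at (upd (pos S) i (suc v)) j) ⟩
        suc (pos S j + (pos S i ∸ suc v)) ≡⟨ +-suc (pos S j) _ ⟨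
        pos S j + suc (pos S i ∸ suc v)   ≡⟨ cong (pos S j +_) (+-∸-assoc 1 v<i) ⟨
        pos S j + (pos S i ∸ v)           ∎
        where open ≡-Reasoning

-- A language with bounded loops, and its compiler

module Language where

  open TapePrograms
  open TapeStates
  open import Data.Bool.Base using (Bool; true; false)
  open import Data.Fin.Base as Fin using (Fin; toℕ)
  open import Data.Nat.Base
  open import Data.Nat.Properties
  open import Data.Vec.Base as Vec using (Vec; _∷_; lookup)
  open import Function.Base using (_∘_)
  open import Relation.Binary.PropositionalEquality
  open import Relation.Nullary.Decidable using (yes; no)

  open State

  Mem : Set
  Mem = ℕ → ℕ → Bool

  sumTo : ℕ → (ℕ → ℕ) → ℕ
  sumTo zero    f = 0
  sumTo (suc j) f = sumTo j f + f j

  -- The index descends to 0, in step with a counter that is being emptied. Invariants of loops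
  -- therefore speak of the indices from some `l` on.
  forTo : {X : Set} → ℕ → (ℕ → X → X) → X → X
  forTo zero    f x = x
  forTo (suc j) f x = forTo j f (f j x)

  b2n : Bool → ℕ
  b2n true  = 1
  b2n false = 0

  -- The work tapes with smaller numbers are arrays, whose heads rest on the wall between accesses;
  -- the others are counters.
  arrays : ℕ
  arrays = 6

  -- `sum` is the only iteration inside expressions; products, conjunctions and bounded quantifiers
  -- are derived from it. Weakening is a constructor that drops a variable of the environment, which
  -- avoids renaming lemmas.
  data Exp : ℕ → Set where
    var   : ∀ {n} → Fin n → Exp n
    wk    : ∀ {n} → Exp n → Exp (suc n)
    zero  : ∀ {n} → Exp n
    suc   : ∀ {n} → Exp n → Exp n
    _⊕_   : ∀ {n} → Exp n → Exp n → Exp n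
    _⊖_   : ∀ {n} → Exp n → Exp n → Exp n
    sum   : ∀ {n} → Exp n → Exp (suc n) → Exp n
    _!_   : ∀ {n} → Fin arrays → Exp n → Exp n

  -- A conditional is a `for` whose bound is 0 or 1.
  data Cmd : ℕ → Set where
    _⨾_     : ∀ {n} → Cmd n → Cmd n → Cmd n
    for     : ∀ {n} → Exp n → Cmd (suc n) → Cmd n
    _[_]:=_ : ∀ {n} → Fin arrays → Exp n → Exp n → Cmd n
    bind    : ∀ {n} → Exp n → Cmd (suc n) → Cmd n

  infixl 6 _⊕_ _⊖_
  infix  8 _!_
  infixr 4 _⨾_
  infix  5 _[_]:=_

  ⟦_⟧ : ∀ {n} → Exp n → Vec ℕ n → Mem → ℕ
  ⟦ var i ⟧   ρ       M = lookup ρ i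
  ⟦ wk e ⟧    (_ ∷ ρ) M = ⟦ e ⟧ ρ M
  ⟦ zero ⟧    ρ       M = 0
  ⟦ suc e ⟧   ρ       M = suc (⟦ e ⟧ ρ M)
  ⟦ a ⊕ b ⟧   ρ       M = ⟦ a ⟧ ρ M + ⟦ b ⟧ ρ M
  ⟦ a ⊖ b ⟧   ρ       M = ⟦ a ⟧ ρ M ∸ ⟦ b ⟧ ρ M
  ⟦ sum b s ⟧ ρ       M = sumTo (⟦ b ⟧ ρ M) λ j → ⟦ s ⟧ (j ∷ ρ) M
  ⟦ a ! e ⟧   ρ       M = b2n (M (toℕ a) (⟦ e ⟧ ρ M))

  set : Mem → ℕ → ℕ → Bool → Mem
  set M a i b = upd M a (upd (M a) i b)

  ⟪_⟫ : ∀ {n} → Cmd n → Vec ℕ n → Mem → Mem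
  ⟪ c ⨾ d ⟫       ρ M = ⟪ d ⟫ ρ (⟪ c ⟫ ρ M)
  ⟪ for e c ⟫     ρ M = forTo (⟦ e ⟧ ρ M) (λ j → ⟪ c ⟫ (j ∷ ρ)) M
  ⟪ a [ i ]:= e ⟫ ρ M = set M (toℕ a) (⟦ i ⟧ ρ M) (0 <ᵇ ⟦ e ⟧ ρ M)
  ⟪ bind e c ⟫    ρ M = ⟪ c ⟫ (⟦ e ⟧ ρ M ∷ ρ) M

  -- Reading a counter means emptying it. To copy a variable, it is moved to a scratch counter, from
  -- which the variable and its copy are then filled together.
  transfer₂ : ℕ → ℕ → ℕ → Prog
  transfer₂ i k m = countdown i (inc k ⨟ inc m)

  -- The variables occupy the counters `rs`, all below `l`. The value is left in counter `l`; the
  -- counters from `l` on are 0 before, and those above `l` are 0 again afterwards.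
  compE : ∀ {n} → Exp n → Vec ℕ n → ℕ → Prog
  compE (var i)   rs       l = transfer (lookup rs i) (suc l) ⨟ transfer₂ (suc l) (lookup rs i) l
  compE (wk e)    (_ ∷ rs) l = compE e rs l
  compE zero      rs       l = nop
  compE (suc e)   rs       l = compE e rs l ⨟ inc l
  compE (a ⊕ b)   rs       l = compE a rs l ⨟ compE b rs (suc l) ⨟ transfer (suc l) l
  compE (a ⊖ b)   rs       l = compE a rs l ⨟ compE b rs (suc l) ⨟ countdown (suc l) (dec l)
  compE (sum b s) rs       l = compE b rs (suc l) ⨟
    countdown (suc l) (compE s (suc l ∷ rs) (2 + l) ⨟ transfer (2 + l) l)
  -- The head of the array itself walks to the entry. The loop runs at most once, because its body
  -- ends on the wall, which does not read as true.
  compE (a ! e)   rs       l = compE e rs l ⨟ transfer l (toℕ a) ⨟ inc (toℕ a) ⨟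
    while (suc (toℕ a)) isTrue (inc l ⨟ clear (toℕ a)) ⨟ clear (toℕ a)

  compC : ∀ {n} → Cmd n → Vec ℕ n → ℕ → Prog
  compC (c ⨾ d)       rs l = compC c rs l ⨟ compC d rs l
  compC (for e c)     rs l = compE e rs l ⨟ countdown l (compC c (l ∷ rs) (suc l))
  -- The entry is first erased, then set if the value is positive; emptying the value ends the loop
  -- after one round.
  compC (a [ i ]:= e) rs l = compE i rs l ⨟ compE e rs (suc l) ⨟ transfer l (toℕ a) ⨟ inc (toℕ a) ⨟
    write (toℕ a) false ⨟ while (2 + l) positive (clear (suc l) ⨟ write (toℕ a) true) ⨟ clear (toℕ a)
  compC (bind e c)    rs l = compE e rs l ⨟ compC c (l ∷ rs) (suc l) ⨟ clear l

  -- Valid for all memories: an array access yields at most 1, so no bound depends on stored data.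
  valueBound : ∀ {n} → Exp n → ℕ → ℕ
  valueBound (var i)   V = V
  valueBound (wk e)    V = valueBound e V
  valueBound zero      V = 0
  valueBound (suc e)   V = suc (valueBound e V)
  valueBound (a ⊕ b)   V = valueBound a V + valueBound b V
  valueBound (a ⊖ b)   V = valueBound a V
  -- The index joins the environment of `s` and may exceed `V`, hence the enlarged argument.
  valueBound (sum b s) V = valueBound b V * valueBound s (V + valueBound b V)
  valueBound (a ! e)   V = 1

  costE : ∀ {n} → Exp n → ℕ → ℕ
  costE (var i)   V = (1 + V * 3) + (1 + V * 4)
  costE (wk e)    V = costE e V
  costE zero      V = 1
  costE (suc e)   V = costE e V + 1
  costE (a ⊕ b)   V = costE a V + (costE b V + (1 + valueBound b V * 3))
  costE (a ⊖ b)   V = costE a V + (costE b V + (1 + valueBound b V * 3))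
  costE (sum b s) V = let V′ = V + valueBound b V in
    costE b V + (1 + valueBound b V * (2 + (costE s V′ + (1 + valueBound s V′ * 3))))
  costE (a ! e)   V = let B = valueBound e V in
    costE e V + ((1 + B * 3) + (1 + ((2 + (1 + (1 + 2 * suc B))) + (1 + 2 * suc B))))

  costC : ∀ {n} → Cmd n → ℕ → ℕ
  costC (c ⨾ d)       V = costC c V + costC d V
  costC (for e c)     V = costE e V + (1 + valueBound e V * (2 + costC c (V + valueBound e V)))
  costC (a [ i ]:= e) V = let I = valueBound i V in
    costE i V + (costE e V + ((1 + I * 3) + (1 + (1 + ((2 + ((1 + 2 * valueBound e V) + 1)) + (1 + 2 * suc I))))))
  costC (bind e c)    V = costE e V + (costC c (V + valueBound e V) + (1 + 2 * valueBound e V))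

  sumTo-mono-bound : ∀ {m k} (f : ℕ → ℕ) {B} → m ≤ k → (∀ j → j < m → f j ≤ B) → sumTo m f ≤ k * B
  sumTo-mono-bound {zero}          f _         h = z≤n
  sumTo-mono-bound {suc m} {suc k} f {B} (s≤s m≤k) h = ≤-trans
    (+-mono-≤ (sumTo-mono-bound f m≤k (λ j j<m → h j (m<n⇒m<1+n j<m))) (h m ≤-refl))
    (≤-reflexive (+-comm (k * B) B))

  Bounded : ∀ {n} → Vec ℕ n → ℕ → Set
  Bounded ρ V = ∀ i → lookup ρ i ≤ V

  bounded-∷ : ∀ {n} {ρ : Vec ℕ n} {V x B} → Bounded ρ V → x ≤ B → Bounded (x ∷ ρ) (V + B)
  bounded-∷ h x≤B Fin.zero    = ≤-trans x≤B (m≤n+m _ _)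
  bounded-∷ h x≤B (Fin.suc i) = ≤-trans (h i) (m≤m+n _ _)

  b2n≤1 : ∀ b → b2n b ≤ 1
  b2n≤1 true  = ≤-refl
  b2n≤1 false = z≤n

  value-bounded : ∀ {n} (e : Exp n) {ρ M V} → Bounded ρ V → ⟦ e ⟧ ρ M ≤ valueBound e V
  value-bounded (var i)               h = h i
  value-bounded (wk e)    {_ ∷ ρ}     h = value-bounded e (h ∘ Fin.suc)
  value-bounded zero                  h = z≤n
  value-bounded (suc e)               h = s≤s (value-bounded e h)
  value-bounded (a ⊕ b)               h = +-mono-≤ (value-bounded a h) (value-bounded b h)
  value-bounded (a ⊖ b)   {ρ} {M}     h = ≤-trans (m∸n≤m _ (⟦ b ⟧ ρ M)) (value-bounded a h)
  value-bounded (sum b s)             h = sumTo-mono-bound _ (value-bounded b h) λ j j<b →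
    value-bounded s (bounded-∷ h (≤-trans (<⇒≤ j<b) (value-bounded b h)))
  value-bounded (a ! e)   {ρ} {M}     h = b2n≤1 (M (toℕ a) (⟦ e ⟧ ρ M))

  -- The precondition of compiled code. By `clean` and `rest` it may borrow scratch counters and
  -- array heads and know to which value they must return.
  record Ok {n} (S : State) (l : ℕ) (rs ρ : Vec ℕ n) : Set where
    constructor ok
    field
      env   : ∀ i → pos S (lookup rs i) ≡ lookup ρ i
      below : ∀ i → lookup rs i < l
      clean : ∀ r → l ≤ r → pos S r ≡ 0
      rest  : ∀ a → a < arrays → pos S a ≡ 0
      room  : arrays ≤ l

  open Ok

  ok-tail : ∀ {n S l r x} {rs ρ : Vec ℕ n} → Ok S l (r ∷ rs) (x ∷ ρ) → Ok S l rs ρ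
  ok-tail (ok e b c r A) = ok (e ∘ Fin.suc) (b ∘ Fin.suc) c r A

  ok-skip : ∀ {n S l x} {rs ρ : Vec ℕ n} → Ok S l rs ρ → Ok (setPos S l x) (suc l) rs ρ
  ok-skip {S = S} {l} (ok e b c r A) = ok
    (λ i → trans (upd-off (pos S) (<⇒≢ (b i))) (e i))
    (λ i → m<n⇒m<1+n (b i))
    (λ s l<s → trans (upd-off (pos S) (>⇒≢ l<s)) (c s (<⇒≤ l<s)))
    (λ a a<A → trans (upd-off (pos S) (<⇒≢ (≤-trans a<A A))) (r a a<A))
    (m≤n⇒m≤1+n A)

  ok-push : ∀ {n S l x} {rs ρ : Vec ℕ n} → Ok S l rs ρ → Ok (setPos S l x) (suc l) (l ∷ rs) (x ∷ ρ)
  ok-push {S = S} {l} {x} {rs} {ρ} o = ok env′ below′ (clean o′) (rest o′) (room o′)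
    where
    o′ = ok-skip {x = x} o
    env′ : ∀ i → pos (setPos S l x) (lookup (l ∷ rs) i) ≡ lookup (x ∷ ρ) i
    env′ Fin.zero    = upd-at (pos S) l
    env′ (Fin.suc i) = env o′ i
    below′ : ∀ i → lookup (l ∷ rs) i < suc l
    below′ Fin.zero    = ≤-refl
    below′ (Fin.suc i) = below o′ i

  exec-transfer₂ : ∀ {S} i k m → i ≢ k → i ≢ m → k ≢ m →
    Exec (transfer₂ i k m) (1 + pos S i * 4) S
      (setPos (setPos (setPos S i 0) k (pos S k + pos S i)) m (pos S m + pos S i))
  exec-transfer₂ {S} i k m i≢k i≢m k≢m = exec-pre start (exec-countdown i family atI (pos S i) body)
    where
    gone : ℕ → ℕ
    gone v = pos S i ∸ v
    family : ℕ → State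
    family v = setPos (setPos (setPos S i v) k (pos S k + gone v)) m (pos S m + gone v)
    atI : ∀ v → pos (family v) i ≡ v
    atI v = trans (upd-off (upd (upd (pos S) i v) k (pos S k + gone v)) i≢m)
                  (trans (upd-off (upd (pos S) i v) i≢k) (upd-at (pos S) i))
    start : S ≐ family (pos S i)
    start = eqv refl go (λ _ _ → refl)
      where
      go : ∀ j → pos S j ≡ pos (family (pos S i)) j
      go j with same? j m | same? j k | same? j i
      ... | yes refl | _        | _ rewrite n∸n≡0 (pos S i) = sym (+-identityʳ _)
      ... | no _     | yes refl | _ rewrite n∸n≡0 (pos S i) = sym (+-identityʳ _)
      ... | no _     | no _     | yes refl = refl
      ... | no _     | no _     | no _     = refl
    body : ∀ v → v < pos S i → Exec (inc k ⨟ inc m) 2 (setPos (family (suc v)) i v) (family v)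
    body v v<i = exec-post (eqv refl go (λ _ _ → refl)) (exec-inc k ▷ exec-inc m)
      where
      T = setPos (family (suc v)) i v
      U = setPos T k (suc (pos T k))
      step : ∀ x → suc (x + gone (suc v)) ≡ x + gone v
      step x = trans (sym (+-suc x _)) (cong (x +_) (sym (+-∸-assoc 1 v<i)))
      fk : pos T k ≡ pos S k + gone (suc v)
      fk = trans (upd-off (pos (family (suc v))) (i≢k ∘ sym))
          (trans (upd-off (upd (upd (pos S) i (suc v)) k (pos S k + gone (suc v))) k≢m)
                 (upd-at (upd (pos S) i (suc v)) k))
      fm : pos U m ≡ pos S m + gone (suc v)
      fm = trans (upd-off (pos T) (k≢m ∘ sym)) (trans (upd-off (pos (family (suc v))) (i≢m ∘ sym))
          (upd-at (upd (upd (pos S) i (suc v)) k (pos S k + gone (suc v))) m))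
      go : ∀ j → upd (pos U) m (suc (pos U m)) j ≡ pos (family v) j
      go j with same? j m | same? j k | same? j i
      ... | yes refl | _        | _        = trans (cong suc fm) (step (pos S j))
      ... | no _     | yes refl | _        = trans (cong suc fk) (step (pos S j))
      ... | no _     | no _     | yes refl = refl
      ... | no _     | no _     | no _     = refl

  exec-monus : ∀ {S} i k → i ≢ k →
    Exec (countdown i (dec k)) (1 + pos S i * 3) S (setPos (setPos S i 0) k (pos S k ∸ pos S i))
  exec-monus {S} i k i≢k = exec-pre start (exec-countdown i family atI (pos S i) body)
    where
    family : ℕ → State
    family v = setPos (setPos S i v) k (pos S k ∸ (pos S i ∸ v))
    atI : ∀ v → pos (family v) i ≡ v
    atI v = trans (upd-off (upd (pos S) i v) i≢k) (upd-at (pos S) i)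
    start : S ≐ family (pos S i)
    start = eqv refl go (λ _ _ → refl)
      where
      go : ∀ j → pos S j ≡ pos (family (pos S i)) j
      go j with same? j k | same? j i
      ... | yes refl | _ rewrite n∸n≡0 (pos S i) = refl
      ... | no _ | yes refl = refl
      ... | no _ | no _     = refl
    body : ∀ v → v < pos S i → Exec (dec k) 1 (setPos (family (suc v)) i v) (family v)
    body v v<i = exec-post (eqv refl go (λ _ _ → refl)) (exec-dec k)
      where
      T = setPos (family (suc v)) i v
      go : ∀ j → upd (pos T) k (pred (pos T k)) j ≡ pos (family v) j
      go j with same? j k | same? j i
      ... | no _     | yes _ = refl
      ... | no _     | no _  = refl
      ... | yes refl | _     = begin
        pred (pos T j)                    ≡⟨ cong pred (upd-off (pos (family (suc v))) (i≢k ∘ sym)) ⟩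
        pred (pos (family (suc v)) j)     ≡⟨ cong pred (upd-at (upd (pos S) i (suc v)) j) ⟩
        pred (pos S j ∸ (pos S i ∸ suc v)) ≡⟨ pred[m∸n]≡m∸[1+n] (pos S j) _ ⟩
        pos S j ∸ suc (pos S i ∸ suc v)   ≡⟨ cong (pos S j ∸_) (+-∸-assoc 1 v<i) ⟨
        pos S j ∸ (pos S i ∸ v)           ∎
        where open ≡-Reasoning

-- Correctness of the compiler

module Compilation where

  open TapePrograms
  open TapeStates
  open Language
  open import Data.Bool.Base using (Bool; true; false; if_then_else_)
  open import Data.Empty using (⊥-elim)
  open import Data.Fin.Base as Fin using (Fin; toℕ)
  open import Data.Fin.Properties using (toℕ<n)
  open import Data.Nat.Base
  open import Data.Nat.Properties
  open import Data.Vec.Base as Vec using (Vec; _∷_)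
  open import Function.Base using (_∘_)
  open import Relation.Binary.PropositionalEquality
  open import Relation.Nullary.Decidable using (yes; no)

  open State
  open _≐_
  open Ok

  setPos² : ∀ S l {x y} → setPos (setPos S l x) l y ≐ setPos S l y
  setPos² S l {x} {y} = eqv refl go (λ _ _ → refl)
    where
    go : ∀ j → upd (upd (pos S) l x) l y j ≡ upd (pos S) l y j
    go j with same? j l
    ... | yes _ = refl
    ... | no  _ = refl

  setPos-cong : ∀ {S l x y} → x ≡ y → setPos S l x ≐ setPos S l y
  setPos-cong refl = eqv refl (λ _ → refl) (λ _ _ → refl)

  ≐-refl : ∀ {S} → S ≐ S
  ≐-refl = eqv refl (λ _ → refl) (λ _ _ → refl)

  ≐-sym : ∀ {S T} → S ≐ T → T ≐ S
  ≐-sym (eqv e p c) = eqv (sym e) (λ j → sym (p j)) (λ i j → sym (c i j))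

  ≐-trans : ∀ {S T U} → S ≐ T → T ≐ U → S ≐ U
  ≐-trans (eqv e p c) (eqv e′ p′ c′) =
    eqv (trans e e′) (λ j → trans (p j) (p′ j)) (λ i j → trans (c i j) (c′ i j))

  setPos-≐ : ∀ {S T} l x → S ≐ T → setPos S l x ≐ setPos T l x
  setPos-≐ {S} {T} l x (eqv e p c) = eqv e go c
    where
    go : ∀ j → upd (pos S) l x j ≡ upd (pos T) l x j
    go j with same? j l
    ... | yes _ = refl
    ... | no  _ = p j

  restore : ∀ S l {x} → pos S l ≡ 0 → setPos (setPos S l x) l 0 ≐ S
  restore S l {x} eq = ≐-trans (setPos² S l) (≐-trans (setPos-cong (sym eq)) (setPos-id S l))

  suc≢ : ∀ {l} → suc l ≢ l
  suc≢ e = 1+n≢n e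

  correct-var : ∀ {S l r x V} → pos S r ≡ x → r < l → (∀ j → l ≤ j → pos S j ≡ 0) → x ≤ V →
    Exec (transfer r (suc l) ⨟ transfer₂ (suc l) r l) ((1 + V * 3) + (1 + V * 4)) S (setPos S l x)
  correct-var {S} {l} {r} {x} {V} refl r<l clean x≤V = exec-post (eqv refl go (λ _ _ → refl))
    (exec-≤ (+-mono-≤ (s≤s (*-monoˡ-≤ 3 x≤V)) (s≤s (*-monoˡ-≤ 4 (≤-trans (≤-reflexive T₁) x≤V))))
      (exec-transfer r (suc l) r≢1+l ▷ exec-transfer₂ (suc l) r l (r≢1+l ∘ sym) suc≢ (<⇒≢ r<l)))
    where
    r≢1+l : r ≢ suc l
    r≢1+l = <⇒≢ (m<n⇒m<1+n r<l)
    T = setPos (setPos S r 0) (suc l) (pos S (suc l) + pos S r)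
    T₁ : pos T (suc l) ≡ pos S r
    T₁ = trans (upd-at (upd (pos S) r 0) (suc l)) (cong (_+ pos S r) (clean (suc l) (n≤1+n l)))
    Tr : pos T r ≡ 0
    Tr = trans (upd-off (upd (pos S) r 0) r≢1+l) (upd-at (pos S) r)
    Tl : pos T l ≡ 0
    Tl = trans (upd-off (upd (pos S) r 0) (suc≢ ∘ sym)) (trans (upd-off (pos S) (>⇒≢ r<l)) (clean l ≤-refl))
    go : ∀ j → upd (upd (upd (pos T) (suc l) 0) r (pos T r + pos T (suc l))) l (pos T l + pos T (suc l)) j
             ≡ upd (pos S) l (pos S r) j
    go j with same? j l | same? j r | same? j (suc l)
    ... | yes refl | _        | _        = cong₂ _+_ Tl T₁
    ... | no _     | yes refl | _        = cong₂ _+_ Tr T₁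
    ... | no _     | no _     | yes refl = sym (clean (suc l) (n≤1+n l))
    ... | no _     | no _     | no _     = refl

  add-scratch : ∀ {S} l i x y → l ≢ i → pos S i ≡ 0 → let T = setPos (setPos S l x) i y in
    Exec (transfer i l) (1 + y * 3) T (setPos S l (x + y))
  add-scratch {S} l i x y l≢i clean =
    exec-post (eqv refl go (λ _ _ → refl))
      (exec-≤ (≤-reflexive (cong (λ z → 1 + z * 3) Ti)) (exec-transfer i l (l≢i ∘ sym)))
    where
    T = setPos (setPos S l x) i y
    Ti : pos T i ≡ y
    Ti = upd-at (upd (pos S) l x) i
    Tl : pos T l ≡ x
    Tl = trans (upd-off (upd (pos S) l x) l≢i) (upd-at (pos S) l)
    go : ∀ j → upd (upd (pos T) i 0) l (pos T l + pos T i) j ≡ upd (pos S) l (x + y) j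
    go j with same? j l | same? j i
    ... | yes refl | _        = cong₂ _+_ Tl Ti
    ... | no _     | yes refl = sym clean
    ... | no _     | no _     = refl

  monus-scratch : ∀ {S} l i x y → l ≢ i → pos S i ≡ 0 → let T = setPos (setPos S l x) i y in
    Exec (countdown i (dec l)) (1 + y * 3) T (setPos S l (x ∸ y))
  monus-scratch {S} l i x y l≢i clean =
    exec-post (eqv refl go (λ _ _ → refl))
      (exec-≤ (≤-reflexive (cong (λ z → 1 + z * 3) Ti)) (exec-monus i l (l≢i ∘ sym)))
    where
    T = setPos (setPos S l x) i y
    Ti : pos T i ≡ y
    Ti = upd-at (upd (pos S) l x) i
    Tl : pos T l ≡ x
    Tl = trans (upd-off (upd (pos S) l x) l≢i) (upd-at (pos S) l)
    go : ∀ j → upd (upd (pos T) i 0) l (pos T l ∸ pos T i) j ≡ upd (pos S) l (x ∸ y) j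
    go j with same? j l | same? j i
    ... | yes refl | _        = cong₂ _∸_ Tl Ti
    ... | no _     | yes refl = sym clean
    ... | no _     | no _     = refl

  exec-read : ∀ {S} l a v → l ≢ a → pos S a ≡ 0 → pos S l ≡ 0 →
    Exec (transfer l a ⨟ inc a ⨟ while (suc a) isTrue (inc l ⨟ clear a) ⨟ clear a)
         ((1 + v * 3) + (1 + ((2 + (1 + (1 + 2 * suc v))) + (1 + 2 * suc v))))
         (setPos S l v) (setPos S l (b2n (con S a v)))
  exec-read {S} l a v l≢a a≡0 l≡0 =
    exec-post (eqv refl moved (λ _ _ → refl)) (exec-≤ (≤-reflexive (cong (λ z → 1 + z * 3) (upd-at (pos S) l))) (exec-transfer l a l≢a))
    ▷ exec-post (eqv refl (λ j → trans (pos≡ (setPos² S a) j) (cong (λ z → upd (pos S) a z j) (cong suc (upd-at (pos S) a)))) (λ _ _ → refl)) (exec-inc a)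
    ▷ exec-ifTrue a at-a cleared (exec-inc l ▷ exec-≤ (≤-reflexive (cong (λ z → 1 + 2 * z) at-a′)) (exec-clear a))
    ▷ finish (con S a v)
    where
    U = setPos S a (suc v)
    U′ = setPos (setPos U l (suc (pos U l))) a 0
    at-a : pos U a ≡ suc v
    at-a = upd-at (pos S) a
    at-a′ : pos (setPos U l (suc (pos U l))) a ≡ suc v
    at-a′ = trans (upd-off (pos U) (l≢a ∘ sym)) at-a
    Ul : pos U l ≡ 0
    Ul = trans (upd-off (pos S) l≢a) l≡0
    cleared : pos U′ a ≡ 0
    cleared = upd-at (pos (setPos U l (suc (pos U l)))) a
    moved : ∀ j → upd (upd (upd (pos S) l v) l 0) a (upd (pos S) l v a + upd (pos S) l v l) j ≡ upd (pos S) a v j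
    moved j with same? j a | same? j l
    ... | yes refl | _ = cong₂ _+_ (trans (upd-off (pos S) (l≢a ∘ sym)) a≡0) (upd-at (pos S) l)
    ... | no _ | yes refl = sym l≡0
    ... | no _ | no _ = refl
    finish : ∀ b → Exec (clear a) (1 + 2 * suc v) (if b then U′ else U) (setPos S l (b2n b))
    finish false = exec-post (≐-trans (restore S a a≡0) (≐-sym (≐-trans (setPos-cong (sym l≡0)) (setPos-id S l))))
                     (exec-≤ (≤-reflexive (cong (λ z → 1 + 2 * z) at-a)) (exec-clear a))
    finish true = exec-post (eqv refl go (λ _ _ → refl))
                    (exec-≤ (s≤s (*-monoʳ-≤ 2 {pos U′ a} {suc v} (≤-trans (≤-reflexive cleared) z≤n))) (exec-clear a))
      where
      go : ∀ j → upd (pos U′) a 0 j ≡ upd (pos S) l 1 j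
      go j with same? j a | same? j l
      ... | yes refl | yes refl = ⊥-elim (l≢a refl)
      ... | yes refl | no _     = sym a≡0
      ... | no _     | yes refl = cong suc Ul
      ... | no _     | no _     = refl

  sumTo-mono-≤ : ∀ f {m n} → m ≤ n → sumTo m f ≤ sumTo n f
  sumTo-mono-≤ f {n = n} m≤n = go (≤⇒≤′ m≤n)
    where
    go : ∀ {m n} → m ≤′ n → sumTo m f ≤ sumTo n f
    go (≤′-reflexive refl) = ≤-refl
    go (≤′-step m≤n)       = ≤-trans (go m≤n) (m≤m+n _ _)

  correctE : ∀ {n} (e : Exp n) {S l rs ρ V} → Ok S l rs ρ → Bounded ρ V →
    Exec (compE e rs l) (costE e V) S (setPos S l (⟦ e ⟧ ρ (con S)))
  correctE (var i) o h = correct-var (env o i) (below o i) (clean o) (h i)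
  correctE (wk e) {rs = _ ∷ _} {_ ∷ _} o h = correctE e (ok-tail o) (h ∘ Fin.suc)
  correctE zero {S} {l} o h =
    exec-post (≐-sym (≐-trans (setPos-cong (sym (clean o l ≤-refl))) (setPos-id S l))) exec-nop
  correctE (suc e) {S} {l} o h = correctE e o h ▷
    exec-post (≐-trans (setPos² S l) (setPos-cong (cong suc (upd-at (pos S) l)))) (exec-inc l)
  correctE (a ⊕ b) {S} {l} {ρ = ρ} o h =
    correctE a o h ▷ correctE b (ok-skip o) h ▷
    exec-≤ (s≤s (*-monoˡ-≤ 3 (value-bounded b h)))
      (add-scratch l (suc l) (⟦ a ⟧ ρ (con S)) (⟦ b ⟧ ρ (con S)) (suc≢ ∘ sym) (clean o (suc l) (n≤1+n l)))
  correctE (a ⊖ b) {S} {l} {ρ = ρ} o h =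
    correctE a o h ▷ correctE b (ok-skip o) h ▷
    exec-≤ (s≤s (*-monoˡ-≤ 3 (value-bounded b h)))
      (monus-scratch l (suc l) (⟦ a ⟧ ρ (con S)) (⟦ b ⟧ ρ (con S)) (suc≢ ∘ sym) (clean o (suc l) (n≤1+n l)))
  correctE (sum b s) {S} {l} {rs} {ρ} {V} o h =
    exec-pre (≐-sym (≐-trans (setPos-cong (sym (clean o l ≤-refl))) (setPos-id S l)))
      (exec-post (setPos-cong refl) (correctE b (ok-skip {x = 0} o) h)
       ▷ exec-pre start (exec-post end (exec-≤ (s≤s (*-monoˡ-≤ _ (value-bounded b h)))
           (exec-countdown (suc l) family (λ v → upd-at (pos (acc v)) (suc l)) N body))))
    where
    N = ⟦ b ⟧ ρ (con S)
    f : ℕ → ℕ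
    f j = ⟦ s ⟧ (j ∷ ρ) (con S)
    -- The loop counts down, so at counter value `v` the accumulator holds the terms from `v` on:
    -- the whole sum minus its first `v` terms.
    partial : ℕ → ℕ
    partial v = sumTo N f ∸ sumTo v f
    acc family : ℕ → State
    acc v = setPos S l (partial v)
    family v = setPos (acc v) (suc l) v
    start : setPos (setPos S l 0) (suc l) N ≐ family N
    start = setPos-≐ (suc l) N (setPos-cong (sym (n∸n≡0 (sumTo N f))))
    end : family 0 ≐ setPos S l (sumTo N f)
    end = ≐-trans (setPos-cong (sym (clean (ok-skip {x = partial 0} o) (suc l) ≤-refl))) (setPos-id (acc 0) (suc l))
    body : ∀ v → v < N → Exec (compE s (suc l ∷ rs) (2 + l) ⨟ transfer (2 + l) l)
      (costE s (V + valueBound b V) + (1 + valueBound s (V + valueBound b V) * 3))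
      (setPos (family (suc v)) (suc l) v) (family v)
    body v v<N = exec-pre (setPos² (acc (suc v)) (suc l))
      (correctE s (ok-push (ok-skip {x = partial (suc v)} o)) h′ ▷
       exec-pre reorder (exec-≤ (s≤s (*-monoˡ-≤ 3 (value-bounded s h′)))
         (exec-post reorder′ (add-scratch {setPos S (suc l) v} l (2 + l) (partial (suc v)) (f v) (λ ()) (clean′)))))
      where
      h′ : Bounded (v ∷ ρ) (V + valueBound b V)
      h′ = bounded-∷ h (≤-trans (<⇒≤ v<N) (value-bounded b h))
      clean′ : pos (setPos S (suc l) v) (2 + l) ≡ 0
      clean′ = trans (upd-off (pos S) suc≢) (clean o (2 + l) (m≤n+m l 2))
      swap : ∀ x → setPos (setPos S l x) (suc l) v ≐ setPos (setPos S (suc l) v) l x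
      swap x = eqv refl go (λ _ _ → refl)
        where
        go : ∀ j → upd (upd (pos S) l x) (suc l) v j ≡ upd (upd (pos S) (suc l) v) l x j
        go j with same? j (suc l) | same? j l
        ... | yes refl | yes ()
        ... | yes refl | no _ = refl
        ... | no _ | yes _ = refl
        ... | no _ | no _  = refl
      reorder : setPos (setPos (acc (suc v)) (suc l) v) (2 + l) (f v) ≐ setPos (setPos (setPos S (suc l) v) l (partial (suc v))) (2 + l) (f v)
      reorder = setPos-≐ (2 + l) (f v) (swap (partial (suc v)))
      reorder′ : setPos (setPos S (suc l) v) l (partial (suc v) + f v) ≐ family v
      reorder′ = ≐-trans (≐-sym (swap _)) (setPos-≐ (suc l) v (setPos-cong gain))
        where
        gain : partial (suc v) + f v ≡ partial v
        gain = trans (cong (_+ f v) (sym (∸-+-assoc (sumTo N f) (sumTo v f) (f v))))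
                     (m∸n+n≡m (m+n≤o⇒m≤o∸n (f v) (≤-trans (≤-reflexive (+-comm (f v) _)) (sumTo-mono-≤ f v<N))))
  correctE (a ! e) {S} {l} {ρ = ρ} {V} o h =
    correctE e o h ▷
    exec-≤ (+-mono-≤ (s≤s (*-monoˡ-≤ 3 B)) (s≤s (+-mono-≤ (s≤s (s≤s (s≤s (s≤s (*-monoʳ-≤ 2 (s≤s B)))))) (s≤s (*-monoʳ-≤ 2 (s≤s B))))))
      (exec-read l (toℕ a) (⟦ e ⟧ ρ (con S)) (>⇒≢ (≤-trans (toℕ<n a) (room o))) (rest o (toℕ a) (toℕ<n a)) (clean o l ≤-refl))
    where
    B = value-bounded e h

  setMem : State → Mem → State
  setMem S M = record S { con = M }

  exec-store : ∀ {S} l a v x → a < l → pos S a ≡ 0 → pos S l ≡ 0 → pos S (suc l) ≡ 0 →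
    Exec (transfer l a ⨟ inc a ⨟ write a false ⨟ while (2 + l) positive (clear (suc l) ⨟ write a true) ⨟ clear a)
         ((1 + v * 3) + (1 + (1 + ((2 + ((1 + 2 * x) + 1)) + (1 + 2 * suc v)))))
         (setPos (setPos S l v) (suc l) x) (setMem S (set (con S) a v (0 <ᵇ x)))
  exec-store {S} l a v x a<l a≡0 l≡0 l′≡0 =
    exec-post (eqv refl moved (λ _ _ → refl)) (exec-≤ (≤-reflexive (cong (λ z → 1 + z * 3) Tl)) (exec-transfer l a (>⇒≢ a<l)))
    ▷ exec-post (≐-trans (setPos² S′ a) (setPos-cong (cong suc (upd-at (pos S′) a)))) (exec-inc a)
    ▷ exec-post (eqv refl (λ _ → refl) (λ _ _ → refl)) (exec-write a false (upd-at (pos S′) a))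
    ▷ choose x refl
    ▷ exec-post final (exec-≤ (≤-reflexive (cong (λ z → 1 + 2 * z) (upd-at (pos S) a))) (exec-clear {setPos (setMem S (set (con S) a v (0 <ᵇ x))) a (suc v)} a))
    where
    T = setPos (setPos S l v) (suc l) x
    S′ = setPos S (suc l) x
    a≢1+l : a ≢ suc l
    a≢1+l = <⇒≢ (m<n⇒m<1+n a<l)
    Tl : pos T l ≡ v
    Tl = trans (upd-off (upd (pos S) l v) (suc≢ ∘ sym)) (upd-at (pos S) l)
    Ta : pos T a ≡ 0
    Ta = trans (upd-off (upd (pos S) l v) a≢1+l) (trans (upd-off (pos S) (<⇒≢ a<l)) a≡0)
    moved : ∀ j → upd (upd (pos T) l 0) a (pos T a + pos T l) j ≡ upd (pos S′) a v j
    moved j with same? j a | same? j l | same? j (suc l)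
    ... | yes refl | _        | _        = cong₂ _+_ Ta Tl
    ... | no _     | yes refl | yes ()
    ... | no _     | yes refl | no _     = sym l≡0
    ... | no _     | no _     | yes refl = refl
    ... | no _     | no _     | no _     = refl
    U : Bool → State
    U b = setPos (setPos (setMem S (set (con S) a v b)) (suc l) x) a (suc v)
    final : setPos (setPos (setMem S (set (con S) a v (0 <ᵇ x))) a (suc v)) a 0 ≐ setMem S (set (con S) a v (0 <ᵇ x))
    final = restore (setMem S (set (con S) a v (0 <ᵇ x))) a a≡0
    Ux : ∀ b → pos (U b) (suc l) ≡ x
    Ux b = trans (upd-off (upd (pos S) (suc l) x) (a≢1+l ∘ sym)) (upd-at (pos S) (suc l))
    drop : ∀ b → setPos (U b) (suc l) 0 ≐ setPos (setMem S (set (con S) a v b)) a (suc v)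
    drop b = eqv refl go (λ _ _ → refl)
      where
      go : ∀ j → upd (pos (U b)) (suc l) 0 j ≡ upd (pos S) a (suc v) j
      go j with same? j (suc l) | same? j a
      ... | yes refl | yes e = ⊥-elim (a≢1+l (sym e))
      ... | yes refl | no _  = sym l′≡0
      ... | no _     | yes _ = refl
      ... | no _     | no _  = refl
    overwrite : setCon (setPos (U false) (suc l) 0) a (upd (con (U false) a) v true) ≐
                setPos (setMem S (set (con S) a v true)) a (suc v)
    overwrite = ≐-trans (eqv refl (λ _ → refl) go) (drop true)
      where
      go : ∀ i → upd (set (con S) a v false) a (upd (set (con S) a v false a) v true) i ≗ set (con S) a v true i
      go i k with same? i a
      ... | no _ = refl
      ... | yes refl with same? k v
      ...   | yes _ = refl
      ...   | no k≢v = trans (cong (λ c → c k) (upd-at (con S) i)) (upd-off (con S i) k≢v)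
    choose : ∀ y → y ≡ x → Exec (while (2 + l) positive (clear (suc l) ⨟ write a true)) (2 + ((1 + 2 * x) + 1)) (U false)
             (setPos (setMem S (set (con S) a v (0 <ᵇ x))) a (suc v))
    choose zero refl = exec-≤ (s≤s z≤n)
      (exec-post (≐-trans (≐-sym (setPos-id (U false) (suc l))) (≐-trans (setPos-cong (Ux false)) (drop false)))
        (while-stop (suc l) (Ux false)))
    choose (suc y) refl = exec-≤ (≤-reflexive (cong suc (+-comm _ 1)))
      (while-loop (suc l) (Ux false)
        (exec-≤ (≤-reflexive (cong (λ z → 1 + 2 * z) (Ux false))) (exec-clear (suc l))
          ▷ exec-write a true (trans (upd-off (pos (U false)) a≢1+l) (upd-at (upd (pos S) (suc l) x) a)))
        (exec-post overwrite (while-stop (suc l) (upd-at (pos (U false)) (suc l)))))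

  ok-setMem : ∀ {n S l M} {rs ρ : Vec ℕ n} → Ok S l rs ρ → Ok (setMem S M) l rs ρ
  ok-setMem (ok e b c r A) = ok e b c r A

  correctC : ∀ {n} (c : Cmd n) {S l rs ρ V} → Ok S l rs ρ → Bounded ρ V →
    Exec (compC c rs l) (costC c V) S (setMem S (⟪ c ⟫ ρ (con S)))
  correctC (c ⨾ d) o h = correctC c o h ▷ correctC d (ok-setMem o) h
  correctC (a [ i ]:= e) {S} {l} {ρ = ρ} {V} o h =
    correctE i o h ▷ correctE e (ok-skip o) h ▷
    exec-≤ (+-mono-≤ (s≤s (*-monoˡ-≤ 3 I)) (s≤s (s≤s (+-mono-≤ (s≤s (s≤s (s≤s (+-monoˡ-≤ 1 (*-monoʳ-≤ 2 (value-bounded e h)))))) (s≤s (*-monoʳ-≤ 2 (s≤s I)))))))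
      (exec-store l (toℕ a) (⟦ i ⟧ ρ (con S)) (⟦ e ⟧ ρ (con S)) (≤-trans (toℕ<n a) (room o)) (rest o _ (toℕ<n a))
        (clean o l ≤-refl) (clean o (suc l) (n≤1+n l)))
    where
    I = value-bounded i h
  correctC (bind e c) {S} {l} {ρ = ρ} o h =
    correctE e o h ▷
    correctC c (ok-push o) (bounded-∷ h (value-bounded e h)) ▷
    exec-post (restore _ l (clean o l ≤-refl))
      (exec-≤ (s≤s (*-monoʳ-≤ 2 (≤-trans (≤-reflexive (upd-at (pos S) l)) (value-bounded e h)))) (exec-clear l))
  correctC (for e c) {S} {l} {rs} {ρ} {V} o h = correctE e o h ▷
    exec-≤ (s≤s (*-monoˡ-≤ _ (value-bounded e h))) (go (⟦ e ⟧ ρ (con S)) (con S) (value-bounded e h))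
    where
    B = valueBound e V
    K = costC c (V + B)
    -- The memory changes from round to round, so the induction generalises over it instead of
    -- naming a family of states in advance.
    go : ∀ n M → n ≤ B → Exec (countdown l (compC c (l ∷ rs) (suc l))) (1 + n * (2 + K))
           (setMem (setPos S l n) M) (setMem S (forTo n (λ j → ⟪ c ⟫ (j ∷ ρ)) M))
    go zero M _ = exec-post (≐-trans (setPos-cong (sym (clean o l ≤-refl))) (setPos-id (setMem S M) l))
      (while-stop l (upd-at (pos S) l))
    go (suc n) M n<B = exec-≤ (≤-reflexive (cong suc (+-suc (suc K) _)))
      (while-loop l (upd-at (pos S) l)
        (exec-post (≐-trans (setPos² (setMem S M) l) (setPos-cong (cong pred (upd-at (pos S) l)))) (exec-dec l) ▷
         correctC c (ok-push (ok-setMem o)) (bounded-∷ h (<⇒≤ n<B)))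
        (go n (⟪ c ⟫ (n ∷ ρ) M) (<⇒≤ n<B)))

-- Polynomial bounds

module CostsAndInput where

  open TapePrograms
  open TapeStates
  open Language
  open Compilation
  open import Data.Bool.Base using (Bool; true; false)
  open import Data.List.Base as List using (List; []; _∷_; _++_; _∷ʳ_; length)
  open import Data.List.Properties using (++-identityʳ; ++-assoc; length-++)
  open import Data.Nat.Base
  open import Data.Nat.Properties
  open import Data.Nat.Tactic.RingSolver using (solve-∀)
  open import Data.Product.Base using (∃-syntax; _,_)
  open import Data.Vec.Base as Vec using ([]; _∷_)
  open import Function.Base using (_∘_)
  open import Relation.Binary.PropositionalEquality
  open import Relation.Nullary.Decidable using (yes; no)

  open State
  open _≐_
  open Ok
  open Rep

  -- With a base of at least 2, constants and sums are absorbed into the exponent, so a single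
  -- number describes the bound.
  Poly : (ℕ → ℕ) → Set
  Poly f = ∃[ p ] ∀ V → f V ≤ (2 + V) ^ p

  n≤2^n : ∀ n → n ≤ 2 ^ n
  n≤2^n zero    = z≤n
  n≤2^n (suc n) = ≤-trans (+-mono-≤ (>-nonZero⁻¹ (2 ^ n) {{m^n≢0 2 n}}) (n≤2^n n))
                          (≤-reflexive (cong (2 ^ n +_) (sym (+-identityʳ _))))

  poly-const : ∀ c → Poly (λ _ → c)
  poly-const c = c , λ V → ≤-trans (n≤2^n c) (^-monoˡ-≤ c (m≤m+n 2 V))

  poly-id : Poly (λ V → V)
  poly-id = 1 , λ V → ≤-trans (m≤n+m V 2) (≤-reflexive (sym (*-identityʳ _)))

  poly-* : ∀ {f g} → Poly f → Poly g → Poly (λ V → f V * g V)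
  poly-* (p , hf) (q , hg) = p + q , λ V →
    ≤-trans (*-mono-≤ (hf V) (hg V)) (≤-reflexive (sym (^-distribˡ-+-* (2 + V) p q)))

  poly-+ : ∀ {f g} → Poly f → Poly g → Poly (λ V → f V + g V)
  poly-+ (p , hf) (q , hg) = suc (p + q) , λ V → begin
    _                                  ≤⟨ +-mono-≤ (hf V) (hg V) ⟩
    (2 + V) ^ p + (2 + V) ^ q          ≤⟨ +-mono-≤ (^-monoʳ-≤ (2 + V) (m≤m+n p q)) (^-monoʳ-≤ (2 + V) (m≤n+m q p)) ⟩
    (2 + V) ^ (p + q) + (2 + V) ^ (p + q) ≡⟨ cong ((2 + V) ^ (p + q) +_) (+-identityʳ _) ⟨
    2 * (2 + V) ^ (p + q)              ≤⟨ *-monoˡ-≤ ((2 + V) ^ (p + q)) (m≤m+n 2 V) ⟩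
    (2 + V) ^ suc (p + q)              ∎
    where open ≤-Reasoning

  -- The new base `2 + g V` is itself at most a power of `2 + V`, and exponents multiply.
  poly-∘ : ∀ {f g} → Poly f → Poly g → Poly (λ V → f (g V))
  poly-∘ {g = g} (p , hf) pg with poly-+ (poly-const 2) pg
  ... | q , hg = q * p , λ V → ≤-trans (hf (g V))
    (≤-trans (^-monoˡ-≤ p (hg V)) (≤-reflexive (^-*-assoc (2 + V) q p)))

  poly-value : ∀ {n} (e : Exp n) → Poly (valueBound e)
  poly-value (var i)   = poly-id
  poly-value (wk e)    = poly-value e
  poly-value zero      = poly-const 0
  poly-value (suc e)   = poly-+ (poly-const 1) (poly-value e)
  poly-value (a ⊕ b)   = poly-+ (poly-value a) (poly-value b)
  poly-value (a ⊖ b)   = poly-value a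
  poly-value (sum b s) = poly-* (poly-value b) (poly-∘ (poly-value s) (poly-+ poly-id (poly-value b)))
  poly-value (a ! e)   = poly-const 1

  poly-linear : ∀ c d {f} → Poly f → Poly (λ V → c + f V * d)
  poly-linear c d pf = poly-+ (poly-const c) (poly-* pf (poly-const d))

  poly-double : ∀ {f} → Poly f → Poly (λ V → 1 + 2 * f V)
  poly-double pf = poly-+ (poly-const 1) (poly-* (poly-const 2) pf)

  poly-extend : ∀ {n f} → Poly f → (e : Exp n) → Poly (λ V → f (V + valueBound e V))
  poly-extend pf e = poly-∘ pf (poly-+ poly-id (poly-value e))

  poly-suc : ∀ {f} → Poly f → Poly (λ V → suc (f V))
  poly-suc = poly-+ (poly-const 1)

  poly-costE : ∀ {n} (e : Exp n) → Poly (costE e)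
  poly-costE (var i)   = poly-+ (poly-linear 1 3 poly-id) (poly-linear 1 4 poly-id)
  poly-costE (wk e)    = poly-costE e
  poly-costE zero      = poly-const 1
  poly-costE (suc e)   = poly-+ (poly-costE e) (poly-const 1)
  poly-costE (a ⊕ b)   = poly-+ (poly-costE a) (poly-+ (poly-costE b) (poly-linear 1 3 (poly-value b)))
  poly-costE (a ⊖ b)   = poly-+ (poly-costE a) (poly-+ (poly-costE b) (poly-linear 1 3 (poly-value b)))
  poly-costE (sum b s) = poly-+ (poly-costE b) (poly-suc (poly-* (poly-value b) (poly-+ (poly-const 2)
    (poly-+ (poly-extend (poly-costE s) b) (poly-linear 1 3 (poly-extend (poly-value s) b))))))
  poly-costE (a ! e)   = poly-+ (poly-costE e) (poly-+ (poly-linear 1 3 B) (poly-suc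
    (poly-+ (poly-+ (poly-const 2) (poly-suc (poly-double (poly-suc B)))) (poly-double (poly-suc B)))))
    where B = poly-value e

  poly-costC : ∀ {n} (c : Cmd n) → Poly (costC c)
  poly-costC (c ⨾ d)       = poly-+ (poly-costC c) (poly-costC d)
  poly-costC (for e c)     = poly-+ (poly-costE e) (poly-suc (poly-* (poly-value e)
    (poly-+ (poly-const 2) (poly-extend (poly-costC c) e))))
  poly-costC (a [ i ]:= e) = poly-+ (poly-costE i) (poly-+ (poly-costE e) (poly-+ (poly-linear 1 3 I)
    (poly-suc (poly-suc (poly-+ (poly-+ (poly-const 2) (poly-+ (poly-double (poly-value e)) (poly-const 1)))
                        (poly-double (poly-suc I)))))))
    where I = poly-value i
  poly-costC (bind e c)    = poly-+ (poly-costE e)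
    (poly-+ (poly-extend (poly-costC c) e) (poly-double (poly-value e)))

  -- Reading the input and computing a power of two

  isBit : Sym → Bool
  isBit (bit _) = true
  isBit _       = false

  reading : List Sym → List Bool → Tape 1
  reading L []       = tape L blank []
  reading L (b ∷ bs) = tape L (bit b) (List.map bit bs)

  reading-next : ∀ L b w → shift moveRight (tape L (bit b) (List.map bit w)) ≡ reading (bit b ∷ L) w
  reading-next L b []      = refl
  reading-next L b (_ ∷ _) = refl

  setInp : State → Tape 1 → State
  setInp S t = record S { inp = t }

  rep-input : ∀ {ts S t} → Rep ts S → Rep (upd ts 0 t) (setInp S t)
  rep-input (rep e w) = rep refl w

  exec-input : ∀ {S t} f → inp S ≡ t → Exec (act 0 f) 1 S (setInp S (writeMove (f (Tape.head t)) t))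
  exec-input f refl {ts} r@(rep e w) = _ , 1 , ≤-refl , act ,
    rep-cong (eqv (cong (λ t → writeMove (f (Tape.head t)) t) e) (λ _ → refl) (λ _ _ → refl)) (rep-input r)

  exec-stop₀ : ∀ {S p} b → b (Tape.head (inp S)) ≡ false → Exec (while 0 b p) 1 S S
  exec-stop₀ b eq r = _ , 1 , ≤-refl , stop (trans (cong (b ∘ Tape.head) (input r)) eq) , r

  exec-loop₀ : ∀ {S S′ S″ p c d} b → b (Tape.head (inp S)) ≡ true → Exec p c S S′ →
    Exec (while 0 b p) d S′ S″ → Exec (while 0 b p) (suc (c + d)) S S″
  exec-loop₀ b eq ex ey r with ex r
  ... | _ , _ , le , run , r′ with ey r′
  ... | _ , _ , le′ , run′ , r″ = _ , _ , s≤s (+-mono-≤ le le′) ,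
    loop (trans (cong (b ∘ Tape.head) (input r)) eq) run run′ , r″

  advance : Prog
  advance = act 0 (_, moveRight)

  readUnary : ℕ → Prog
  readUnary i = while 0 isTrue (advance ⨟ inc i) ⨟ advance

  exec-advance : ∀ {S L b w} → inp S ≡ reading L (b ∷ w) → Exec advance 1 S (setInp S (reading (bit b ∷ L) w))
  exec-advance {S} {L} {b} {w} eq = exec-post (eqv (reading-next L b w) (λ _ → refl) (λ _ _ → refl)) (exec-input _ eq)

  exec-readUnary : ∀ i k {L w S} → inp S ≡ reading L (unary k ++ w) →
    ∃[ L′ ] Exec (readUnary i) (2 + k * 3) S (setInp (setPos S i (k + pos S i)) (reading L′ w))
  exec-readUnary i k {L} {w} {S} eq with count k eq
    where
    count : ∀ k {L S} → inp S ≡ reading L (unary k ++ w) →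
      ∃[ L′ ] Exec (while 0 isTrue (advance ⨟ inc i)) (1 + k * 3) S
        (setInp (setPos S i (k + pos S i)) (reading L′ (false ∷ w)))
    count zero {L} {S} eq = L , exec-post (eqv eq (λ j → sym (pos≡ (setPos-id S i) j)) (λ _ _ → refl))
      (exec-stop₀ isTrue (cong (isTrue ∘ Tape.head) eq))
    count (suc k) {L} {S} eq with count k {bit true ∷ L} {setPos (setInp S _) i (suc (pos S i))} refl
    ... | L′ , ex = L′ , exec-loop₀ isTrue (cong (isTrue ∘ Tape.head) eq) (exec-advance eq ▷ exec-inc i)
      (exec-post (eqv refl go (λ _ _ → refl)) ex)
      where
      go : ∀ j → upd (upd (pos S) i (suc (pos S i))) i (k + upd (pos S) i (suc (pos S i)) i) j ≡ upd (pos S) i (suc k + pos S i) j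
      go j with same? j i
      ... | yes refl = trans (cong (k +_) (upd-at (pos S) j)) (+-suc k _)
      ... | no _     = refl
  ... | L′ , ex = bit false ∷ L′ , exec-≤ (≤-reflexive (+-comm (1 + k * 3) 1)) (ex ▷ exec-advance refl)

  entry : List Bool → ℕ → Bool
  entry []       i       = false
  entry (b ∷ bs) zero    = b
  entry (b ∷ bs) (suc i) = entry bs i

  entry-∷ʳ : ∀ bs b → upd (entry bs) (length bs) b ≗ entry (bs ∷ʳ b)
  entry-∷ʳ []       b zero    = refl
  entry-∷ʳ []       b (suc i) = refl
  entry-∷ʳ (x ∷ bs) b zero    = refl
  entry-∷ʳ (x ∷ bs) b (suc i) with same? i (length bs) | entry-∷ʳ bs b i
  ... | yes _ | eq = eq
  ... | no _  | eq = eq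

  -- The input bit steers a loop that must run at most once, so the body overwrites this bit by
  -- `false` after copying it. An input bit `false` needs no writing, since fresh entries are
  -- `false`.
  copyBit : Prog
  copyBit = inc 0 ⨟ while 0 isTrue (write 0 true ⨟ act 0 (λ _ → bit false , stay)) ⨟ advance

  copyInput : Prog
  copyInput = while 0 isBit copyBit ⨟ clear 0

  holding : State → Tape 1 → ℕ → List Bool → State
  holding S t p bs = setCon (setPos (setInp S t) 0 p) 0 (entry bs)

  exec-copyBit : ∀ S L b w done →
    ∃[ L′ ] Exec copyBit 6 (holding S (reading L (b ∷ w)) (length done) done)
                           (holding S (reading L′ w) (suc (length done)) (done ∷ʳ b))
  exec-copyBit S L false w done = bit false ∷ L , exec-≤ (s≤s (s≤s (s≤s z≤n)))
    (exec-inc 0 ▷ exec-stop₀ isTrue refl ▷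
     exec-post (eqv refl go unchanged) (exec-advance {b = false} {w} refl))
    where
    go : ∀ j → upd (upd (pos S) 0 (length done)) 0 (suc (upd (pos S) 0 (length done) 0)) j ≡ upd (pos S) 0 (suc (length done)) j
    go zero    = refl
    go (suc j) = refl
    entry-false : ∀ bs → entry bs ≗ entry (bs ∷ʳ false)
    entry-false []       zero    = refl
    entry-false []       (suc i) = refl
    entry-false (x ∷ bs) zero    = refl
    entry-false (x ∷ bs) (suc i) = entry-false bs i
    unchanged : ∀ i → upd (con S) 0 (entry done) i ≗ upd (con S) 0 (entry (done ∷ʳ false)) i
    unchanged zero    k = entry-false done k
    unchanged (suc i) k = refl
  exec-copyBit S L true w done = bit false ∷ L , exec-≤ ≤-refl
    (exec-inc 0 ▷
     exec-loop₀ isTrue refl (exec-write 0 true refl ▷ exec-input _ refl) (exec-stop₀ isTrue refl) ▷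
     exec-post (eqv refl go written) (exec-advance {b = false} {w} refl))
    where
    go : ∀ j → upd (upd (pos S) 0 (length done)) 0 (suc (upd (pos S) 0 (length done) 0)) j ≡ upd (pos S) 0 (suc (length done)) j
    go zero    = refl
    go (suc j) = refl
    written : ∀ i → upd (upd (con S) 0 (entry done)) 0 (upd (entry done) (length done) true) i ≗ upd (con S) 0 (entry (done ∷ʳ true)) i
    written zero    = entry-∷ʳ done true
    written (suc i) k = refl

  exec-copyInput : ∀ S L w →
    ∃[ L′ ] Exec copyInput (2 + length w * 9) (holding S (reading L w) 0 []) (holding S (reading L′ []) 0 w)
  exec-copyInput S L w with copy w [] L
    where
    copy : ∀ w done L → ∃[ L′ ] Exec (while 0 isBit copyBit) (1 + length w * 7)
      (holding S (reading L w) (length done) done)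
      (holding S (reading L′ []) (length (done ++ w)) (done ++ w))
    copy [] done L = L , exec-post (subst (λ z → holding S (reading L []) (length done) done ≐ holding S (reading L []) (length z) z) (sym (++-identityʳ done)) ≐-refl)
      (exec-stop₀ isBit refl)
    copy (b ∷ w) done L with exec-copyBit S L b w done
    ... | L₁ , ex with copy w (done ∷ʳ b) L₁
    ... | L₂ , ey = L₂ , exec-loop₀ isBit refl ex
      (subst₂ (λ z p → Exec (while 0 isBit copyBit) (1 + length w * 7)
                     (holding S (reading L₁ w) p (done ∷ʳ b)) (holding S (reading L₂ []) (length z) z))
              (++-assoc done (b ∷ []) w)
              (trans (length-++ done) (+-comm (length done) 1)) ey)
  ... | L′ , ex = L′ , exec-≤ (≤-reflexive cost) (ex ▷ exec-post (eqv refl go (λ _ _ → refl)) (exec-clear 0))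
    where
    go : ∀ j → upd (upd (pos S) 0 (length w)) 0 0 j ≡ upd (pos S) 0 0 j
    go zero    = refl
    go (suc j) = refl
    linear : ∀ x → (1 + x * 7) + (1 + 2 * x) ≡ 2 + x * 9
    linear = solve-∀
    cost : (1 + length w * 7) + (1 + 2 * length w) ≡ 2 + length w * 9
    cost = linear (length w)

  -- Repeated doubling: the counter is poured into two scratch counters, and both are poured back.
  power : ℕ → Prog
  power l = inc (suc l) ⨟ countdown l (transfer₂ (suc l) (2 + l) (3 + l) ⨟ transfer (2 + l) (suc l) ⨟ transfer (3 + l) (suc l))

  exec-power : ∀ {S} l g → (∀ r → l ≤ r → pos S r ≡ 0) →
    Exec (power l) (1 + (1 + g * (2 + ((1 + 2 ^ g * 4) + ((1 + 2 ^ g * 3) + (1 + 2 ^ g * 3)))))) (setPos S l g) (setPos S (suc l) (2 ^ g))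
  exec-power {S} l g clean =
    exec-post start (exec-inc (suc l)) ▷
    exec-post (eqv refl end (λ _ _ → refl)) (exec-countdown l family atl g body)
    where
    family : ℕ → State
    -- When the loop counter shows `v`, the number of doublings done is `g ∸ v`.
    family v = setPos (setPos S l v) (suc l) (2 ^ (g ∸ v))
    clean₊ : ∀ i → pos S (i + l) ≡ 0
    clean₊ i = clean (i + l) (m≤n+m l i)
    atl : ∀ v → pos (family v) l ≡ v
    atl v = trans (upd-off (upd (pos S) l v) (suc≢ ∘ sym)) (upd-at (pos S) l)
    start : setPos (setPos S l g) (suc l) (suc (pos (setPos S l g) (suc l))) ≐ family g
    start = setPos-cong (trans (cong suc (trans (upd-off (pos S) suc≢) (clean₊ 1))) (cong (2 ^_) (sym (n∸n≡0 g))))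
    end : ∀ j → pos (family 0) j ≡ upd (pos S) (suc l) (2 ^ g) j
    end j with same? j (suc l) | same? j l
    ... | yes _ | _        = refl
    ... | no _  | yes refl = sym (clean₊ 0)
    ... | no _  | no _     = refl
    body : ∀ v → v < g → Exec (transfer₂ (suc l) (2 + l) (3 + l) ⨟ transfer (2 + l) (suc l) ⨟ transfer (3 + l) (suc l))
      ((1 + 2 ^ g * 4) + ((1 + 2 ^ g * 3) + (1 + 2 ^ g * 3))) (setPos (family (suc v)) l v) (family v)
    body v v<g = exec-post (eqv refl total (λ _ _ → refl))
      (exec-≤ (s≤s (*-monoˡ-≤ 4 (≤-trans (≤-reflexive T₁) P≤)))
              (exec-transfer₂ (suc l) (2 + l) (3 + l) (λ ()) (λ ()) (λ ()))
      ▷ exec-≤ (s≤s (*-monoˡ-≤ 3 (≤-trans (≤-reflexive U₂) P≤))) (exec-transfer (2 + l) (suc l) (λ ()))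
      ▷ exec-≤ (s≤s (*-monoˡ-≤ 3 (≤-trans (≤-reflexive W₃) P≤))) (exec-transfer (3 + l) (suc l) (λ ())))
      where
      P = 2 ^ (g ∸ suc v)
      P≤ : P ≤ 2 ^ g
      P≤ = ^-monoʳ-≤ 2 (m∸n≤m g (suc v))
      T = setPos (family (suc v)) l v
      U = setPos (setPos (setPos T (suc l) 0) (2 + l) (pos T (2 + l) + pos T (suc l))) (3 + l) (pos T (3 + l) + pos T (suc l))
      W = setPos (setPos U (2 + l) 0) (suc l) (pos U (suc l) + pos U (2 + l))
      T-off : ∀ j → j ≢ l → j ≢ suc l → pos T j ≡ pos S j
      T-off j p q = trans (upd-off (pos (family (suc v))) p) (trans (upd-off (upd (pos S) l (suc v)) q) (upd-off (pos S) p))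
      T₁ : pos T (suc l) ≡ P
      T₁ = trans (upd-off (pos (family (suc v))) {l} {suc l} suc≢) (upd-at (upd (pos S) l (suc v)) (suc l))
      U₂ : pos U (2 + l) ≡ P
      U₂ = trans (upd-off (upd (upd (pos T) (suc l) 0) (2 + l) (pos T (2 + l) + pos T (suc l))) {3 + l} {2 + l} (λ ()))
          (trans (upd-at (upd (pos T) (suc l) 0) (2 + l))
                 (cong₂ _+_ (trans (T-off (2 + l) (λ ()) (λ ())) (clean₊ 2)) T₁))
      U₃ : pos U (3 + l) ≡ P
      U₃ = trans (upd-at (upd (upd (pos T) (suc l) 0) (2 + l) (pos T (2 + l) + pos T (suc l))) (3 + l))
                 (cong₂ _+_ (trans (T-off (3 + l) (λ ()) (λ ())) (clean₊ 3)) T₁)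
      U₁ : pos U (suc l) ≡ 0
      U₁ = trans (upd-off (upd (upd (pos T) (suc l) 0) (2 + l) (pos T (2 + l) + pos T (suc l))) {3 + l} {suc l} (λ ()))
          (trans (upd-off (upd (pos T) (suc l) 0) {2 + l} {suc l} (λ ())) (upd-at (pos T) (suc l)))
      W₁ : pos W (suc l) ≡ P
      W₁ = trans (upd-at (upd (pos U) (2 + l) 0) (suc l)) (cong₂ _+_ U₁ U₂)
      W₃ : pos W (3 + l) ≡ P
      W₃ = trans (upd-off (upd (pos U) (2 + l) 0) {suc l} {3 + l} (λ ())) (trans (upd-off (pos U) {2 + l} {3 + l} (λ ())) U₃)
      total : ∀ j → upd (upd (pos W) (3 + l) 0) (suc l) (pos W (suc l) + pos W (3 + l)) j ≡ pos (family v) j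
      total j with same? j (suc l) | same? j (3 + l) | same? j (2 + l) | same? j l
      ... | yes refl | _ | _ | _ = begin
        pos W (suc l) + pos W (3 + l) ≡⟨ cong₂ _+_ W₁ W₃ ⟩
        P + P                         ≡⟨ cong (P +_) (+-identityʳ P) ⟨
        2 ^ suc (g ∸ suc v)           ≡⟨ cong (2 ^_) (+-∸-assoc 1 v<g) ⟨
        2 ^ (g ∸ v)                   ∎
        where open ≡-Reasoning
      ... | no _ | yes refl | _        | yes ()
      ... | no _ | yes refl | _        | no _ = sym (clean₊ 3)
      ... | no _ | no _     | yes refl | yes ()
      ... | no _ | no _     | yes refl | no _ = sym (clean₊ 2)
      ... | no _ | no _     | no _     | yes refl = refl
      ... | no _ | no _     | no _     | no _     = refl

-- From programs to decision procedures with a time bound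

module Decision where

  open TapePrograms
  open TapeStates
  open Language
  open Compilation
  open CostsAndInput
  open import Data.Bool.Base using (Bool; true; false)
  open import Data.Fin.Base as Fin using (Fin)
  open import Data.List.Base as List using (List; []; _∷_; _++_; length; replicate)
  open import Data.List.Properties using (length-++; length-replicate)
  open import Data.Maybe.Base using (just)
  open import Data.Nat.Base
  open import Data.Nat.Properties
  open import Data.Nat.Tactic.RingSolver using (solve-∀)
  open import Data.Product.Base using (∃-syntax; _,_; proj₁; proj₂)
  open import Data.Vec.Base as Vec using (Vec; []; _∷_)
  open import Function.Base using (_∘_)
  open import Relation.Binary.PropositionalEquality

  open State
  open _≐_
  open Rep

  ^-distribʳ-* : ∀ p a b → (a * b) ^ p ≡ a ^ p * b ^ p
  ^-distribʳ-* zero    a b = refl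
  ^-distribʳ-* (suc p) a b = trans (cong (a * b *_) (^-distribʳ-* p a b)) (interchange a b (a ^ p) (b ^ p))
    where
    interchange : ∀ a b c d → a * b * (c * d) ≡ a * c * (b * d)
    interchange = solve-∀

  -- The point is 2 + k + n + N ≤ (2 + k + N) (1 + n + m), where 1 + n + m will be the length of the
  -- encoding: in the p-th power of the right-hand side the parameter and the length are separate
  -- factors. The additional factor in the exponent `suc p` pays for the linear cost of reading the
  -- input.
  budget : ∀ p k n m N A {W} → W ≤ (2 + (k + n + N)) ^ p →
    A + (6 + (n * 3 + m * 9)) + W ≤ (A + 15 + (2 + (k + N)) ^ p) * (1 + n + m) ^ suc p
  budget p k n m N A {W} W≤ = begin
    A + (6 + (n * 3 + m * 9)) + W ≤⟨ +-mono-≤ (+-mono-≤ A≤ six) (≤-trans W≤ Y≤) ⟩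
    A * X + 15 * X + Y * X        ≡⟨ distribute A Y X ⟩
    (A + 15 + Y) * X              ∎
    where
    open ≤-Reasoning
    L = 1 + n + m
    X = L ^ suc p
    Y = (2 + (k + N)) ^ p
    distribute : ∀ a y x → a * x + 15 * x + y * x ≡ (a + 15 + y) * x
    distribute = solve-∀
    A≤ : A ≤ A * X
    A≤ = ≤-trans (≤-reflexive (sym (*-identityʳ A))) (*-monoʳ-≤ A (>-nonZero⁻¹ X {{m^n≢0 L (suc p)}}))
    L≤X : L ≤ X
    L≤X = ≤-trans (≤-reflexive (sym (*-identityʳ L))) (*-monoʳ-≤ L (>-nonZero⁻¹ (L ^ p) {{m^n≢0 L p}}))
    six : 6 + (n * 3 + m * 9) ≤ 15 * X
    six = ≤-trans (≤-trans (m≤m+n _ (9 + n * 12 + m * 6)) (≤-reflexive (fifteen n m))) (*-monoʳ-≤ 15 L≤X)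
      where
      fifteen : ∀ n m → 6 + (n * 3 + m * 9) + (9 + n * 12 + m * 6) ≡ 15 * (1 + n + m)
      fifteen = solve-∀
    base : 2 + (k + n + N) ≤ (2 + (k + N)) * L
    base = ≤-trans (m≤m+n _ (n + (k + N) * n + (2 + (k + N)) * m)) (≤-reflexive (expand k n N m))
      where
      expand : ∀ k n N m → 2 + (k + n + N) + (n + (k + N) * n + (2 + (k + N)) * m) ≡ (2 + (k + N)) * (1 + n + m)
      expand = solve-∀
    Y≤ : (2 + (k + n + N)) ^ p ≤ Y * X
    Y≤ = begin
      (2 + (k + n + N)) ^ p     ≤⟨ ^-monoˡ-≤ p base ⟩
      ((2 + (k + N)) * L) ^ p   ≡⟨ ^-distribʳ-* p (2 + (k + N)) L ⟩
      Y * L ^ p                 ≤⟨ *-monoʳ-≤ Y (^-monoʳ-≤ L (n≤1+n p)) ⟩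
      Y * X                     ∎

  load : List Bool → Mem
  load bits = upd (λ _ _ → false) 0 (entry bits)

  blankState : List Bool → State
  blankState w = state (inputTape w) (λ _ → 0) (λ _ _ → false)

  rep-blank : ∀ w → Rep (markedTapes w) (blankState w)
  rep-blank w = rep refl λ _ → at refl refl λ _ → refl

  module Decide (P : Prog) (out W : ℕ) (P≤W : maxTape P ≤ W) (out≤W : suc out ≤ W) where

    open Machine P (suc out) W P≤W out≤W public using (machine)
    open Machine P (suc out) W P≤W out≤W using (machine-correct)

    verdict : ∀ {w c S} T → 2 + c ≤ T → Exec P c (blankState w) S →
      TuringMachine.runFor machine T (TuringMachine.initial machine w) ≡ just (0 <ᵇ pos S out)
    verdict {w} {c} {S} T le ex with ex (rep-blank w)
    ... | ts , d , d≤c , ⇓P , r =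
      trans (runFor-mono machine (≤-trans (s≤s (s≤s d≤c)) le) (machine-correct ⇓P))
            (cong just (head-positive (work r out)))

  -- Values of expressions are polynomially bounded, so 2 ^ g k is in general out of reach of the
  -- language. A tape program computes it and hands it to `body` as a variable.
  module Program (gE : Exp 1) (g : ℕ → ℕ) (gE≡g : ∀ k M → ⟦ gE ⟧ (k ∷ []) M ≡ g k)
                 (body : Cmd 3) (answer : Exp 3) where

    -- Counter 6 holds k, counter 7 holds n, and counter 9 holds 2 ^ g k.
    rs : Vec ℕ 3
    rs = 9 ∷ 7 ∷ 6 ∷ []

    main : Prog
    main = readUnary 6 ⨟ readUnary 7 ⨟ copyInput ⨟ compE gE (6 ∷ []) 8 ⨟ power 8 ⨟
           compC body rs 10 ⨟ compE answer rs 10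

    -- The answer is in counter 10, which is tape 11.
    width : ℕ
    width = maxTape main ⊔ 11

    open Decide main 10 width (m≤m⊔n (maxTape main) 11) (m≤n⊔m (maxTape main) 11) public using (machine)
    open Decide main 10 width (m≤m⊔n (maxTape main) 11) (m≤n⊔m (maxTape main) 11) using (verdict)

    values : ℕ → ℕ → Vec ℕ 3
    values k n = 2 ^ g k ∷ n ∷ k ∷ []

    powerCost : ℕ → ℕ
    powerCost g = 1 + (1 + g * (2 + ((1 + 2 ^ g * 4) + ((1 + 2 ^ g * 3) + (1 + 2 ^ g * 3)))))

    total : ℕ → ℕ → ℕ → ℕ
    total k n m = let V = k + n + 2 ^ g k in
      (2 + k * 3) + ((2 + n * 3) + ((2 + m * 9) + (costE gE k + (powerCost (g k) + (costC body V + costE answer V)))))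

    result : ℕ → ℕ → List Bool → ℕ
    result k n bits = ⟦ answer ⟧ (values k n) (⟪ body ⟫ (values k n) (load bits))

    module _ (k n : ℕ) (bits : List Bool) where

      w : List Bool
      w = unary k ++ unary n ++ bits

      P₂ P₃ : ℕ → ℕ
      P₂ = upd (upd (λ _ → 0) 6 k) 7 n
      P₃ = upd P₂ 9 (2 ^ g k)

      run : ∃[ L ] Exec main (total k n (length bits)) (blankState w)
        (setPos (state L P₃ (⟪ body ⟫ (values k n) (load bits))) 10 (result k n bits))
      run with exec-readUnary 6 k {[]} {unary n ++ bits} {blankState w} (start w)
        where
        start : ∀ w → inputTape w ≡ reading [] w
        start []      = refl
        start (_ ∷ _) = refl
      ... | L₁ , ex₁ with exec-readUnary 7 n {L₁} {bits} {state (reading L₁ (unary n ++ bits)) (upd (λ _ → 0) 6 k) (λ _ _ → false)} refl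
      ... | L₂ , ex₂ with exec-copyInput (state (reading L₂ bits) P₂ (λ _ _ → false)) L₂ bits
      ... | L₃ , ex₃ = reading L₃ [] ,
        (exec-post (eqv refl after-k (λ _ _ → refl)) ex₁ ▷
         exec-post (eqv refl after-n (λ _ _ → refl)) ex₂ ▷
         exec-pre (eqv refl same-pos same-con) (exec-post (eqv refl (sym ∘ same-pos) (λ _ _ → refl)) ex₃) ▷
         exec-post (setPos-cong {S₃} (gE≡g k (load bits))) (correctE gE ok₁ (λ { Fin.zero → ≤-refl })) ▷
         exec-power 8 (g k) clean₈ ▷
         correctC body ok₂ bounded ▷
         correctE answer (ok-setMem ok₂) bounded)
        where
        S₃ = state (reading L₃ []) P₂ (load bits)
        S₄ = state (reading L₃ []) P₃ (load bits)
        after-k : ∀ j → upd (λ _ → 0) 6 (k + 0) j ≡ upd (λ _ → 0) 6 k j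
        after-k j = cong (λ z → upd (λ _ → 0) 6 z j) (+-identityʳ k)
        after-n : ∀ j → upd (upd (λ _ → 0) 6 k) 7 (n + 0) j ≡ P₂ j
        after-n j = cong (λ z → upd (upd (λ _ → 0) 6 k) 7 z j) (+-identityʳ n)
        same-pos : ∀ j → P₂ j ≡ upd P₂ 0 0 j
        same-pos zero    = refl
        same-pos (suc j) = refl
        same-con : ∀ i → (λ _ → false) ≗ upd (λ _ _ → false) 0 (entry []) i
        same-con zero    j = refl
        same-con (suc i) j = refl
        clean₈ : ∀ r → 8 ≤ r → P₂ r ≡ 0
        clean₈ (suc (suc (suc (suc (suc (suc (suc (suc r)))))))) _ = refl
        clean₈ 0 ()
        clean₈ 1 (s≤s ())
        clean₈ 2 (s≤s (s≤s ()))
        clean₈ 3 (s≤s (s≤s (s≤s ())))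
        clean₈ 4 (s≤s (s≤s (s≤s (s≤s ()))))
        clean₈ 5 (s≤s (s≤s (s≤s (s≤s (s≤s ())))))
        clean₈ 6 (s≤s (s≤s (s≤s (s≤s (s≤s (s≤s ()))))))
        clean₈ 7 (s≤s (s≤s (s≤s (s≤s (s≤s (s≤s (s≤s ())))))))
        rest₂ : ∀ a → a < arrays → P₂ a ≡ 0
        rest₂ a a<A = trans (upd-off (upd (λ _ → 0) 6 k) (<⇒≢ (m<n⇒m<1+n a<A))) (upd-off (λ _ → 0) (<⇒≢ a<A))
        ok₁ : Ok S₃ 8 (6 ∷ []) (k ∷ [])
        ok₁ = ok (λ { Fin.zero → refl }) (λ { Fin.zero → m≤m+n 7 1 }) clean₈ rest₂ (m≤m+n 6 2)
        ok₂ : Ok S₄ 10 rs (values k n)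
        ok₂ = ok (λ { Fin.zero → refl ; (Fin.suc Fin.zero) → refl ; (Fin.suc (Fin.suc Fin.zero)) → refl })
                 (λ { Fin.zero → m≤m+n 10 0 ; (Fin.suc Fin.zero) → m≤m+n 8 2 ; (Fin.suc (Fin.suc Fin.zero)) → m≤m+n 7 3 })
                 (λ r 10≤r → trans (upd-off P₂ (>⇒≢ 10≤r)) (clean₈ r (≤-trans (m≤m+n 8 2) 10≤r)))
                 (λ a a<A → trans (upd-off P₂ (<⇒≢ (≤-trans a<A (m≤m+n 6 3)))) (rest₂ a a<A))
                 (m≤m+n 6 4)
        bounded : Bounded (values k n) (k + n + 2 ^ g k)
        bounded Fin.zero                       = m≤n+m _ (k + n)
        bounded (Fin.suc Fin.zero)             = ≤-trans (m≤n+m n k) (m≤m+n (k + n) _)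
        bounded (Fin.suc (Fin.suc Fin.zero))   = ≤-trans (m≤m+n k n) (m≤m+n (k + n) _)

    -- Abstract, so that the power (2 + V) ^ p is not expanded.
    abstract
      exponent : Poly (λ V → costC body V + costE answer V)
      exponent = poly-+ (poly-costC body) (poly-costE answer)

    p : ℕ
    p = proj₁ exponent

    setupCost : ℕ → ℕ
    setupCost k = (2 + k * 3) + (costE gE k + powerCost (g k))

    factor : ℕ → ℕ
    factor k = setupCost k + 15 + (2 + (k + 2 ^ g k)) ^ p

    total-bound : ∀ k n m → 2 + total k n m ≤ factor k * (1 + n + m) ^ suc p
    total-bound k n m = ≤-trans
      (≤-reflexive (regroup (2 + k * 3) (costE gE k) (powerCost (g k)) (costC body V + costE answer V) n m))
      (budget p k n m (2 ^ g k) (setupCost k) (proj₂ exponent V))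
      where
      V = k + n + 2 ^ g k
      regroup : ∀ a b c d n m → 2 + (a + ((2 + n * 3) + ((2 + m * 9) + (b + (c + d))))) ≡ (a + (b + c)) + (6 + (n * 3 + m * 9)) + d
      regroup = solve-∀

    decides : ∀ k n bits →
      TuringMachine.runFor machine (factor k * length (unary n ++ bits) ^ suc p)
        (TuringMachine.initial machine (unary k ++ unary n ++ bits)) ≡ just (0 <ᵇ result k n bits)
    decides k n bits = verdict (factor k * length (unary n ++ bits) ^ suc p)
      (≤-trans (total-bound k n (length bits)) (≤-reflexive (cong (λ z → factor k * z ^ suc p) (sym len))))
      (proj₂ (run k n bits))
      where
      len : length (unary n ++ bits) ≡ 1 + n + length bits
      len = trans (length-++ (unary n)) (cong (_+ length bits)
            (trans (length-++ (replicate n true)) (trans (+-comm _ 1) (cong suc (length-replicate n)))))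

-- Searching for extremal elements

module TreeDecompositions where

  open import Data.Bool.Base using (T)
  open import Data.Bool.Properties using (T?)
  open import Data.Empty using (⊥; ⊥-elim)
  open import Data.Fin.Base using (Fin; zero; suc)
  open import Data.Fin.Properties as Finₚ using (any?)
  open import Data.Fin.Subset using (Subset; _∈_; ∣_∣; Nonempty)
  open import Data.Fin.Subset.Properties using (_∈?_; p⊆q⇒∣p∣≤∣q∣; nonempty?; Empty-unique; ∣⊥∣≡0)
  open import Data.List.Base as List using (List; []; _∷_; _∷ʳ_)
  open import Data.List.Extrema.Nat using (max; xs≤max)
  open import Data.List.Membership.Propositional as ListMem using ()
  open import Data.List.Relation.Unary.All as All using (All; []; _∷_)
  open import Data.List.Relation.Unary.All.Properties using (¬Any⇒All¬; tabulate⁻)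
  open import Data.List.Relation.Unary.Any using (here; there)
  import Data.List.Membership.DecPropositional as DecMem
  open import Data.List.Relation.Unary.AllPairs using ([]; _∷_)
  open import Data.List.Relation.Unary.Linked using (Linked; [-]; _∷_; [])
  open import Data.List.Relation.Unary.Unique.Propositional using (Unique)
  open import Data.Nat.Base
  open import Data.Nat.Properties
  open import Data.Product.Base using (∃-syntax; ∃; _×_; _,_; proj₁; proj₂)
  open import Data.Sum.Base using (_⊎_; inj₁; inj₂)
  open import Function.Base using (_∘_)
  open import Relation.Binary.Construct.Closure.ReflexiveTransitive as Star using (Star; ε; _◅_; _◅◅_)
  open import Relation.Binary.PropositionalEquality
  open import Relation.Nullary.Decidable using (Dec; yes; no; _×-dec_)
  open import Relation.Nullary.Negation using (¬_; contradiction)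

  minimum : ∀ {n} (P : Fin n → Set) → (∀ i → Dec (P i)) → (f : Fin n → ℕ) → ∃ P →
            ∃[ i ] (P i × ∀ j → P j → f i ≤ f j)
  minimum P P? f (i , pi) = go (suc (f i)) i pi ≤-refl
    where
    go : ∀ fuel i → P i → f i < fuel → ∃[ i ] (P i × ∀ j → P j → f i ≤ f j)
    go (suc fuel) i pi lt with any? (λ j → P? j ×-dec (f j <? f i))
    ... | yes (j , pj , fj<fi) = go fuel j pj (≤-trans fj<fi (s≤s⁻¹ lt))
    ... | no none              = i , pi , λ j pj → ≮⇒≥ λ lt → none (j , pj , lt)

  maximum : ∀ {n} (P : Fin n → Set) → (∀ i → Dec (P i)) → (f : Fin n → ℕ) → ∃ P →
            ∃[ i ] (P i × ∀ j → P j → f j ≤ f i)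
  maximum {n} P P? f ex with minimum P P? (λ i → bound ∸ f i) ex
    where bound = max 0 (List.tabulate f)
  ... | i , pi , least = i , pi , λ j pj → begin
    f j                     ≡⟨ m∸[m∸n]≡n (≤bound j) ⟨
    bound ∸ (bound ∸ f j)   ≤⟨ ∸-monoʳ-≤ bound (least j pj) ⟩
    bound ∸ (bound ∸ f i)   ≡⟨ m∸[m∸n]≡n (≤bound i) ⟩
    f i                     ∎
    where
    open ≤-Reasoning
    bound = max 0 (List.tabulate f)
    ≤bound : ∀ i → f i ≤ bound
    ≤bound = tabulate⁻ (xs≤max 0 (List.tabulate f))

  least : (P : ℕ → Set) → (∀ i → Dec (P i)) → ∃ P → ∃[ m ] (P m × ∀ j → P j → m ≤ j)
  least P P? (n , pn) with below (suc n)
    where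
    below : ∀ n → (∃[ m ] (P m × ∀ j → P j → m ≤ j)) ⊎ (∀ j → j < n → ¬ P j)
    below zero = inj₂ λ _ ()
    below (suc n) with below n
    ... | inj₁ found = inj₁ found
    ... | inj₂ none with P? n
    ...   | yes pn = inj₁ (n , pn , λ j pj → ≮⇒≥ λ j<n → none j j<n pj)
    ...   | no ¬pn = inj₂ λ j j<1+n pj → case j (m≤n⇒m<n∨m≡n (s≤s⁻¹ j<1+n)) pj
      where
      case : ∀ j → j < n ⊎ j ≡ n → ¬ P j
      case j (inj₁ j<n)  = none j j<n
      case j (inj₂ refl) = ¬pn
  ... | inj₁ found = found
  ... | inj₂ none  = contradiction pn (none n ≤-refl)

  nonempty-of-size : ∀ {n} (A : Subset n) {m} → m < ∣ A ∣ → Nonempty A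
  nonempty-of-size {n} A {m} m<A with nonempty? A
  ... | yes ne = ne
  ... | no  em = contradiction (subst (λ B → m < ∣ B ∣) (Empty-unique em) m<A) (λ lt → n≮0 (≤-trans lt (≤-reflexive (∣⊥∣≡0 n))))

  -- Rooted trees

  module RootedTree (H : Graph) (isTree : IsTree H) where

    open Graph H
    open IsTree isTree
    open DecMem {A = Vertex} Finₚ._≟_ using () renaming (_∈?_ to _∈ₗ?_)

    adj-sym : ∀ {u v} → Adjacent u v → Adjacent v u
    adj-sym {u} {v} = subst T (symmetric u v)

    Avoiding : Vertex → Vertex → Vertex → Set
    Avoiding p i j = Adjacent i j × i ≢ p × j ≢ p

    avoiding-sym : ∀ {p i j} → Avoiding p i j → Avoiding p j i
    avoiding-sym (a , b , c) = adj-sym a , c , b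

    data EndsAt (y : Vertex) : List Vertex → Set where
      here  : EndsAt y (y ∷ [])
      there : ∀ {x z zs} → EndsAt y (z ∷ zs) → EndsAt y (x ∷ z ∷ zs)

    record SimplePath (p x y : Vertex) : Set where
      constructor simple
      field
        rest   : List Vertex
        linked : Linked Adjacent (x ∷ rest)
        unique : Unique (x ∷ rest)
        ends   : EndsAt y (x ∷ rest)
        avoids : All (_≢ p) (x ∷ rest)

    restart : ∀ {p x y zs} → x ListMem.∈ zs → Linked Adjacent zs → Unique zs → EndsAt y zs →
              All (_≢ p) zs → SimplePath p x y
    restart (here refl)         l       u       e         a       = simple _ l u e a
    restart (there x∈zs@(here _))  (_ ∷ l) (_ ∷ u) (there e) (_ ∷ a) = restart x∈zs l u e a
    restart (there x∈zs@(there _)) (_ ∷ l) (_ ∷ u) (there e) (_ ∷ a) = restart x∈zs l u e a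

    -- Built from the end of the walk: if the new vertex already lies on the simple path, the part
    -- before that occurrence is discarded by `restart`.
    loopErase : ∀ {p x y} → x ≢ p → Star (Avoiding p) x y → SimplePath p x y
    loopErase x≢p ε = simple [] [-] ([] ∷ []) here (x≢p ∷ [])
    loopErase {x = x} x≢p (_◅_ {j = z} (xz , _ , z≢p) walk) with loopErase z≢p walk
    ... | simple zs l u e a with x ∈ₗ? (z ∷ zs)
    ...   | yes x∈ = restart x∈ l u e a
    ...   | no x∉  = simple (z ∷ zs) (xz ∷ l) (¬Any⇒All¬ _ x∉ ∷ u) (there e) (x≢p ∷ a)

    linked-∷ʳ : ∀ {y w zs} → Linked Adjacent zs → EndsAt y zs → Adjacent y w → Linked Adjacent (zs ∷ʳ w)
    linked-∷ʳ [-]     here      yw = yw ∷ [-]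
    linked-∷ʳ (a ∷ l) (there e) yw = a ∷ linked-∷ʳ l e yw

    -- Otherwise a simple path between the two neighbours, together with `p`, would be a cycle.
    cut : ∀ {p j₁ j₂} → Adjacent p j₁ → Adjacent p j₂ → j₁ ≢ j₂ → j₁ ≢ p → ¬ Star (Avoiding p) j₁ j₂
    cut {p} {j₁} {j₂} pj₁ pj₂ j₁≢j₂ j₁≢p walk with loopErase j₁≢p walk
    ... | simple [] l u here a = j₁≢j₂ refl
    ... | simple (z ∷ zs) l u e a = acyclic record
      { v        = p
      ; vs       = j₁ ∷ z ∷ zs
      ; long     = s≤s (s≤s z≤n)
      ; distinct = All.map (_∘ sym) a ∷ u
      ; closed   = pj₁ ∷ linked-∷ʳ l e (adj-sym pj₂)
      }

    root : Vertex
    root = nonempty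

    -- Walks of a prescribed length are decidable by recursion; the least length that occurs is the
    -- depth.
    Near : ℕ → Vertex → Set
    Near zero    i = i ≡ root
    Near (suc l) i = ∃[ j ] (Adjacent i j × Near l j)

    near? : ∀ l i → Dec (Near l i)
    near? zero    i = i Finₚ.≟ root
    near? (suc l) i = any? λ j → T? (adj i j) ×-dec near? l j

    near : ∀ {i} → Star Adjacent i root → ∃[ l ] Near l i
    near ε       = 0 , refl
    near (a ◅ w) with near w
    ... | l , n = suc l , _ , a , n

    abstract
      nearest : ∀ i → ∃[ m ] (Near m i × ∀ j → Near j i → m ≤ j)
      nearest i = least (λ l → Near l i) (λ l → near? l i) (near (connected i root))

      depth : Vertex → ℕ
      depth i = proj₁ (nearest i)

      -- The second vertex of a shortest walk to the root.
      parent : ∀ i → i ≢ root → ∃[ j ] (Adjacent i j × depth j < depth i)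
      parent i i≢root with nearest i
      ... | zero  , n           , _ = contradiction n i≢root
      ... | suc m , (j , a , n) , _ = j , a , s≤s (proj₂ (proj₂ (nearest j)) m n)

      depth-root : depth root ≡ 0
      depth-root = n≤0⇒n≡0 (proj₂ (proj₂ (nearest root)) 0 refl)

    -- Going from parent to parent strictly lowers the depth, so after the start only vertices of
    -- smaller depth than `p` are met.
    toRoot : ∀ {p} q → q ≢ p → depth q ≤ depth p → Star (Avoiding p) q root
    toRoot {p} q q≢p le = go (suc (depth q)) q q≢p ≤-refl le
      where
      go : ∀ fuel q → q ≢ p → depth q < fuel → depth q ≤ depth p → Star (Avoiding p) q root
      go (suc fuel) q q≢p lt le with q Finₚ.≟ root
      ... | yes refl = ε
      ... | no q≢root with parent q q≢root
      ...   | j , qj , j<q = (qj , q≢p , j≢p) ◅ go fuel j j≢p (≤-trans j<q (s≤s⁻¹ lt)) (≤-trans (<⇒≤ j<q) le)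
        where
        j≢p : j ≢ p
        j≢p refl = <⇒≱ j<q le

    -- A walk is split at its last visit to `p`, if there is one. `Q` carries along a property of
    -- the vertices entered, here that their bags contain a given vertex.
    lastExit : ∀ {R : Vertex → Vertex → Set} (Q : Vertex → Set) {p x y} →
      (∀ {i j} → R i j → Adjacent i j × Q j) → Star R x y → y ≢ p →
      (x ≢ p × Star (Avoiding p) x y) ⊎ (∃[ j ] (Adjacent p j × Q j × j ≢ p × Star (Avoiding p) j y))
    lastExit Q h ε y≢p = inj₁ (y≢p , ε)
    lastExit Q {p} {x} h (r ◅ w) y≢p with lastExit Q h w y≢p
    ... | inj₂ found = inj₂ found
    ... | inj₁ (z≢p , w′) with x Finₚ.≟ p | h r
    ...   | yes refl | a , qz = inj₂ (_ , a , qz , z≢p , w′)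
    ...   | no x≢p   | a , _  = inj₁ (x≢p , (a , x≢p , z≢p) ◅ w′)

  -- Bicliques and tree decompositions

  module Biclique (G : Graph) (D : TreeDecomposition G) where

    open TreeDecomposition D
    open RootedTree tree isTree
    open Graph tree using () renaming (Vertex to Node)
    open Graph G using (Vertex; Adjacent)

    record Top (v : Vertex) : Set where
      field
        node    : Node
        inside  : v ∈ bag node
        highest : ∀ i → v ∈ bag i → depth node ≤ depth i

    open Top

    abstract
      top : ∀ v → Top v
      top v with minimum (λ i → v ∈ bag i) (λ i → v ∈? bag i) depth (coversVertices v)
      ... | i , v∈ , h = record { node = i ; inside = v∈ ; highest = h }

    -- The bags of v and u meet; going up from a common node, those of u reach at least as
    -- high as the top node of v, hence pass through it.
    top-contains : ∀ u v → Adjacent u v → depth (node (top u)) ≤ depth (node (top v)) → u ∈ bag (node (top v))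
    top-contains u v uv q≤p with u ∈? bag (node (top v))
    ... | yes u∈ = u∈
    ... | no u∉ with coversEdges u v uv
    ...   | i , u∈i , v∈i = ⊥-elim (conclude (lastExit (λ j → v ∈ bag j) (λ (a , b , c) → c , b) (coherent v p i (inside (top v)) v∈i) i≢p))
      where
      p q : Node
      p = node (top v)
      q = node (top u)
      off : ∀ {j} → u ∈ bag j → j ≢ p
      off u∈j refl = u∉ u∈j
      i≢p : i ≢ p
      i≢p = off u∈i
      q≢p : q ≢ p
      q≢p = off (inside (top u))
      i⟶root : Star (Avoiding p) i root
      i⟶root = Star.map (λ (a , b , c) → c , off a , off b) (coherent u i q u∈i (inside (top u))) ◅◅ toRoot q q≢p q≤p
      p≢root : p ≢ root
      p≢root p≡root with q Finₚ.≟ root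
      ... | yes q≡root = q≢p (trans q≡root (sym p≡root))
      ... | no q≢root with parent q q≢root
      ...   | j , _ , j<q = n≮0 (≤-trans j<q (≤-trans q≤p (≤-reflexive (trans (cong depth p≡root) depth-root))))
      conclude : (p ≢ p × Star (Avoiding p) p i) ⊎
                 (∃[ j ] (Graph.Adjacent tree p j × v ∈ bag j × j ≢ p × Star (Avoiding p) j i)) → ⊥
      conclude (inj₁ (p≢p , _)) = p≢p refl
      conclude (inj₂ (j , pj , v∈j , j≢p , walk)) with parent p p≢root
      -- From `j`, the next node after the last visit to `p`, a walk leads to `i`, through bags of
      -- `u` to `q`, up to the root and down to the parent `j₀` of `p`, always avoiding `p`. Since
      -- the bag of `j` contains `v`, `j` is not above the top node `p`, so it differs from `j₀`.
      ... | j₀ , pj₀ , j₀<p = cut pj pj₀ j≢j₀ j≢p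
        (walk ◅◅ i⟶root ◅◅ Star.reverse avoiding-sym (toRoot j₀ j₀≢p (<⇒≤ j₀<p)))
        where
        j≢j₀ : j ≢ j₀
        j≢j₀ refl = <⇒≱ j₀<p (highest (top v) j v∈j)
        j₀≢p : j₀ ≢ p
        j₀≢p refl = n≮n _ j₀<p

    bag≤ : ∀ i → ∣ bag i ∣ ≤ suc width
    bag≤ i = ≤-trans (tabulate⁻ (xs≤max 0 (List.tabulate (∣_∣ ∘ bag))) i) (m≤n+m∸n _ 1)

    Joined : Subset (Graph.order G) → Subset (Graph.order G) → Set
    Joined A B = ∀ a b → a ∈ A → b ∈ B → Adjacent a b

    no-biclique : ∀ {A B} → Joined A B → suc width < ∣ A ∣ → ¬ suc width < ∣ B ∣
    no-biclique {A} {B} joined A> B>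
      with maximum (_∈ A) (_∈? A) (depth ∘ node ∘ top) (nonempty-of-size A A>)
         | maximum (_∈ B) (_∈? B) (depth ∘ node ∘ top) (nonempty-of-size B B>)
    ... | a , a∈A , a≥ | b , b∈B , b≥ with ≤-total (depth (node (top a))) (depth (node (top b)))
    ...   | inj₁ a≤b = <⇒≱ A> (≤-trans (p⊆q⇒∣p∣≤∣q∣ λ {x} x∈A →
      top-contains x b (joined x b x∈A b∈B) (≤-trans (a≥ x x∈A) a≤b)) (bag≤ (node (top b))))
    ...   | inj₂ b≤a = <⇒≱ B> (≤-trans (p⊆q⇒∣p∣≤∣q∣ λ {x} x∈B →
      top-contains x a (subst T (Graph.symmetric G a x) (joined a x a∈A x∈B)) (≤-trans (b≥ x x∈B) b≤a)) (bag≤ (node (top a))))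

-- Finite sets and single-token moves

module TokenReplacement where

  open import Data.Bool.Base using (Bool; true; false; not; T; _∧_)
  open import Data.Bool.Properties using (T?; T-≡)
  open import Data.Fin.Base using (Fin; zero; suc)
  open import Data.Fin.Properties as Finₚ using ()
  open import Data.Fin.Subset using (Subset; _∈_; _∉_; ∣_∣; _⊆_; _∩_)
  open import Data.Fin.Subset.Properties using (_∈?_; p⊆q⇒∣p∣≤∣q∣; x∈p∩q⁺; nonempty?; Empty-unique; ∣⊥∣≡0)
  open import Data.List.Base as List using (List; []; _∷_; length)
  open import Data.List.Membership.Propositional as L using ()
  open import Data.List.Membership.Propositional.Properties using (∈-map⁺; ∈-map⁻)
  open import Data.List.Properties using (length-map)
  open import Data.List.Relation.Unary.Any using (here; there)
  open import Data.Nat.Base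
  open import Data.Nat.Properties
  open import Data.Nat.Tactic.RingSolver using (solve-∀)
  open import Data.Product.Base using (∃-syntax; _×_; _,_; proj₁; proj₂)
  open import Data.Sum.Base using (_⊎_; inj₁; inj₂)
  open import Data.Vec.Base using ([]; _∷_; lookup; _[_]≔_; tabulate; here; there)
  open import Data.Vec.Properties
  open import Function.Base using (_∘_)
  open import Function.Bundles using (Equivalence)
  open import Relation.Binary.Construct.Closure.ReflexiveTransitive as Star using (Star; ε; _◅_; _◅◅_)
  open import Relation.Binary.PropositionalEquality
  open import Relation.Nullary.Decidable using (yes; no)
  open import Relation.Nullary.Negation using (¬_; contradiction)

  private variable n : ℕ

  infixl 6 _+ₛ_ _-ₛ_

  _+ₛ_ _-ₛ_ : Subset n → Fin n → Subset n
  A +ₛ x = A [ x ]≔ true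
  A -ₛ x = A [ x ]≔ false

  ∈-add : ∀ (A : Subset n) x → x ∈ A +ₛ x
  ∈-add A x = []≔-updates A x

  ∈-add⁺ : ∀ {A : Subset n} {u} x → u ∈ A → u ∈ A +ₛ x
  ∈-add⁺ {A = A} {u} x u∈A with u Finₚ.≟ x
  ... | yes refl = ∈-add A u
  ... | no u≢x   = []≔-minimal A u x u≢x u∈A

  ∈-add⁻ : ∀ {A : Subset n} {u x} → u ∈ A +ₛ x → u ≡ x ⊎ u ∈ A
  ∈-add⁻ {A = A} {u} {x} u∈ with u Finₚ.≟ x
  ... | yes refl = inj₁ refl
  ... | no u≢x   = inj₂ (lookup⇒[]= u A (trans (sym (lookup∘update′ u≢x A true)) ([]=⇒lookup u∈)))

  ∉-remove : ∀ (A : Subset n) x → x ∉ A -ₛ x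
  ∉-remove A x x∈ with trans (sym (lookup∘update x A false)) ([]=⇒lookup x∈)
  ... | ()

  ∈-remove⁻ : ∀ {A : Subset n} {u x} → u ∈ A -ₛ x → u ≢ x × u ∈ A
  ∈-remove⁻ {A = A} {u} {x} u∈ with u Finₚ.≟ x
  ... | yes refl = contradiction u∈ (∉-remove A u)
  ... | no u≢x   = u≢x , lookup⇒[]= u A (trans (sym (lookup∘update′ u≢x A false)) ([]=⇒lookup u∈))

  ∉⇒lookup : ∀ {A : Subset n} {x} → x ∉ A → lookup A x ≡ false
  ∉⇒lookup {A = A} {x} x∉A with lookup A x in eq
  ... | false = refl
  ... | true  = contradiction (lookup⇒[]= x A eq) x∉A

  remove-add : ∀ {A : Subset n} {x} → x ∈ A → A -ₛ x +ₛ x ≡ A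
  remove-add {A = A} {x} x∈A = trans ([]≔-idempotent A x)
    (trans (cong (A [ x ]≔_) (sym ([]=⇒lookup x∈A))) ([]≔-lookup A x))

  add-remove : ∀ {A : Subset n} {x} → x ∉ A → A +ₛ x -ₛ x ≡ A
  add-remove {A = A} {x} x∉A = trans ([]≔-idempotent A x)
    (trans (cong (A [ x ]≔_) (sym (∉⇒lookup x∉A))) ([]≔-lookup A x))

  ∣add∣ : ∀ {A : Subset n} {x} → x ∉ A → ∣ A +ₛ x ∣ ≡ suc ∣ A ∣
  ∣add∣ {A = true  ∷ A} {zero}  x∉A = contradiction here x∉A
  ∣add∣ {A = false ∷ A} {zero}  x∉A = refl
  ∣add∣ {A = true  ∷ A} {suc x} x∉A = cong suc (∣add∣ (x∉A ∘ there))
  ∣add∣ {A = false ∷ A} {suc x} x∉A = ∣add∣ (x∉A ∘ there)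

  ∣add∣≤ : ∀ (A : Subset n) x → ∣ A +ₛ x ∣ ≤ suc ∣ A ∣
  ∣add∣≤ A x with x ∈? A
  ... | no x∉A = ≤-reflexive (∣add∣ x∉A)
  ... | yes x∈A = ≤-trans (p⊆q⇒∣p∣≤∣q∣ λ u∈ → back (∈-add⁻ u∈)) (n≤1+n _)
    where
    back : ∀ {u} → u ≡ x ⊎ u ∈ A → u ∈ A
    back (inj₁ refl) = x∈A
    back (inj₂ u∈A)  = u∈A

  ∣remove∣ : ∀ {A : Subset n} {x} → x ∈ A → ∣ A ∣ ≡ suc ∣ A -ₛ x ∣
  ∣remove∣ {A = A} {x} x∈A = trans (cong ∣_∣ (sym (remove-add x∈A))) (∣add∣ (∉-remove A x))

  cover : ∀ (p q r : Subset n) → (∀ x → x ∈ p → x ∈ q ⊎ x ∈ r) → ∣ p ∣ ≤ ∣ q ∣ + ∣ r ∣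
  cover p q r h with drop h
    where
    strip : ∀ {n a b} {q r : Subset n} {x} → suc x ∈ (a ∷ q) ⊎ suc x ∈ (b ∷ r) → x ∈ q ⊎ x ∈ r
    strip (inj₁ (there u)) = inj₁ u
    strip (inj₂ (there u)) = inj₂ u
    drop : ∀ {n} {p q r : Subset n} → (∀ x → x ∈ p → x ∈ q ⊎ x ∈ r) → ∣ p ∣ ≤ ∣ q ∣ + ∣ r ∣
    drop {p = []} {[]} {[]} h = z≤n
    drop {p = false ∷ p} {b ∷ q} {c ∷ r} h =
      ≤-trans (drop (λ x x∈ → strip (h (suc x) (there x∈)))) (+-mono-≤ (grow b q) (grow c r))
      where
      grow : ∀ b (q : Subset _) → ∣ q ∣ ≤ ∣ b ∷ q ∣
      grow true  q = n≤1+n _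
      grow false q = ≤-refl
    drop {p = true ∷ p} {true ∷ q} {c ∷ r} h =
      s≤s (≤-trans (drop (λ x x∈ → strip (h (suc x) (there x∈)))) (+-monoʳ-≤ ∣ q ∣ (grow c r)))
      where
      grow : ∀ b (q : Subset _) → ∣ q ∣ ≤ ∣ b ∷ q ∣
      grow true  q = n≤1+n _
      grow false q = ≤-refl
    drop {p = true ∷ p} {false ∷ q} {true ∷ r} h =
      ≤-trans (s≤s (drop (λ x x∈ → strip (h (suc x) (there x∈))))) (≤-reflexive (sym (+-suc _ _)))
    drop {p = true ∷ p} {false ∷ q} {false ∷ r} h with h zero here
    ... | inj₁ ()
    ... | inj₂ ()
  ... | le = le

  elements : Subset n → List (Fin n)
  elements []          = []
  elements (true  ∷ p) = zero ∷ List.map suc (elements p)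
  elements (false ∷ p) = List.map suc (elements p)

  length-elements : ∀ (p : Subset n) → length (elements p) ≡ ∣ p ∣
  length-elements []          = refl
  length-elements (true  ∷ p) = cong suc (trans (length-map suc (elements p)) (length-elements p))
  length-elements (false ∷ p) = trans (length-map suc (elements p)) (length-elements p)

  ∈-elements⁺ : ∀ {p : Subset n} {x} → x ∈ p → x L.∈ elements p
  ∈-elements⁺ here = here refl
  ∈-elements⁺ {p = true  ∷ p} (there x∈) = there (∈-map⁺ suc (∈-elements⁺ x∈))
  ∈-elements⁺ {p = false ∷ p} (there x∈) = ∈-map⁺ suc (∈-elements⁺ x∈)

  ∈-elements⁻ : ∀ {p : Subset n} {x} → x L.∈ elements p → x ∈ p
  ∈-elements⁻ {p = true  ∷ p} (here refl) = here
  ∈-elements⁻ {p = true  ∷ p} (there x∈) with ∈-map⁻ suc x∈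
  ... | y , y∈ , refl = there (∈-elements⁻ y∈)
  ∈-elements⁻ {p = false ∷ p} x∈ with ∈-map⁻ suc x∈
  ... | y , y∈ , refl = there (∈-elements⁻ y∈)

  ∣△∣≡0 : ∀ (A B : Subset n) → ∣ A △ B ∣ ≡ 0 → A ≡ B
  ∣△∣≡0 []          []          _ = refl
  ∣△∣≡0 (true ∷ A)  (true ∷ B)  e = cong (true ∷_) (∣△∣≡0 A B e)
  ∣△∣≡0 (false ∷ A) (false ∷ B) e = cong (false ∷_) (∣△∣≡0 A B e)

  ∣△∣-self : ∀ (A : Subset n) → ∣ A △ A ∣ ≡ 0
  ∣△∣-self []          = refl
  ∣△∣-self (true ∷ A)  = ∣△∣-self A
  ∣△∣-self (false ∷ A) = ∣△∣-self A

  △-comm : ∀ (A B : Subset n) → A △ B ≡ B △ A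
  △-comm []          []          = refl
  △-comm (true ∷ A)  (true ∷ B)  = cong (false ∷_) (△-comm A B)
  △-comm (true ∷ A)  (false ∷ B) = cong (true ∷_) (△-comm A B)
  △-comm (false ∷ A) (true ∷ B)  = cong (true ∷_) (△-comm A B)
  △-comm (false ∷ A) (false ∷ B) = cong (false ∷_) (△-comm A B)

  ∣△∣-add : ∀ {A : Subset n} {x} → x ∉ A → ∣ A △ (A +ₛ x) ∣ ≡ 1
  ∣△∣-add {A = true  ∷ A} {zero}  x∉ = contradiction here x∉
  ∣△∣-add {A = false ∷ A} {zero}  x∉ = cong suc (∣△∣-self A)
  ∣△∣-add {A = true  ∷ A} {suc x} x∉ = ∣△∣-add (x∉ ∘ there)
  ∣△∣-add {A = false ∷ A} {suc x} x∉ = ∣△∣-add (x∉ ∘ there)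

  -- Turns a move of the reconfiguration graph into the addition or the removal of one token.
  ∣△∣≡1 : ∀ (A B : Subset n) → ∣ A △ B ∣ ≡ 1 →
    (∃[ x ] (x ∉ A × B ≡ A +ₛ x)) ⊎ (∃[ x ] (x ∉ B × A ≡ B +ₛ x))
  ∣△∣≡1 []          []          ()
  ∣△∣≡1 (true ∷ A)  (false ∷ B) e = inj₂ (zero , (λ ()) , cong (true ∷_) (∣△∣≡0 A B (suc-injective e)))
  ∣△∣≡1 (false ∷ A) (true ∷ B)  e = inj₁ (zero , (λ ()) , cong (true ∷_) (sym (∣△∣≡0 A B (suc-injective e))))
  ∣△∣≡1 (true ∷ A)  (true ∷ B)  e with ∣△∣≡1 A B e
  ... | inj₁ (x , x∉ , eq) = inj₁ (suc x , (λ { (there p) → x∉ p }) , cong (true ∷_) eq)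
  ... | inj₂ (x , x∉ , eq) = inj₂ (suc x , (λ { (there p) → x∉ p }) , cong (true ∷_) eq)
  ∣△∣≡1 (false ∷ A) (false ∷ B) e with ∣△∣≡1 A B e
  ... | inj₁ (x , x∉ , eq) = inj₁ (suc x , (λ { (there p) → x∉ p }) , cong (false ∷_) eq)
  ... | inj₂ (x , x∉ , eq) = inj₂ (suc x , (λ { (there p) → x∉ p }) , cong (false ∷_) eq)

  -- Replacing tokens within a sparse set

  module Kernel (G : Graph) (k : ℕ) (0<k : 0 < k) where

    open Graph G using (order; adj; symmetric; irreflexive; Vertex; Adjacent)
    open ReconfigurationGraph G k

    Set′ : Set
    Set′ = Subset order

    N : Vertex → Set′
    N x = tabulate (adj x)

    adj-sym : ∀ {u v} → Adjacent u v → Adjacent v u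
    adj-sym {u} {v} = subst T (symmetric u v)

    ∈N⁺ : ∀ {x u} → Adjacent x u → u ∈ N x
    ∈N⁺ {x} {u} a = lookup⇒[]= u (N x) (trans (lookup∘tabulate (adj x) u) (Equivalence.to T-≡ a))

    ∈N⁻ : ∀ {x u} → u ∈ N x → Adjacent x u
    ∈N⁻ {x} {u} u∈ = Equivalence.from T-≡ (trans (sym (lookup∘tabulate (adj x) u)) ([]=⇒lookup u∈))

    loopless : ∀ {u} → ¬ Adjacent u u
    loopless {u} = subst T (irreflexive u)

    -- Deleted vertices are collected in a set `D` and the graph stays the same, so the sets before
    -- and after a deletion are subsets of one vertex set.
    Live : Set′ → Set′ → Set
    Live D A = ∀ u → u ∈ A → u ∉ D

    Step : Set′ → Set′ → Set′ → Set
    Step D A B = A ~ B × Live D A × Live D B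

    step-sym : ∀ {D A B} → Step D A B → Step D B A
    step-sym {D} {A} {B} ((a , b , e) , p , q) = (b , a , trans (cong ∣_∣ (△-comm B A)) e) , q , p

    independent-⊆ : ∀ {A B} → A ⊆ B → Independent G B → Independent G A
    independent-⊆ A⊆B ind u v u∈ v∈ = ind u v (A⊆B u∈) (A⊆B v∈)

    independent-add : ∀ {A x} → Independent G A → (∀ a → a ∈ A → ¬ Adjacent a x) → Independent G (A +ₛ x)
    independent-add {A} {x} ind free u v u∈ v∈ uv with ∈-add⁻ {A = A} u∈ | ∈-add⁻ {A = A} v∈
    ... | inj₁ refl | inj₁ refl = loopless uv
    ... | inj₁ refl | inj₂ v∈A  = free v v∈A (adj-sym uv)
    ... | inj₂ u∈A  | inj₁ refl = free u u∈A uv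
    ... | inj₂ u∈A  | inj₂ v∈A  = ind u v u∈A v∈A uv

    1+[k∸1] : suc (k ∸ 1) ≡ k
    1+[k∸1] = m+[n∸m]≡n 0<k

    step-add : ∀ {D A x} → x ∉ A → ∣ A ∣ ≡ k ∸ 1 → Independent G (A +ₛ x) → Live D (A +ₛ x) → Step D A (A +ₛ x)
    step-add {D} {A} {x} x∉A size ind live =
      ( (independent-⊆ (∈-add⁺ x) ind , inj₁ size)
      , (ind , inj₂ (trans (∣add∣ x∉A) (trans (cong suc size) 1+[k∸1])))
      , ∣△∣-add x∉A) , (λ u u∈ → live u (∈-add⁺ x u∈)) , live

    add-size : ∀ {A x} → x ∉ A → IsNode A → IsNode (A +ₛ x) → ∣ A ∣ ≡ k ∸ 1
    add-size x∉A (_ , inj₁ e) _ = e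
    add-size x∉A (_ , inj₂ e) (_ , inj₁ e′) = contradiction
      (trans (sym (trans (∣add∣ x∉A) (cong suc e))) e′) (λ eq → m≢1+n+m (k ∸ 1) {1} (trans (sym eq) (cong suc (sym 1+[k∸1]))))
    add-size x∉A (_ , inj₂ e) (_ , inj₂ e′) = contradiction (trans (sym e′) (trans (∣add∣ x∉A) (cong suc e))) (m≢1+m+n k ∘ λ eq → trans eq (cong suc (sym (+-identityʳ k))))

    -- Vertices adjacent to all of `W` are exempt. This does no harm, since an independent set with
    -- a token on `W` contains no such vertex.
    Sparse : Set′ → Set
    Sparse W = ∀ x u → u ∈ W → ¬ Adjacent x u → (2 + k) * ∣ W ∩ N x ∣ < ∣ W ∣

    -- Each killer rules out fewer than |W|/(k+2) + 1 vertices of W.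
    survivors : ∀ {W} → Sparse W → (xs : List Vertex) → (∀ x → x L.∈ xs → ∃[ u ] (u ∈ W × ¬ Adjacent x u)) →
      ∃[ W′ ] ((∀ u → u ∈ W′ → u ∈ W × (∀ x → x L.∈ xs → u ≢ x × ¬ Adjacent x u)) ×
               (2 + k) * ∣ W ∣ ≤ (2 + k) * ∣ W′ ∣ + length xs * (∣ W ∣ + (1 + k)))
    survivors {W} sp [] h = W , (λ u u∈ → u∈ , λ _ ()) , m≤m+n _ _
    survivors {W} sp (x ∷ xs) h with survivors sp xs (λ y y∈ → h y (there y∈)) | h x (here refl)
    ... | W₁ , sound , bound | u₀ , u₀∈W , x≁u₀ = W₂ , sound₂ , bound₂
      where
      keep : Vertex → Bool
      keep u = lookup W₁ u ∧ not (adj x u)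
      W₂ : Set′
      -- A survivor must also differ from `x`. This loses at most one more vertex, which after
      -- multiplication by `2 + k` accounts for the strict inequality in `Sparse` and for the
      -- summand `1 + k`.
      W₂ = (tabulate keep) -ₛ x
      keep⁻ : ∀ {u} → keep u ≡ true → u ∈ W₁ × ¬ Adjacent x u
      keep⁻ {u} eq with lookup W₁ u in e₁ | adj x u in e₂
      ... | true | false = lookup⇒[]= u W₁ e₁ , λ ()
      sound₂ : ∀ u → u ∈ W₂ → u ∈ W × (∀ y → y L.∈ x ∷ xs → u ≢ y × ¬ Adjacent y u)
      sound₂ u u∈ with ∈-remove⁻ {A = tabulate keep} u∈
      ... | u≢x , u∈t with keep⁻ (trans (sym (lookup∘tabulate keep u)) ([]=⇒lookup u∈t))
      ...   | u∈W₁ , x≁u = proj₁ (sound u u∈W₁) , λ where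
        y (here refl) → u≢x , x≁u
        y (there y∈)  → proj₂ (sound u u∈W₁) y y∈
      split : ∀ u → u ∈ W₁ → u ∈ W₂ +ₛ x ⊎ u ∈ W ∩ N x
      split u u∈ with u Finₚ.≟ x | T? (adj x u)
      ... | yes refl | _ = inj₁ (∈-add W₂ u)
      ... | no _ | yes a = inj₂ (x∈p∩q⁺ (proj₁ (sound u u∈) , ∈N⁺ a))
      ... | no u≢x | no na = inj₁ (∈-add⁺ x ([]≔-minimal (tabulate keep) u x u≢x
        (lookup⇒[]= u (tabulate keep) (trans (lookup∘tabulate keep u) (kept ([]=⇒lookup u∈))))))
        where
        kept : lookup W₁ u ≡ true → keep u ≡ true
        kept e rewrite e with adj x u
        ... | true  = contradiction _ na
        ... | false = refl
      bound₂ : (2 + k) * ∣ W ∣ ≤ (2 + k) * ∣ W₂ ∣ + suc (length xs) * (∣ W ∣ + (1 + k))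
      bound₂ = begin
        (2 + k) * ∣ W ∣
          ≤⟨ bound ⟩
        (2 + k) * ∣ W₁ ∣ + rest
          ≤⟨ +-monoˡ-≤ rest (*-monoʳ-≤ (2 + k) (≤-trans (cover W₁ (W₂ +ₛ x) (W ∩ N x) split) (+-monoˡ-≤ ∣ W ∩ N x ∣ (∣add∣≤ W₂ x)))) ⟩
        (2 + k) * (suc ∣ W₂ ∣ + ∣ W ∩ N x ∣) + rest
          ≡⟨ regroup k ∣ W₂ ∣ ∣ W ∩ N x ∣ rest ⟩
        (2 + k) * ∣ W₂ ∣ + ((suc ((2 + k) * ∣ W ∩ N x ∣) + (1 + k)) + rest)
          ≤⟨ +-monoʳ-≤ ((2 + k) * ∣ W₂ ∣) (+-monoˡ-≤ rest (+-monoˡ-≤ (1 + k) (sp x u₀ u₀∈W x≁u₀))) ⟩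
        (2 + k) * ∣ W₂ ∣ + ((∣ W ∣ + (1 + k)) + rest) ∎
        where
        open ≤-Reasoning
        rest = length xs * (∣ W ∣ + (1 + k))
        regroup : ∀ k a b r → (2 + k) * (suc a + b) + r ≡ (2 + k) * a + ((suc ((2 + k) * b) + (1 + k)) + r)
        regroup = solve-∀

    -- Without a survivor, (k + 2) |W| would be at most (k + 1) (|W| + k + 1), that is, |W| at most
    -- (k + 1)².
    survivor : ∀ {W} → Sparse W → (1 + k) * (1 + k) < ∣ W ∣ → (X : Set′) → ∣ X ∣ ≤ 1 + k →
      (∀ x → x ∈ X → ∃[ u ] (u ∈ W × ¬ Adjacent x u)) →
      ∃[ w ] (w ∈ W × w ∉ X × (∀ x → x ∈ X → ¬ Adjacent x w))
    survivor {W} sp big X X≤ h with survivors sp (elements X) (λ x x∈ → h x (∈-elements⁻ x∈))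
    ... | W′ , sound , bound with nonempty? W′
    ...   | yes (w , w∈) = w , proj₁ (sound w w∈)
                         , (λ w∈X → proj₁ (proj₂ (sound w w∈) w (∈-elements⁺ w∈X)) refl)
                         , (λ x x∈X → proj₂ (proj₂ (sound w w∈) x (∈-elements⁺ x∈X)))
    ...   | no em = contradiction bound (<⇒≱ (begin-strict
      (2 + k) * ∣ W′ ∣ + length (elements X) * (∣ W ∣ + (1 + k))
        ≡⟨ cong₂ (λ a b → (2 + k) * a + b * (∣ W ∣ + (1 + k)))
                 (trans (cong ∣_∣ (Empty-unique em)) (∣⊥∣≡0 order)) (length-elements X) ⟩
      (2 + k) * 0 + ∣ X ∣ * (∣ W ∣ + (1 + k))
        ≤⟨ +-mono-≤ (≤-reflexive (*-zeroʳ (2 + k))) (*-monoˡ-≤ (∣ W ∣ + (1 + k)) X≤) ⟩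
      (1 + k) * (∣ W ∣ + (1 + k))
        ≡⟨ *-distribˡ-+ (1 + k) ∣ W ∣ (1 + k) ⟩
      (1 + k) * ∣ W ∣ + (1 + k) * (1 + k)
        <⟨ +-monoʳ-< ((1 + k) * ∣ W ∣) big ⟩
      (1 + k) * ∣ W ∣ + ∣ W ∣
        ≡⟨ +-comm _ ∣ W ∣ ⟩
      (2 + k) * ∣ W ∣ ∎))
      where open ≤-Reasoning

    module Deletion {D W : Set′} (sparse : Sparse W) (big : (1 + k) * (1 + k) < ∣ W ∣)
                    (W-live : ∀ w → w ∈ W → w ∉ D) {v : Vertex} (v∈W : v ∈ W) where

      D′ : Set′
      D′ = D +ₛ v

      ∉D′ : ∀ {u} → u ∉ D → u ≢ v → u ∉ D′
      ∉D′ u∉D u≢v u∈ with ∈-add⁻ {A = D} u∈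
      ... | inj₁ u≡v = u≢v u≡v
      ... | inj₂ u∈D = u∉D u∈D

      record Good (A : Set′) (w : Vertex) : Set where
        field
          w∈W  : w ∈ W
          w∉A  : w ∉ A
          free : ∀ a → a ∈ A → ¬ Adjacent a w

      open Good

      -- The vertices to be avoided are those of `A` and `w₀`, at most `k + 1` in all. Each has a
      -- non-neighbour in `W`: `v` for the members of the independent set `A`, and `w₀` for itself.
      good : ∀ {A} w₀ → w₀ ∈ W → v ∈ A → IsNode A → ∃[ w ] (Good A w × w ≢ w₀ × ¬ Adjacent w₀ w)
      good {A} w₀ w₀∈W v∈A (ind , size) with survivor sparse big (A +ₛ w₀)
        (≤-trans (∣add∣≤ A w₀) (s≤s (size≤ size))) witness
        where
        size≤ : ∣ A ∣ ≡ k ∸ 1 ⊎ ∣ A ∣ ≡ k → ∣ A ∣ ≤ k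
        size≤ (inj₁ e) = ≤-trans (≤-reflexive e) (m∸n≤m k 1)
        size≤ (inj₂ e) = ≤-reflexive e
        witness : ∀ x → x ∈ A +ₛ w₀ → ∃[ u ] (u ∈ W × ¬ Adjacent x u)
        witness x x∈ with ∈-add⁻ {A = A} x∈
        ... | inj₁ refl = x , w₀∈W , loopless
        ... | inj₂ x∈A  = v , v∈W , ind x v x∈A v∈A
      ... | w , w∈W , w∉X , free = w
        , record { w∈W = w∈W ; w∉A = w∉X ∘ ∈-add⁺ w₀ ; free = λ a a∈A → free a (∈-add⁺ w₀ a∈A) }
        , (λ { refl → w∉X (∈-add A w) }) , free w₀ (∈-add A w₀)

      swap : Set′ → Vertex → Set′
      swap A w = A -ₛ v +ₛ w

      good-⊆ : ∀ {A B w} → A ⊆ B → Good B w → Good A w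
      good-⊆ A⊆B g = record { w∈W = w∈W g ; w∉A = w∉A g ∘ A⊆B ; free = λ a a∈A → free g a (A⊆B a∈A) }

      ∉swap : ∀ {A w u} → u ∉ A → u ≢ w → u ∉ swap A w
      ∉swap {A} u∉A u≢w u∈ with ∈-add⁻ {A = A -ₛ v} u∈
      ... | inj₁ u≡w = u≢w u≡w
      ... | inj₂ u∈A = u∉A (proj₂ (∈-remove⁻ {A = A} u∈A))

      w≢v : ∀ {A w} → v ∈ A → Good A w → w ≢ v
      w≢v v∈A g refl = w∉A g v∈A

      swap-independent : ∀ {A w} → Independent G A → Good A w → Independent G (swap A w)
      swap-independent {A} ind g = independent-add (independent-⊆ (proj₂ ∘ ∈-remove⁻ {A = A}) ind)
        (λ a a∈ → free g a (proj₂ (∈-remove⁻ {A = A} a∈)))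

      swap-size : ∀ {A w} → v ∈ A → Good A w → ∣ swap A w ∣ ≡ ∣ A ∣
      swap-size {A} v∈A g = trans (∣add∣ (w∉A g ∘ proj₂ ∘ ∈-remove⁻ {A = A})) (sym (∣remove∣ v∈A))

      swap-live : ∀ {A w} → v ∈ A → Live D A → Good A w → Live D′ (swap A w)
      swap-live {A} v∈A live g u u∈ with ∈-add⁻ {A = A -ₛ v} u∈
      ... | inj₁ refl = ∉D′ (W-live _ (w∈W g)) (w≢v v∈A g)
      ... | inj₂ u∈A  = let u≢v , u∈A′ = ∈-remove⁻ {A = A} u∈A in ∉D′ (live u u∈A′) u≢v

      live-without : ∀ {A} → v ∉ A → Live D A → Live D′ A
      live-without v∉A live u u∈A = ∉D′ (live u u∈A) λ { refl → v∉A u∈A }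

      -- A path is followed with the token on v parked on some w ∈ W; before a token is added
      -- elsewhere, w is exchanged for a w′ that is compatible with it.
      Mirrors : Set′ → Set′ → Set
      Mirrors A A′ = (v ∉ A × A′ ≡ A) ⊎ (v ∈ A × ∃[ w ] (Good A w × A′ ≡ swap A w))

      swap-add : ∀ {A x w} → x ≢ v → x ≢ w → swap (A +ₛ x) w ≡ swap A w +ₛ x
      swap-add {A} {x} {w} x≢v x≢w = trans (cong (_+ₛ w) ([]≔-commutes A x v x≢v)) ([]≔-commutes (A -ₛ v) x w x≢w)

      -- If `v` carries a token, three moves imitate the addition of `x`: add `w′`, remove `w`, add
      -- `x`. The copy has k - 1 tokens at first, so the size never exceeds k; `w′` is chosen for
      -- `A +ₛ x`, hence compatible with `x`, and not adjacent to `w`.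
      simulate-add : ∀ {A A′ x} → x ∉ A → Step D A (A +ₛ x) → Mirrors A A′ →
        ∃[ B′ ] (Mirrors (A +ₛ x) B′ × Star (Step D′) A′ B′)
      simulate-add {A} {x = x} x∉A ((nA , nB , e) , liveA , liveB) (inj₁ (v∉A , refl)) with x Finₚ.≟ v
      ... | no x≢v = A +ₛ x , inj₁ (v∉B , refl) , ((nA , nB , e) , live-without v∉A liveA , live-without v∉B liveB) ◅ ε
        where
        v∉B : v ∉ A +ₛ x
        v∉B v∈ with ∈-add⁻ {A = A} v∈
        ... | inj₁ v≡x = x≢v (sym v≡x)
        ... | inj₂ v∈A = v∉A v∈A
      -- No substitute is in use yet, so `v` itself takes the place of the vertex to be exchanged.
      ... | yes refl with good v v∈W (∈-add A v) nB
      ...   | w , g , _ = swap (A +ₛ v) w , inj₂ (∈-add A v , w , g , refl) ,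
        subst (Step D′ A) (cong (_+ₛ w) (sym (add-remove v∉A)))
          (step-add (w∉A g ∘ ∈-add⁺ v) (add-size v∉A nA nB)
            (subst (Independent G) A+w (swap-independent (proj₁ nB) g))
            (subst (Live D′) A+w (swap-live (∈-add A v) liveB g))) ◅ ε
        where
        A+w : swap (A +ₛ v) w ≡ A +ₛ w
        A+w = cong (_+ₛ w) (add-remove v∉A)
      simulate-add {A} {x = x} x∉A ((nA , nB , e) , liveA , liveB) (inj₂ (v∈A , w , g , refl))
        with good w (w∈W g) (∈-add⁺ x v∈A) nB
      ... | w′ , g′ , w′≢w , w≁w′ = swap (A +ₛ x) w′ , inj₂ (∈-add⁺ x v∈A , w′ , g′ , refl) ,
        step-add w′∉ sizeA (proj₁ both) (proj₂ both) ◅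
        subst (λ B → Step D′ B (swap A w′)) exchange (step-sym (step-add w∉ sizeA′
          (subst (Independent G) (sym exchange) (proj₁ both)) (subst (Live D′) (sym exchange) (proj₂ both)))) ◅
        subst (Step D′ (swap A w′)) (sym moved) (step-add (∉swap x∉A x≢w′) sizeA′
          (subst (Independent G) moved (swap-independent (proj₁ nB) g′))
          (subst (Live D′) moved (swap-live (∈-add⁺ x v∈A) liveB g′))) ◅ ε
        where
        g″ : Good A w′
        g″ = good-⊆ (∈-add⁺ x) g′
        x≢w′ : x ≢ w′
        x≢w′ refl = w∉A g′ (∈-add A x)
        sizeA : ∣ swap A w ∣ ≡ k ∸ 1
        sizeA = trans (swap-size v∈A g) (add-size x∉A nA nB)
        sizeA′ : ∣ swap A w′ ∣ ≡ k ∸ 1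
        sizeA′ = trans (swap-size v∈A g″) (add-size x∉A nA nB)
        w′∉ : w′ ∉ swap A w
        w′∉ = ∉swap (w∉A g″) w′≢w
        w∉ : w ∉ swap A w′
        w∉ = ∉swap (w∉A g) (w′≢w ∘ sym)
        exchange : swap A w′ +ₛ w ≡ swap A w +ₛ w′
        exchange = []≔-commutes (A -ₛ v) w′ w w′≢w
        moved : swap (A +ₛ x) w′ ≡ swap A w′ +ₛ x
        moved = swap-add {A} (λ { refl → x∉A v∈A }) x≢w′
        both : Independent G (swap A w +ₛ w′) × Live D′ (swap A w +ₛ w′)
        both = independent-add (swap-independent (proj₁ nA) g) free′ , live′
          where
          free′ : ∀ a → a ∈ swap A w → ¬ Adjacent a w′
          free′ a a∈ with ∈-add⁻ {A = A -ₛ v} a∈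
          ... | inj₁ refl = w≁w′
          ... | inj₂ a∈A  = free g″ a (proj₂ (∈-remove⁻ {A = A} a∈A))
          live′ : Live D′ (swap A w +ₛ w′)
          live′ u u∈ with ∈-add⁻ {A = swap A w} u∈
          ... | inj₁ refl = ∉D′ (W-live u (w∈W g′)) (w≢v v∈A g″)
          ... | inj₂ u∈A  = swap-live v∈A liveA g u u∈A

      -- No exchange occurs here, since a substitute stays compatible with a smaller set.
      simulate-remove : ∀ {B A′ x} → x ∉ B → Step D (B +ₛ x) B → Mirrors (B +ₛ x) A′ →
        ∃[ B′ ] (Mirrors B B′ × Star (Step D′) A′ B′)
      simulate-remove {B} {x = x} x∉B (st , liveA , liveB) (inj₁ (v∉A , refl)) =
        B , inj₁ (v∉B , refl) , (st , live-without v∉A liveA , live-without v∉B liveB) ◅ ε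
        where
        v∉B : v ∉ B
        v∉B = v∉A ∘ ∈-add⁺ x
      simulate-remove {B} {x = x} x∉B ((nA , nB , e) , liveA , liveB) (inj₂ (v∈A , w , g , refl)) with x Finₚ.≟ v
      ... | yes refl = B , inj₁ (x∉B , refl) ,
        subst (λ A → Step D′ A B) (sym B+w) (step-sym (step-add (w∉A g ∘ ∈-add⁺ v) (add-size x∉B nB nA)
          (subst (Independent G) B+w (swap-independent (proj₁ nA) g))
          (subst (Live D′) B+w (swap-live v∈A liveA g)))) ◅ ε
        where
        B+w : swap (B +ₛ v) w ≡ B +ₛ w
        B+w = cong (_+ₛ w) (add-remove x∉B)
      ... | no x≢v = swap B w , inj₂ (v∈B , w , g′ , refl) ,
        subst (λ A → Step D′ A (swap B w)) (sym moved) (step-sym (step-add (∉swap x∉B x≢w)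
          (trans (swap-size v∈B g′) (add-size x∉B nB nA))
          (subst (Independent G) moved (swap-independent (proj₁ nA) g))
          (subst (Live D′) moved (swap-live v∈A liveA g)))) ◅ ε
        where
        v∈B : v ∈ B
        v∈B with ∈-add⁻ {A = B} v∈A
        ... | inj₁ v≡x = contradiction (sym v≡x) x≢v
        ... | inj₂ v∈B = v∈B
        g′ : Good B w
        g′ = good-⊆ (∈-add⁺ x) g
        x≢w : x ≢ w
        x≢w refl = w∉A g (∈-add B x)
        moved : swap (B +ₛ x) w ≡ swap B w +ₛ x
        moved = swap-add {B} x≢v x≢w

      simulate : ∀ {A A′ B} → Step D A B → Mirrors A A′ → ∃[ B′ ] (Mirrors B B′ × Star (Step D′) A′ B′)
      simulate {A} {A′} {B} st@((_ , _ , e) , _) m with ∣△∣≡1 A B e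
      ... | inj₁ (x , x∉A , refl) = simulate-add x∉A st m
      ... | inj₂ (x , x∉B , refl) = simulate-remove x∉B st m

      mirror-path : ∀ {A A′ B} → Star (Step D) A B → Mirrors A A′ → ∃[ B′ ] (Mirrors B B′ × Star (Step D′) A′ B′)
      mirror-path ε         m = _ , m , ε
      mirror-path (st ◅ ss) m with simulate st m
      ... | _ , m′ , path with mirror-path ss m′
      ...   | _ , m″ , path′ = _ , m″ , path ◅◅ path′

      -- A set without `v` is mirrored only by itself, so the imitated path has the same ends.
      deletion-safe : ∀ {A B} → v ∉ A → v ∉ B → Star (Step D) A B → Star (Step D′) A B
      deletion-safe v∉A v∉B path with mirror-path path (inj₁ (v∉A , refl))
      ... | _ , inj₁ (_ , refl) , path′ = path′
      ... | _ , inj₂ (v∈B , _)  , _     = contradiction v∈B v∉B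

-- Shrinking to common neighbourhoods

module Thinning where

  open TokenReplacement
  open import Data.Fin.Subset using (Subset; _∈_; _∉_; ∣_∣; _∩_; ⊥)
  open import Data.Fin.Subset.Properties using (p⊆q⇒∣p∣≤∣q∣; x∈p∩q⁺; x∈p∩q⁻; ∣⊥∣≡0; ∉⊥)
  open import Data.Nat.Base
  open import Data.Nat.Properties
  open import Data.Product.Base using (_×_; _,_; proj₁; proj₂)
  open import Data.Sum.Base using (_⊎_; inj₁; inj₂)
  open import Function.Base using (_∘_)
  open import Relation.Binary.PropositionalEquality
  open import Relation.Nullary.Decidable using (Dec; yes; no)
  open import Relation.Nullary.Negation using (¬_; contradiction)

  ∣p∩q∣<∣p∣ : ∀ {n} (p q : Subset n) {u} → u ∈ p → u ∉ q → ∣ p ∩ q ∣ < ∣ p ∣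
  ∣p∩q∣<∣p∣ p q {u} u∈p u∉q = ≤-trans (≤-reflexive (sym (∣add∣ {A = p ∩ q} (u∉q ∘ proj₂ ∘ x∈p∩q⁻ p q))))
    (p⊆q⇒∣p∣≤∣q∣ λ v∈ → inside (∈-add⁻ v∈))
    where
    inside : ∀ {v} → v ≡ u ⊎ v ∈ p ∩ q → v ∈ p
    inside (inj₁ refl) = u∈p
    inside (inj₂ v∈)   = proj₁ (x∈p∩q⁻ p q v∈)

  -- At most `1 + r` shrinkings count, each by a factor of at most `2 + k`. The set left over has at
  -- most `r` vertices, by the absence of bicliques, or at most (k + 1)², if it is too small for a
  -- deletion; the sum covers both cases.
  bound : ℕ → ℕ → ℕ
  bound r k = (2 + k) ^ (1 + r) * (r + (1 + k) * (1 + k))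

  module Shrinking (G : Graph) (k : ℕ) (0<k : 0 < k) (r : ℕ)
    (biclique-free : ∀ (A B : Subset (Graph.order G)) →
      (∀ a b → a ∈ A → b ∈ B → Graph.Adjacent G a b) → r < ∣ A ∣ → ¬ r < ∣ B ∣) where

    open Graph G using (order; Vertex; Adjacent)
    open Kernel G k 0<k

    Shrinkable : Set′ → Vertex → Set
    Shrinkable W x = ∣ W ∩ N x ∣ < ∣ W ∣ × ∣ W ∣ ≤ (2 + k) * ∣ W ∩ N x ∣

    Stable : Set′ → Set
    Stable W = ∀ x → ¬ Shrinkable W x

    stable⇒sparse : ∀ {W} → Stable W → Sparse W
    stable⇒sparse {W} st x u u∈W x≁u =
      ≰⇒> λ le → st x (∣p∩q∣<∣p∣ W (N x) u∈W (x≁u ∘ ∈N⁻) , le)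

    record Thinned (W₀ W : Set′) : Set where
      constructor thinned
      field
        core   : Set′
        joined : ∀ a b → a ∈ core → b ∈ W → Adjacent a b
        small  : ∣ core ∣ ≤ r
        ratio  : ∣ W₀ ∣ ≤ (2 + k) ^ ∣ core ∣ * ∣ W ∣

    -- The first alternative, once established for the initial set, persists while the program goes
    -- on shrinking. Until then `core` collects the vertices used so far.
    Thin : Set′ → Set′ → Set
    Thin W₀ W = ∣ W₀ ∣ ≤ bound r k ⊎ Thinned W₀ W

    thin-start : ∀ W₀ → Thin W₀ W₀
    thin-start W₀ = inj₂ (thinned ⊥ (λ a b a∈ → contradiction a∈ ∉⊥) (≤-trans (≤-reflexive (∣⊥∣≡0 order)) z≤n)
      (≤-reflexive (sym (trans (cong (λ c → (2 + k) ^ c * ∣ W₀ ∣) (∣⊥∣≡0 order)) (*-identityˡ _)))))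

    power≤ : ∀ {i j a b} → i ≤ j → a ≤ b → (2 + k) ^ i * a ≤ (2 + k) ^ j * b
    power≤ i≤j a≤b = *-mono-≤ (^-monoʳ-≤ (2 + k) i≤j) a≤b

    -- Since `x` misses part of `W`, it is new to the core. If the core thereby exceeds `r`, then
    -- `W ∩ N x` has at most `r` vertices, and the ratio bounds the initial set.
    thin-shrink : ∀ {W₀ W x} → Shrinkable W x → Thin W₀ W → Thin W₀ (W ∩ N x)
    thin-shrink _ (inj₁ le) = inj₁ le
    thin-shrink {W₀} {W} {x} (lt , le) (inj₂ (thinned C joined small ratio)) = split (suc ∣ C ∣ ≤? r)
      where
      x∉C : x ∉ C
      x∉C x∈C = <⇒≱ lt (p⊆q⇒∣p∣≤∣q∣ λ b∈W → x∈p∩q⁺ (b∈W , ∈N⁺ (joined x _ x∈C b∈W)))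
      ∣C′∣ : ∣ C +ₛ x ∣ ≡ suc ∣ C ∣
      ∣C′∣ = ∣add∣ x∉C
      joined′ : ∀ a b → a ∈ C +ₛ x → b ∈ W ∩ N x → Adjacent a b
      joined′ a b a∈ b∈ with ∈-add⁻ {A = C} a∈ | x∈p∩q⁻ W (N x) b∈
      ... | inj₁ refl | _ , b∈N = ∈N⁻ b∈N
      ... | inj₂ a∈C  | b∈W , _ = joined a b a∈C b∈W
      ratio′ : ∣ W₀ ∣ ≤ (2 + k) ^ suc ∣ C ∣ * ∣ W ∩ N x ∣
      ratio′ = ≤-trans ratio (≤-trans (*-monoʳ-≤ ((2 + k) ^ ∣ C ∣) le)
        (≤-reflexive (trans (sym (*-assoc ((2 + k) ^ ∣ C ∣) (2 + k) _))
                            (cong (_* ∣ W ∩ N x ∣) (*-comm ((2 + k) ^ ∣ C ∣) (2 + k))))))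
      split : Dec (suc ∣ C ∣ ≤ r) → Thin W₀ (W ∩ N x)
      split (yes C<r) = inj₂ (thinned (C +ₛ x) joined′ (≤-trans (≤-reflexive ∣C′∣) C<r)
        (≤-trans ratio′ (≤-reflexive (cong (λ c → (2 + k) ^ c * ∣ W ∩ N x ∣) (sym ∣C′∣)))))
      split (no C≮r) = inj₁ (≤-trans ratio′ (power≤ {suc ∣ C ∣} (s≤s small) (≤-trans (≮⇒≥ few) (m≤m+n r _))))
        where
        few : ¬ r < ∣ W ∩ N x ∣
        few = biclique-free (C +ₛ x) (W ∩ N x) joined′ (≤-trans (≰⇒> C≮r) (≤-reflexive (sym ∣C′∣)))

    thin-end : ∀ {W₀ W} → Thin W₀ W → ∣ W ∣ ≤ (1 + k) * (1 + k) → ∣ W₀ ∣ ≤ bound r k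
    thin-end (inj₁ le) _ = le
    thin-end (inj₂ (thinned C _ small ratio)) W≤ =
      ≤-trans ratio (power≤ {∣ C ∣} (m≤n⇒m≤1+n small) (≤-trans W≤ (m≤n+m _ r)))

-- Conditions as numbers

module TruthValues where

  open TapePrograms
  open Language
  open import Data.Bool.Base using (Bool; true; false)
  open import Data.Fin.Base as Fin using (Fin; toℕ)
  open import Data.Fin.Subset using (Subset; _∈_; ∣_∣)
  open import Data.Nat.Base
  open import Data.Nat.Properties
  open import Data.Product.Base using (∃-syntax; _×_; _,_; proj₁; proj₂)
  open import Data.Sum.Base using (_⊎_; inj₁; inj₂)
  open import Data.Vec.Base as Vec using (Vec; []; _∷_; tabulate; here; there)
  open import Data.Vec.Properties using (lookup∘tabulate; []=⇒lookup; lookup⇒[]=)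
  open import Function.Base using (_∘_)
  open import Relation.Binary.PropositionalEquality
  open import Relation.Nullary.Decidable using (yes; no)
  open import Relation.Nullary.Negation using (¬_; contradiction)

  -- That the value is exactly 0 or 1 makes sums count and lets a `for` with this bound act as a
  -- conditional.
  data Truth (x : ℕ) (P : Set) : Set where
    holds : x ≡ 1 → P → Truth x P
    fails : x ≡ 0 → ¬ P → Truth x P

  truth-map : ∀ {x P Q} → (P → Q) → (Q → P) → Truth x P → Truth x Q
  truth-map f g (holds e p) = holds e (f p)
  truth-map f g (fails e ¬p) = fails e (¬p ∘ g)

  truth-≡ : ∀ {x y P} → x ≡ y → Truth x P → Truth y P
  truth-≡ refl t = t

  truth-not : ∀ {x P} → Truth x P → Truth (1 ∸ x) (¬ P)
  truth-not (holds refl p) = fails refl (λ ¬p → ¬p p)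
  truth-not (fails refl ¬p) = holds refl ¬p

  truth-and : ∀ {x y P Q} → Truth x P → Truth y Q → Truth (sumTo x (λ _ → y)) (P × Q)
  truth-and (holds refl p) (holds refl q) = holds refl (p , q)
  truth-and (holds refl p) (fails refl ¬q) = fails refl (¬q ∘ proj₂)
  truth-and (fails refl ¬p) _            = fails refl (¬p ∘ proj₁)

  truth-≤ : ∀ a b → Truth (1 ∸ (a ∸ b)) (a ≤ b)
  truth-≤ a b with a ≤? b
  ... | yes a≤b rewrite m≤n⇒m∸n≡0 a≤b = holds refl a≤b
  ... | no a≰b with a ∸ b in eq
  ...   | zero  = contradiction (m∸n≡0⇒m≤n eq) a≰b
  ...   | suc d = fails (0∸n≡0 d) a≰b

  sumTo-positive : ∀ n (f : ℕ → ℕ) {j} → j < n → 0 < f j → 0 < sumTo n f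
  sumTo-positive (suc n) f {j} (s≤s j≤n) pos with m≤n⇒m<n∨m≡n j≤n
  ... | inj₁ j<n  = ≤-trans (sumTo-positive n f j<n pos) (m≤m+n _ _)
  ... | inj₂ refl = ≤-trans pos (m≤n+m _ _)

  sumTo-zero : ∀ n (f : ℕ → ℕ) → (∀ j → j < n → f j ≡ 0) → sumTo n f ≡ 0
  sumTo-zero zero    f h = refl
  sumTo-zero (suc n) f h = cong₂ _+_ (sumTo-zero n f (λ j j<n → h j (m<n⇒m<1+n j<n))) (h n ≤-refl)

  truth-any : ∀ n {f : ℕ → ℕ} {P : ℕ → Set} → (∀ j → j < n → Truth (f j) (P j)) →
              Truth (1 ∸ (1 ∸ sumTo n f)) (∃[ j ] (j < n × P j))
  truth-any n {f} {P} h = truth-map found counted (truth-≤ 1 (sumTo n f))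
    where
    found′ : ∀ n → (∀ j → j < n → Truth (f j) (P j)) → 0 < sumTo n f → ∃[ j ] (j < n × P j)
    found′ (suc n) h lt with h n ≤-refl
    ... | holds _ p = n , ≤-refl , p
    ... | fails e _ with found′ n (λ j j<n → h j (m<n⇒m<1+n j<n)) (≤-trans lt (≤-reflexive (trans (cong (sumTo n f +_) e) (+-identityʳ _))))
    ...   | j , j<n , p = j , m<n⇒m<1+n j<n , p
    found : 0 < sumTo n f → ∃[ j ] (j < n × P j)
    found = found′ n h
    counted : ∃[ j ] (j < n × P j) → 0 < sumTo n f
    counted (j , j<n , p) with h j j<n
    ... | holds e _ = sumTo-positive n f j<n (≤-reflexive (sym e))
    ... | fails _ ¬p = contradiction p ¬p

  truth-all : ∀ n {f : ℕ → ℕ} {P : ℕ → Set} → (∀ j → j < n → Truth (f j) (P j)) →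
              Truth (1 ∸ sumTo n (λ j → 1 ∸ f j)) (∀ j → j < n → P j)
  truth-all n {f} {P} h = truth-map from to (truth-≤ (sumTo n (λ j → 1 ∸ f j)) 0)
    where
    from : sumTo n (λ j → 1 ∸ f j) ≤ 0 → ∀ j → j < n → P j
    from le j j<n with h j j<n
    ... | holds _ p = p
    ... | fails e _  = contradiction le (<⇒≱ (sumTo-positive n _ j<n (≤-reflexive (sym (cong (1 ∸_) e)))))
    to : (∀ j → j < n → P j) → sumTo n (λ j → 1 ∸ f j) ≤ 0
    to all = ≤-reflexive (sumTo-zero n _ λ j j<n → zero′ j j<n (h j j<n))
      where
      zero′ : ∀ j → j < n → Truth (f j) (P j) → 1 ∸ f j ≡ 0
      zero′ j j<n (holds e _) = cong (1 ∸_) e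
      zero′ j j<n (fails _ ¬p) = contradiction (all j j<n) ¬p

  truth-or : ∀ {x y P Q} → Truth x P → Truth y Q → Truth (1 ∸ (1 ∸ (x + y))) (P ⊎ Q)
  truth-or (holds refl p) (holds refl q) = holds refl (inj₁ p)
  truth-or (holds refl p) (fails refl ¬q) = holds refl (inj₁ p)
  truth-or (fails refl ¬p) (holds refl q) = holds refl (inj₂ q)
  truth-or (fails refl ¬p) (fails refl ¬q) = fails refl λ { (inj₁ p) → ¬p p ; (inj₂ q) → ¬q q }

  truth-read : ∀ b → Truth (b2n b) (b ≡ true)
  truth-read true  = holds refl refl
  truth-read false = fails refl λ ()

  truth-store : ∀ {x P} → Truth x P → ((0 <ᵇ x) ≡ true → P) × (P → (0 <ᵇ x) ≡ true)
  truth-store (holds refl p) = (λ _ → p) , (λ _ → refl)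
  truth-store (fails refl ¬p) = (λ ()) , (λ p → contradiction p ¬p)

  sumTo-shift : ∀ n (f : ℕ → ℕ) → sumTo (suc n) f ≡ f 0 + sumTo n (f ∘ suc)
  sumTo-shift zero    f = +-comm 0 (f 0)
  sumTo-shift (suc n) f = trans (cong (_+ f (suc n)) (sumTo-shift n f)) (+-assoc (f 0) _ _)

  truth-count : ∀ {n} (f : ℕ → ℕ) (A : Subset n) → (∀ i → Truth (f (toℕ i)) (i ∈ A)) → sumTo n f ≡ ∣ A ∣
  truth-count f []      h = refl
  truth-count {suc n} f (b ∷ A) h = trans (sumTo-shift n f) (head b (h Fin.zero))
    where
    rest : sumTo n (f ∘ suc) ≡ ∣ A ∣
    rest = truth-count (f ∘ suc) A λ i → truth-map (λ { (there p) → p }) there (h (Fin.suc i))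
    head : ∀ b → Truth (f 0) (Fin.zero ∈ (b ∷ A)) → f 0 + sumTo n (f ∘ suc) ≡ ∣ b ∷ A ∣
    head true  (holds e _) = cong₂ _+_ e rest
    head true  (fails _ ¬p) = contradiction here ¬p
    head false (fails e _)  = cong₂ _+_ e rest
    head false (holds _ ())

  infixl 7 _⊗_
  infixr 3 _∧ₑ_
  infixr 2 _∨ₑ_
  infix  4 _≤ₑ_ _<ₑ_ _=ₑ_

  lit : ∀ {n} → ℕ → Exp n
  lit zero    = zero
  lit (suc c) = suc (lit c)

  ⟦lit⟧ : ∀ {n} c {ρ : Vec ℕ n} {M} → ⟦ lit c ⟧ ρ M ≡ c
  ⟦lit⟧ zero    = refl
  ⟦lit⟧ (suc c) = cong suc (⟦lit⟧ c)

  -- On the values 0 and 1 a product is a conjunction. Subtraction is truncated, so `a ⊖ b` vanishes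
  -- exactly when `a` is at most `b`.
  _⊗_ _∧ₑ_ _∨ₑ_ _≤ₑ_ _<ₑ_ _=ₑ_ : ∀ {n} → Exp n → Exp n → Exp n
  a ⊗ b  = sum a (wk b)
  a ∧ₑ b = sum a (wk b)
  a ≤ₑ b = lit 1 ⊖ (a ⊖ b)
  a <ₑ b = suc a ≤ₑ b
  a =ₑ b = (a ≤ₑ b) ∧ₑ (b ≤ₑ a)
  a ∨ₑ b = lit 1 ≤ₑ a ⊕ b

  ¬ₑ_ : ∀ {n} → Exp n → Exp n
  ¬ₑ a = lit 1 ⊖ a

  allₑ anyₑ : ∀ {n} → Exp n → Exp (suc n) → Exp n
  allₑ b s = ¬ₑ sum b (¬ₑ s)
  anyₑ b s = lit 1 ≤ₑ sum b s

  sumTo-const : ∀ a b → sumTo a (λ _ → b) ≡ a * b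
  sumTo-const zero    b = refl
  sumTo-const (suc a) b = trans (cong (_+ b) (sumTo-const a b)) (+-comm (a * b) b)

  truth-= : ∀ a b → Truth (sumTo (1 ∸ (a ∸ b)) (λ _ → 1 ∸ (b ∸ a))) (a ≡ b)
  truth-= a b = truth-map (λ (p , q) → ≤-antisym p q) (λ { refl → ≤-refl , ≤-refl }) (truth-and (truth-≤ a b) (truth-≤ b a))

  slice : ∀ {n} → (ℕ → Bool) → Subset n
  slice f = tabulate (f ∘ toℕ)

  ∈slice⁺ : ∀ {n} f (i : Fin n) → f (toℕ i) ≡ true → i ∈ slice f
  ∈slice⁺ f i e = lookup⇒[]= i _ (trans (lookup∘tabulate (f ∘ toℕ) i) e)

  ∈slice⁻ : ∀ {n} f (i : Fin n) → i ∈ slice f → f (toℕ i) ≡ true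
  ∈slice⁻ f i i∈ = trans (sym (lookup∘tabulate (f ∘ toℕ) i)) ([]=⇒lookup i∈)

  set-array : ∀ M a i b {a′} → a′ ≢ a → set M a i b a′ ≗ M a′
  set-array M a i b a′≢a j = cong (λ f → f j) (upd-off M a′≢a)

  set-at : ∀ M a i b → set M a i b a i ≡ b
  set-at M a i b = trans (cong (λ f → f i) (upd-at M a)) (upd-at (M a) i)

  set-index : ∀ M a i b {j} → j ≢ i → set M a i b a j ≡ M a j
  set-index M a i b {j} j≢i = trans (cong (λ f → f j) (upd-at M a)) (upd-off (M a) j≢i)

  forTo-invariant : ∀ {X : Set} (P : ℕ → X → Set) {f : ℕ → X → X} n →
    (∀ j x → j < n → P (suc j) x → P j (f j x)) → ∀ {x} → P n x → P 0 (forTo n f x)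
  forTo-invariant P zero    h p = p
  forTo-invariant P (suc n) h p = forTo-invariant P n (λ j x j<n → h j x (m<n⇒m<1+n j<n)) (h n _ ≤-refl p)

  forTo-if : ∀ {X P : Set} {c : ℕ} {f : ℕ → X → X} {x} → Truth c P →
    (P × forTo c f x ≡ f 0 x) ⊎ (¬ P × forTo c f x ≡ x)
  forTo-if (holds refl p) = inj₁ (p , refl)
  forTo-if (fails refl ¬p) = inj₂ (¬p , refl)

  record Filled (a len : ℕ) (P : ℕ → Set) (M M′ : Mem) : Set where
    field
      off : ∀ {a′} → a′ ≢ a → M′ a′ ≗ M a′
      on⁺ : ∀ j → j < len → P j → M′ a j ≡ true
      on⁻ : ∀ j → j < len → M′ a j ≡ true → P j

  fill : ∀ {n} → Fin arrays → Exp n → Exp (suc n) → Cmd n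
  fill a len e = for len (a [ var Fin.zero ]:= e)

  -- Entries are written from the top down, so the j-th value may still read the old entries up to j.
  fill-correct : ∀ a len (val : ℕ → Mem → ℕ) (P : ℕ → Set) M →
    (∀ j M′ → j < len → (∀ {a′} → a′ ≢ a → M′ a′ ≗ M a′) → (∀ i → i ≤ j → M′ a i ≡ M a i) → Truth (val j M′) (P j)) →
    Filled a len P M (forTo len (λ j M → set M a j (0 <ᵇ val j M)) M)
  fill-correct a len val P M h = let o , p , q , _ = go len M ≤-refl (λ _ _ → refl) (λ _ _ → refl) in
    record { off = o ; on⁺ = p ; on⁻ = q }
    where
    write : ℕ → Mem → Mem
    write j M = set M a j (0 <ᵇ val j M)
    -- The last clause of the conclusion protects the entry just written from the rest of the loop.
    go : ∀ l M₁ → l ≤ len → (∀ {a′} → a′ ≢ a → M₁ a′ ≗ M a′) → (∀ i → i < l → M₁ a i ≡ M a i) →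
         let M′ = forTo l write M₁ in
         (∀ {a′} → a′ ≢ a → M′ a′ ≗ M a′) × (∀ j → j < l → P j → M′ a j ≡ true) ×
         (∀ j → j < l → M′ a j ≡ true → P j) × (∀ j → l ≤ j → M′ a j ≡ M₁ a j)
    go zero M₁ _ o _ = o , (λ _ ()) , (λ _ ()) , (λ _ _ → refl)
    go (suc l) M₁ l<len o b with go l (write l M₁) (<⇒≤ l<len)
        (λ a′≢a j → trans (set-array M₁ a l _ a′≢a j) (o a′≢a j))
        (λ i i<l → trans (set-index M₁ a l _ (<⇒≢ i<l)) (b i (m<n⇒m<1+n i<l)))
    ... | o′ , p , q , above = o′ , p′ , q′ , above′
      where
      M′ = forTo l write (write l M₁)
      truth : Truth (val l M₁) (P l)
      truth = h l M₁ l<len o (λ i i≤l → b i (s≤s i≤l))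
      last : M′ a l ≡ (0 <ᵇ val l M₁)
      last = trans (above l ≤-refl) (set-at M₁ a l _)
      p′ : ∀ j → j < suc l → P j → M′ a j ≡ true
      p′ j (s≤s j≤l) pj with m≤n⇒m<n∨m≡n j≤l
      ... | inj₁ j<l  = p j j<l pj
      ... | inj₂ refl = trans last (proj₂ (truth-store truth) pj)
      q′ : ∀ j → j < suc l → M′ a j ≡ true → P j
      q′ j (s≤s j≤l) e with m≤n⇒m<n∨m≡n j≤l
      ... | inj₁ j<l  = q j j<l e
      ... | inj₂ refl = proj₁ (truth-store truth) (trans (sym last) e)
      above′ : ∀ j → suc l ≤ j → M′ a j ≡ M₁ a j
      above′ j l<j = trans (above j (<⇒≤ l<j)) (set-index M₁ a l _ (>⇒≢ l<j))

-- Deleting vertices until few are left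

module Kernelization where

  open TapePrograms
  open Language
  open TreeDecompositions
  open TokenReplacement
  open Thinning
  open TruthValues
  open import Data.Bool.Base using (true; false)
  open import Data.Bool.Properties as Boolₚ using (T-≡)
  open import Data.Fin.Base as Fin using (toℕ; fromℕ<)
  open import Data.Fin.Patterns using (0F; 1F; 2F; 3F; 4F; 5F; 6F)
  open import Data.Fin.Properties using (toℕ<n; toℕ-fromℕ<; toℕ-injective)
  open import Data.Fin.Subset using (Subset; _∈_; _∉_; ∣_∣; _⊆_; _∩_; _∪_; ∁)
  open import Data.Fin.Subset.Properties using (_∈?_; p⊆q⇒∣p∣≤∣q∣; ∣p∣≤n; x∈p∩q⁺; x∈p∩q⁻; x∈p∪q⁺; x∈p∪q⁻; ⊆-antisym; x∈∁p⇒x∉p; x∉p⇒x∈∁p; p∩q⊆p)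
  open import Data.Nat.Base
  open import Data.Nat.Properties
  open import Data.Product.Base using (∃-syntax; _×_; _,_; proj₁; proj₂)
  open import Data.Sum.Base using (_⊎_; inj₁; inj₂)
  open import Data.Vec.Base as Vec using ([]; _∷_; lookup)
  open import Data.Vec.Properties using ([]=⇒lookup; lookup⇒[]=)
  open import Function.Base using (_∘_; id)
  open import Function.Bundles using (Equivalence)
  open import Relation.Binary.Construct.Closure.ReflexiveTransitive as Star using (Star)
  open import Relation.Binary.Definitions using (tri<; tri≈; tri>)
  open import Relation.Binary.PropositionalEquality
  open import Relation.Nullary.Decidable using (yes; no)
  open import Relation.Nullary.Negation using (¬_; contradiction)

  v0 : ∀ {n} → Exp (1 + n)
  v0 = var 0F
  v1 : ∀ {n} → Exp (2 + n)
  v1 = var 1F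
  v2 : ∀ {n} → Exp (3 + n)
  v2 = var 2F
  v3 : ∀ {n} → Exp (4 + n)
  v3 = var 3F
  v4 : ∀ {n} → Exp (5 + n)
  v4 = var 4F
  v5 : ∀ {n} → Exp (6 + n)
  v5 = var 5F
  v6 : ∀ {n} → Exp (7 + n)
  v6 = var 6F

  -- The input array holds the adjacency matrix, the source and the target; row a of the table
  -- is the a-th subset of the kernel.
  pattern inputA   = 0F
  pattern deadA    = 1F
  pattern poolA    = 2F
  pattern tableA   = 3F
  pattern unaryA   = 4F
  pattern reachedA = 5F

  edgeE : ∀ {m} → Exp m → Exp m → Exp m → Exp m
  edgeE n x v = inputA ! (x ⊗ n ⊕ v)

  sourceE targetE : ∀ {m} → Exp m → Exp m → Exp m
  sourceE n v = inputA ! (n ⊗ n ⊕ v)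
  targetE n v = inputA ! (n ⊗ n ⊕ (n ⊕ v))

  -- Environment x , pass , round , N , n , k.
  poolE commonE : Exp 6
  poolE   = sum v4 (poolA ! v0)
  commonE = sum v4 ((poolA ! v0) ∧ₑ edgeE v5 v1 v0)

  shrinkC : Cmd 6
  shrinkC = for ((commonE <ₑ poolE) ∧ₑ (poolE ≤ₑ suc (suc v5) ⊗ commonE))
                (fill poolA v5 ((poolA ! v0) ∧ₑ edgeE v6 v2 v0))

  -- Environment round , N , n , k.
  roundC : Cmd 4
  roundC = fill poolA v2 ((¬ₑ (deadA ! v0)) ∧ₑ ((¬ₑ sourceE v3 v0) ∧ₑ (¬ₑ targetE v3 v0)))
         ⨾ for v2 (for v3 shrinkC)
         ⨾ for (suc v3 ⊗ suc v3 <ₑ sum v2 (poolA ! v0))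
               (fill deadA v3 ((deadA ! v0) ∨ₑ ((poolA ! v0) ∧ₑ allₑ v0 (¬ₑ (poolA ! v0)))))

  -- Environment N , n , k.
  kernelC : Cmd 3
  kernelC = for v1 roundC

  ∈-≡ : ∀ {n} {p q : Subset n} → (∀ x → x ∈ p → x ∈ q) → (∀ x → x ∈ q → x ∈ p) → p ≡ q
  ∈-≡ f g = ⊆-antisym (f _) (g _)

  slice-cong : ∀ {n f g} → f ≗ g → slice {n} f ≡ slice g
  slice-cong {f = f} {g} h = ∈-≡ (λ i i∈ → ∈slice⁺ g i (trans (sym (h (toℕ i))) (∈slice⁻ f i i∈)))
                                 (λ i i∈ → ∈slice⁺ f i (trans (h (toℕ i)) (∈slice⁻ g i i∈)))

  record Inputs (I : ISRInstance) (M : Mem) : Set where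
    open ISRInstance I
    open Graph using (order)
    field
      adj-read    : ∀ x v → M 0 (toℕ x * order graph + toℕ v) ≡ Graph.adj graph x v
      source-read : ∀ v → M 0 (order graph * order graph + toℕ v) ≡ lookup source v
      target-read : ∀ v → M 0 (order graph * order graph + (order graph + toℕ v)) ≡ lookup target v

  module Reduction (I : ISRInstance) (r : ℕ)
    (biclique-free : ∀ (A B : Subset (Graph.order (ISRInstance.graph I))) →
      (∀ a b → a ∈ A → b ∈ B → Graph.Adjacent (ISRInstance.graph I) a b) → r < ∣ A ∣ → ¬ r < ∣ B ∣)
    (big : ℕ) where

    open ISRInstance I
    open Graph graph using (Vertex; Adjacent; adj) renaming (order to n)
    open Kernel graph k k-positive
    open Shrinking graph k k-positive r biclique-free
    open ReconfigurationGraph graph k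

    inputs-cong : ∀ {M M′} → M′ 0 ≗ M 0 → Inputs I M → Inputs I M′
    inputs-cong h i = record
      { adj-read    = λ x v → trans (h _) (Inputs.adj-read i x v)
      ; source-read = λ v → trans (h _) (Inputs.source-read i v)
      ; target-read = λ v → trans (h _) (Inputs.target-read i v)
      }

    truth-edge : ∀ {M} → Inputs I M → ∀ x v → Truth (b2n (M 0 (sumTo (toℕ x) (λ _ → n) + toℕ v))) (Adjacent x v)
    truth-edge {M} i x v rewrite sumTo-const (toℕ x) n | Inputs.adj-read i x v =
      truth-map (Equivalence.from T-≡) (Equivalence.to T-≡) (truth-read (adj x v))

    truth-source : ∀ {M} → Inputs I M → ∀ v → Truth (b2n (M 0 (sumTo n (λ _ → n) + toℕ v))) (v ∈ source)
    truth-source {M} i v rewrite sumTo-const n n | Inputs.source-read i v =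
      truth-map (lookup⇒[]= v source) []=⇒lookup (truth-read (lookup source v))

    truth-target : ∀ {M} → Inputs I M → ∀ v → Truth (b2n (M 0 (sumTo n (λ _ → n) + (n + toℕ v)))) (v ∈ target)
    truth-target {M} i v rewrite sumTo-const n n | Inputs.target-read i v =
      truth-map (lookup⇒[]= v target) []=⇒lookup (truth-read (lookup target v))

    truth-slice : ∀ f (v : Vertex) → Truth (b2n (f (toℕ v))) (v ∈ slice f)
    truth-slice f v = truth-map (∈slice⁺ f v) (∈slice⁻ f v) (truth-read (f (toℕ v)))

    slice-size : ∀ f → sumTo n (b2n ∘ f) ≡ ∣ slice {n} f ∣
    slice-size f = truth-count (b2n ∘ f) (slice f) (truth-slice f)

    below : ∀ {P : ℕ → Set} → (∀ (v : Vertex) → P (toℕ v)) → ∀ j → j < n → P j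
    below {P} h j j<n = subst P (toℕ-fromℕ< j<n) (h (fromℕ< j<n))

    forTo-vertices : ∀ {X : Set} (P : ℕ → X → Set) {f : ℕ → X → X} →
      (∀ (v : Vertex) x → P (suc (toℕ v)) x → P (toℕ v) (f (toℕ v) x)) → ∀ {x} → P n x → P 0 (forTo n f x)
    forTo-vertices P {f} h = forTo-invariant P n λ j x j<n →
      below {λ j → P (suc j) x → P j (f j x)} (λ v → h v x) j j<n

    filled-slice : ∀ {a P M M′} → Filled a n P M M′ → (A : Set′) → (∀ v → P (toℕ v) → v ∈ A) → (∀ v → v ∈ A → P (toℕ v)) →
      slice (M′ a) ≡ A
    filled-slice {a} {M′ = M′} f A to from = ∈-≡
      (λ v v∈ → to v (Filled.on⁻ f (toℕ v) (toℕ<n v) (∈slice⁻ (M′ a) v v∈)))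
      (λ v v∈ → ∈slice⁺ (M′ a) v (Filled.on⁺ f (toℕ v) (toℕ<n v) (from v v∈)))

    pool dead : Mem → Set′
    pool M = slice (M 2)
    dead M = slice (M 1)

    OffPool : Mem → Mem → Set
    OffPool M M′ = ∀ {a} → a ≢ 2 → M′ a ≗ M a

    shrink-correct : ∀ {M} → Inputs I M → ∀ x p j → let M′ = ⟪ shrinkC ⟫ (toℕ x ∷ p ∷ j ∷ big ∷ n ∷ k ∷ []) M in
      (Shrinkable (pool M) x × pool M′ ≡ pool M ∩ N x × OffPool M M′) ⊎ (¬ Shrinkable (pool M) x × M′ ≡ M)
    shrink-correct {M} i x p j with forTo-if {f = body} {x = M} condition
      where
      ρ = toℕ x ∷ p ∷ j ∷ big ∷ n ∷ k ∷ []
      body : ℕ → Mem → Mem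
      body c = ⟪ fill poolA v5 ((poolA ! v0) ∧ₑ edgeE v6 v2 v0) ⟫ (c ∷ ρ)
      common : ⟦ commonE ⟧ ρ M ≡ ∣ pool M ∩ N x ∣
      common = truth-count _ (pool M ∩ N x) λ v →
        truth-map (λ (v∈ , xv) → x∈p∩q⁺ (v∈ , ∈N⁺ xv)) (λ v∈ → let a , b = x∈p∩q⁻ (pool M) (N x) v∈ in a , ∈N⁻ b)
                  (truth-and (truth-slice (M 2) v) (truth-edge i x v))
      condition : Truth (⟦ (commonE <ₑ poolE) ∧ₑ (poolE ≤ₑ suc (suc v5) ⊗ commonE) ⟧ ρ M) (Shrinkable (pool M) x)
      condition = truth-map
        (λ (lt , le) → subst₂ _<_ common (slice-size (M 2)) lt ,
                       subst₂ _≤_ (slice-size (M 2)) (trans (sumTo-const (2 + k) _) (cong ((2 + k) *_) common)) le)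
        (λ (lt , le) → subst₂ _<_ (sym common) (sym (slice-size (M 2))) lt ,
                       subst₂ _≤_ (sym (slice-size (M 2))) (sym (trans (sumTo-const (2 + k) _) (cong ((2 + k) *_) common))) le)
        (truth-and (truth-≤ (suc (⟦ commonE ⟧ ρ M)) (⟦ poolE ⟧ ρ M)) (truth-≤ (⟦ poolE ⟧ ρ M) (⟦ suc (suc v5) ⊗ commonE ⟧ ρ M)))
    ... | inj₂ (¬s , eq) = inj₂ (¬s , eq)
    ... | inj₁ (s , eq) = inj₁ (s ,
        trans (cong pool eq) (filled-slice filled (pool M ∩ N x)
          (λ v (v∈ , xv) → x∈p∩q⁺ (∈slice⁺ (M 2) v v∈ , ∈N⁺ (edge⁻ v xv)))
          (λ v v∈ → let a , b = x∈p∩q⁻ (pool M) (N x) v∈ in ∈slice⁻ (M 2) v a , edge⁺ v (∈N⁻ b))) ,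
        λ a≢2 q → trans (cong (λ m → m _ q) eq) (Filled.off filled a≢2 q))
      where
      ρ = toℕ x ∷ p ∷ j ∷ big ∷ n ∷ k ∷ []
      P : ℕ → Set
      P v = M 2 v ≡ true × M 0 (sumTo (toℕ x) (λ _ → n) + v) ≡ true
      edge⁻ : ∀ v → M 0 (sumTo (toℕ x) (λ _ → n) + toℕ v) ≡ true → Adjacent x v
      edge⁻ v e with truth-edge i x v
      ... | holds _ a = a
      ... | fails e′ _ = contradiction (trans (sym (cong b2n e)) e′) λ ()
      edge⁺ : ∀ v → Adjacent x v → M 0 (sumTo (toℕ x) (λ _ → n) + toℕ v) ≡ true
      edge⁺ v a = trans (cong (λ z → M 0 (z + toℕ v)) (sumTo-const (toℕ x) n)) (trans (Inputs.adj-read i x v) (Equivalence.to T-≡ a))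
      filled : Filled 2 n P M (⟪ fill poolA v5 ((poolA ! v0) ∧ₑ edgeE v6 v2 v0) ⟫ (0 ∷ ρ) M)
      filled = fill-correct 2 n (λ v M → ⟦ (poolA ! v0) ∧ₑ edgeE v6 v2 v0 ⟧ (v ∷ 0 ∷ ρ) M) P M λ v M′ v<n off same →
        truth-and (truth-≡ (cong b2n (sym (same v ≤-refl))) (truth-read (M 2 v)))
                  (truth-≡ (cong b2n (sym (off (λ ()) _))) (truth-read (M 0 _)))

    record Passed (M M′ : Mem) : Set where
      field
        inputs : Inputs I M′
        off    : OffPool M M′
        thin   : ∀ {W} → Thin W (pool M) → Thin W (pool M′)
        sub    : pool M′ ⊆ pool M

    module _ (p j : ℕ) where

      passM : Mem → Mem
      passM = forTo n (λ x → ⟪ shrinkC ⟫ (x ∷ p ∷ j ∷ big ∷ n ∷ k ∷ []))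

      -- Until the first shrinking, every vertex visited has been tested against the original set.
      -- Hence a pass without shrinking certifies stability, and any other pass loses a vertex.
      pass-correct : ∀ {M} → Inputs I M → Passed M (passM M) ×
        ((Stable (pool M) × pool (passM M) ≡ pool M) ⊎ (¬ Stable (pool M) × ∣ pool (passM M) ∣ < ∣ pool M ∣))
      pass-correct {M} i = finish (forTo-vertices Inv step {M} start)
        where
        Inv : ℕ → Mem → Set
        Inv l M₁ = Passed M M₁ ×
          ((pool M₁ ≡ pool M × ∀ x → l ≤ toℕ x → ¬ Shrinkable (pool M) x) ⊎
           (¬ Stable (pool M) × ∣ pool M₁ ∣ < ∣ pool M ∣))
        start : Inv n M
        start = record { inputs = i ; off = λ _ _ → refl ; thin = id ; sub = id } ,
                inj₁ (refl , λ x n≤x → contradiction n≤x (<⇒≱ (toℕ<n x)))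
        step : ∀ x M₁ → Inv (suc (toℕ x)) M₁ → Inv (toℕ x) (⟪ shrinkC ⟫ (toℕ x ∷ p ∷ j ∷ big ∷ n ∷ k ∷ []) M₁)
        step x M₁ (ps , state) with shrink-correct (Passed.inputs ps) x p j
        ... | inj₂ (¬s , eq) rewrite eq = ps , keep state
          where
          keep : _ → _
          keep (inj₂ fewer) = inj₂ fewer
          keep (inj₁ (same , above)) = inj₁ (same , λ y x≤y → at y (m≤n⇒m<n∨m≡n x≤y))
            where
            at : ∀ y → toℕ x < toℕ y ⊎ toℕ x ≡ toℕ y → ¬ Shrinkable (pool M) y
            at y (inj₁ x<y) = above y x<y
            at y (inj₂ x≡y) with toℕ-injective x≡y
            ... | refl = subst (λ W → ¬ Shrinkable W x) same ¬s
        ... | inj₁ (s , eq , off) = record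
                { inputs = inputs-cong (off (λ ())) (Passed.inputs ps)
                ; off    = λ a≢2 q → trans (off a≢2 q) (Passed.off ps a≢2 q)
                ; thin   = λ t → subst (Thin _) (sym eq) (thin-shrink s (Passed.thin ps t))
                ; sub    = λ v∈ → Passed.sub ps (p∩q⊆p _ _ (subst (_ ∈_) eq v∈))
                } , inj₂ (fewer state)
          where
          M₂ = ⟪ shrinkC ⟫ (toℕ x ∷ p ∷ j ∷ big ∷ n ∷ k ∷ []) M₁
          smaller : ∣ pool M₂ ∣ < ∣ pool M₁ ∣
          smaller = ≤-trans (s≤s (≤-reflexive (cong ∣_∣ eq))) (proj₁ s)
          fewer : (pool M₁ ≡ pool M × ∀ y → suc (toℕ x) ≤ toℕ y → ¬ Shrinkable (pool M) y) ⊎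
                 (¬ Stable (pool M) × ∣ pool M₁ ∣ < ∣ pool M ∣) → ¬ Stable (pool M) × ∣ pool M₂ ∣ < ∣ pool M ∣
          fewer (inj₁ (same , _)) = (λ st → st x (subst (λ W → Shrinkable W x) same s)) ,
                                   ≤-trans (smaller) (≤-reflexive (cong ∣_∣ same))
          fewer (inj₂ (¬st , lt)) = ¬st , <-trans (smaller) lt
        finish : ∀ {M₁} → Inv 0 M₁ → Passed M M₁ ×
          ((Stable (pool M) × pool M₁ ≡ pool M) ⊎ (¬ Stable (pool M) × ∣ pool M₁ ∣ < ∣ pool M ∣))
        finish (ps , inj₁ (same , none)) = ps , inj₁ ((λ x → none x z≤n) , same)
        finish (ps , inj₂ fewer)          = ps , inj₂ fewer

    -- `n` passes suffice: the pool has at most `n` vertices, and an empty pool is stable.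
    passes-correct : ∀ j {M} → Inputs I M → let M′ = forTo n (λ p → passM p j) M in
      Passed M M′ × Stable (pool M′)
    passes-correct j {M} i = finish (forTo-invariant Inv n step {M} start)
      where
      Inv : ℕ → Mem → Set
      Inv l M₁ = Passed M M₁ × (Stable (pool M₁) ⊎ ∣ pool M₁ ∣ ≤ l)
      start : Inv n M
      start = record { inputs = i ; off = λ _ _ → refl ; thin = id ; sub = id } , inj₂ (∣p∣≤n (pool M))
      step : ∀ p M₁ → p < n → Inv (suc p) M₁ → Inv p (passM p j M₁)
      step p M₁ _ (ps , state) with pass-correct p j (Passed.inputs ps)
      ... | qs , outcome = record
          { inputs = Passed.inputs qs
          ; off    = λ a≢2 q → trans (Passed.off qs a≢2 q) (Passed.off ps a≢2 q)
          ; thin   = Passed.thin qs ∘ Passed.thin ps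
          ; sub    = Passed.sub ps ∘ Passed.sub qs
          } , next state outcome
        where
        next : Stable (pool M₁) ⊎ ∣ pool M₁ ∣ ≤ suc p → _ → Stable (pool (passM p j M₁)) ⊎ ∣ pool (passM p j M₁) ∣ ≤ p
        next _         (inj₁ (st , same)) = inj₁ (subst Stable (sym same) st)
        next (inj₁ st) (inj₂ (¬st , _))   = contradiction st ¬st
        next (inj₂ le) (inj₂ (_ , lt))    = inj₂ (s≤s⁻¹ (≤-trans lt le))
      finish : ∀ {M₁} → Inv 0 M₁ → Passed M M₁ × Stable (pool M₁)
      finish (ps , inj₁ st) = ps , st
      finish (ps , inj₂ le) = ps , λ x (lt , _) → n≮0 (≤-trans lt le)

    fresh : Set′ → Set′
    fresh D = ∁ D ∩ (∁ source ∩ ∁ target)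

    fresh⁺ : ∀ {D v} → v ∉ D → v ∉ source → v ∉ target → v ∈ fresh D
    fresh⁺ a b c = x∈p∩q⁺ (x∉p⇒x∈∁p a , x∈p∩q⁺ (x∉p⇒x∈∁p b , x∉p⇒x∈∁p c))

    fresh⁻ : ∀ {D v} → v ∈ fresh D → v ∉ D × v ∉ source × v ∉ target
    fresh⁻ {D} v∈ with x∈p∩q⁻ (∁ D) _ v∈
    ... | a , bc with x∈p∩q⁻ (∁ source) (∁ target) bc
    ... | b , c = x∈∁p⇒x∉p a , x∈∁p⇒x∉p b , x∈∁p⇒x∉p c

    fresh-add : ∀ {D v} → v ∈ fresh D → ∣ fresh (D +ₛ v) ∣ < ∣ fresh D ∣
    fresh-add {D} {v} v∈ = ≤-trans (≤-reflexive (sym (∣add∣ {A = fresh (D +ₛ v)} (λ v∈′ → proj₁ (fresh⁻ {D +ₛ v} v∈′) (∈-add D v)))))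
      (p⊆q⇒∣p∣≤∣q∣ λ u∈ → back (∈-add⁻ {A = fresh (D +ₛ v)} u∈))
      where
      back : ∀ {u} → u ≡ v ⊎ u ∈ fresh (D +ₛ v) → u ∈ fresh D
      back (inj₁ refl) = v∈
      back (inj₂ u∈)   = let a , b , c = fresh⁻ {D +ₛ v} u∈ in fresh⁺ (a ∘ ∈-add⁺ v) b c

    record Killed (M M′ : Mem) : Set where
      field
        inputs : Inputs I M′
        off    : ∀ {a} → a ≢ 1 → a ≢ 2 → M′ a ≗ M a
        path   : Star (Step (dead M)) source target → Star (Step (dead M′)) source target
        live   : Live (dead M) source → Live (dead M′) source

    bigE : Exp 4
    bigE = suc v3 ⊗ suc v3 <ₑ sum v2 (poolA ! v0)

    killE : Exp 6
    killE = (deadA ! v0) ∨ₑ ((poolA ! v0) ∧ₑ allₑ v0 (¬ₑ (poolA ! v0)))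

    -- Any vertex of the pool could be deleted. The least one is taken because an expression can
    -- single it out, as the member with no member before it.
    kill-first : ∀ {M j} → Inputs I M → Stable (pool M) → (∀ v → v ∈ pool M → v ∈ fresh (dead M)) →
      (1 + k) * (1 + k) < ∣ pool M ∣ → let M′ = ⟪ fill deadA v3 killE ⟫ (0 ∷ j ∷ big ∷ n ∷ k ∷ []) M in
      Killed M M′ × ∣ fresh (dead M′) ∣ < ∣ fresh (dead M) ∣
    kill-first {M} {j} i st W⊆ many with least (λ i → M 2 i ≡ true) (λ i → M 2 i Boolₚ.≟ true) someone
      where
      someone : ∃[ i ] (M 2 i ≡ true)
      someone with nonempty-of-size (pool M) many
      ... | v , v∈ = toℕ v , ∈slice⁻ (M 2) v v∈
    ... | m , m∈ , m≤ = record
        { inputs = inputs-cong (Filled.off filled (λ ())) i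
        ; off    = λ a≢1 _ → Filled.off filled a≢1
        ; path   = λ p → subst (λ D → Star (Step D) source target) (sym dead≡)
                     (deletion-safe (proj₁ (proj₂ v-fresh)) (proj₂ (proj₂ v-fresh)) p)
        ; live   = λ l u u∈s u∈ → still l u∈s (∈-add⁻ {A = dead M} (subst (u ∈_) dead≡ u∈))
        } , subst (λ D → ∣ fresh D ∣ < ∣ fresh (dead M) ∣) (sym dead≡) (fresh-add (W⊆ v v∈))
      where
      ρ = 0 ∷ j ∷ big ∷ n ∷ k ∷ []
      m<n : m < n
      m<n with nonempty-of-size (pool M) many
      ... | v , v∈ = ≤-trans (s≤s (m≤ (toℕ v) (∈slice⁻ (M 2) v v∈))) (toℕ<n v)
      v : Vertex
      v = fromℕ< m<n
      v≡m : toℕ v ≡ m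
      v≡m = toℕ-fromℕ< m<n
      v∈ : v ∈ pool M
      v∈ = ∈slice⁺ (M 2) v (subst (λ i → M 2 i ≡ true) (sym v≡m) m∈)
      v-fresh = fresh⁻ {dead M} (W⊆ v v∈)
      still : Live (dead M) source → ∀ {u} → u ∈ source → ¬ (u ≡ v ⊎ u ∈ dead M)
      still l u∈s (inj₁ refl) = proj₁ (proj₂ v-fresh) u∈s
      still l u∈s (inj₂ u∈D)  = l _ u∈s u∈D
      open Deletion {dead M} {pool M} (stable⇒sparse st) many (λ w w∈ → proj₁ (fresh⁻ {dead M} (W⊆ w w∈))) {v} v∈ using (deletion-safe)
      P : ℕ → Set
      P u = M 1 u ≡ true ⊎ (M 2 u ≡ true × (∀ l → l < u → ¬ M 2 l ≡ true))
      filled : Filled 1 n P M (⟪ fill deadA v3 killE ⟫ ρ M)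
      filled = fill-correct 1 n (λ u M → ⟦ killE ⟧ (u ∷ ρ) M) P M λ u M′ u<n off same →
        truth-or (truth-≡ (cong b2n (sym (same u ≤-refl))) (truth-read (M 1 u)))
          (truth-and (truth-≡ (cong b2n (sym (off (λ ()) u))) (truth-read (M 2 u)))
            (truth-all u λ l l<u → truth-not (truth-≡ (cong b2n (sym (off (λ ()) l))) (truth-read (M 2 l)))))
      dead≡ : dead (⟪ fill deadA v3 killE ⟫ ρ M) ≡ dead M +ₛ v
      dead≡ = filled-slice filled (dead M +ₛ v) to from
        where
        to : ∀ u → P (toℕ u) → u ∈ dead M +ₛ v
        to u (inj₁ u∈) = ∈-add⁺ v (∈slice⁺ (M 1) u u∈)
        to u (inj₂ (u∈ , none)) with <-cmp m (toℕ u)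
        ... | tri< m<u _ _ = contradiction m∈ (none m m<u)
        ... | tri≈ _ m≡u _ = subst (_∈ dead M +ₛ v) (toℕ-injective (trans v≡m m≡u)) (∈-add (dead M) v)
        ... | tri> _ _ u<m = contradiction (m≤ (toℕ u) u∈) (<⇒≱ u<m)
        from : ∀ u → u ∈ dead M +ₛ v → P (toℕ u)
        from u u∈ with ∈-add⁻ {A = dead M} u∈
        ... | inj₂ u∈D  = inj₁ (∈slice⁻ (M 1) u u∈D)
        ... | inj₁ refl = inj₂ (∈slice⁻ (M 2) v v∈ , λ l l<v l∈ → <⇒≱ (≤-trans l<v (≤-reflexive v≡m)) (m≤ l l∈))

    freshE : Exp 5
    freshE = (¬ₑ (deadA ! v0)) ∧ₑ ((¬ₑ sourceE v3 v0) ∧ₑ (¬ₑ targetE v3 v0))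

    pool-fresh : ∀ {M j} → Inputs I M → let M′ = ⟪ fill poolA v2 freshE ⟫ (j ∷ big ∷ n ∷ k ∷ []) M in
      OffPool M M′ × pool M′ ≡ fresh (dead M)
    pool-fresh {M} {j} i = Filled.off filled , filled-slice filled (fresh (dead M))
      (λ v (a , b , c) → fresh⁺ {dead M} (a ∘ ∈slice⁻ (M 1) v) (b ∘ source⁺ v) (c ∘ target⁺ v))
      (λ v v∈ → let a , b , c = fresh⁻ {dead M} v∈ in (a ∘ ∈slice⁺ (M 1) v) , (b ∘ source⁻ v) , (c ∘ target⁻ v))
      where
      ρ = j ∷ big ∷ n ∷ k ∷ []
      square = sumTo n (λ _ → n)
      P : ℕ → Set
      P v = ¬ M 1 v ≡ true × ¬ M 0 (square + v) ≡ true × ¬ M 0 (square + (n + v)) ≡ true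
      source⁺ : ∀ v → v ∈ source → M 0 (square + toℕ v) ≡ true
      source⁺ v v∈ = trans (cong (λ z → M 0 (z + toℕ v)) (sumTo-const n n)) (trans (Inputs.source-read i v) ([]=⇒lookup v∈))
      source⁻ : ∀ v → M 0 (square + toℕ v) ≡ true → v ∈ source
      source⁻ v e = lookup⇒[]= v source (trans (sym (Inputs.source-read i v)) (trans (cong (λ z → M 0 (z + toℕ v)) (sym (sumTo-const n n))) e))
      target⁺ : ∀ v → v ∈ target → M 0 (square + (n + toℕ v)) ≡ true
      target⁺ v v∈ = trans (cong (λ z → M 0 (z + (n + toℕ v))) (sumTo-const n n)) (trans (Inputs.target-read i v) ([]=⇒lookup v∈))
      target⁻ : ∀ v → M 0 (square + (n + toℕ v)) ≡ true → v ∈ target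
      target⁻ v e = lookup⇒[]= v target (trans (sym (Inputs.target-read i v)) (trans (cong (λ z → M 0 (z + (n + toℕ v))) (sym (sumTo-const n n))) e))
      filled : Filled 2 n P M (⟪ fill poolA v2 freshE ⟫ ρ M)
      filled = fill-correct 2 n (λ v M → ⟦ freshE ⟧ (v ∷ ρ) M) P M λ v M′ v<n off same →
        truth-and (truth-not (truth-≡ (cong b2n (sym (off (λ ()) v))) (truth-read (M 1 v))))
          (truth-and (truth-not (truth-≡ (cong b2n (sym (off (λ ()) _))) (truth-read (M 0 (square + v)))))
                     (truth-not (truth-≡ (cong b2n (sym (off (λ ()) _))) (truth-read (M 0 (square + (n + v)))))))

    -- Stated for arbitrary intermediate memories, so that type checking does not unfold the loops.
    round-end : ∀ {M M₁ M₂ j} → OffPool M M₁ × pool M₁ ≡ fresh (dead M) → Passed M₁ M₂ × Stable (pool M₂) →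
      let M₃ = ⟪ for bigE (fill deadA v3 killE) ⟫ (j ∷ big ∷ n ∷ k ∷ []) M₂ in
      Killed M M₃ × (∣ fresh (dead M₃) ∣ ≤ bound r k ⊎ ∣ fresh (dead M₃) ∣ < ∣ fresh (dead M) ∣) ×
      ∣ fresh (dead M₃) ∣ ≤ ∣ fresh (dead M) ∣
    round-end {M} {M₁} {M₂} {j} (off₁ , pool₁) (passed , stable) = finish (forTo-if {f = killC} {x = M₂} truth)
      where
      ρ = j ∷ big ∷ n ∷ k ∷ []
      killC : ℕ → Mem → Mem
      killC c = ⟪ fill deadA v3 killE ⟫ (c ∷ ρ)
      off₂ : OffPool M M₂
      off₂ a≢2 q = trans (Passed.off passed a≢2 q) (off₁ a≢2 q)
      dead₂ : dead M₂ ≡ dead M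
      dead₂ = slice-cong (off₂ (λ ()))
      W⊆ : ∀ v → v ∈ pool M₂ → v ∈ fresh (dead M₂)
      W⊆ v v∈ = subst (λ D → v ∈ fresh D) (sym dead₂) (subst (v ∈_) pool₁ (Passed.sub passed v∈))
      truth : Truth (⟦ bigE ⟧ ρ M₂) ((1 + k) * (1 + k) < ∣ pool M₂ ∣)
      truth = truth-map (subst₂ _<_ (sumTo-const (suc k) (suc k)) (slice-size (M₂ 2)))
                        (subst₂ _<_ (sym (sumTo-const (suc k) (suc k))) (sym (slice-size (M₂ 2))))
                        (truth-≤ (suc (sumTo (suc k) (λ _ → suc k))) (sumTo n (b2n ∘ M₂ 2)))
      finish : ∀ {M₃} → ((1 + k) * (1 + k) < ∣ pool M₂ ∣ × M₃ ≡ killC 0 M₂) ⊎ (¬ (1 + k) * (1 + k) < ∣ pool M₂ ∣ × M₃ ≡ M₂) →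
        Killed M M₃ × (∣ fresh (dead M₃) ∣ ≤ bound r k ⊎ ∣ fresh (dead M₃) ∣ < ∣ fresh (dead M) ∣) ×
        ∣ fresh (dead M₃) ∣ ≤ ∣ fresh (dead M) ∣
      finish (inj₁ (many , refl)) with kill-first {M₂} {j} (Passed.inputs passed) stable W⊆ many
      ... | killed , lt = record
          { inputs = Killed.inputs killed
          ; off    = λ a≢1 a≢2 q → trans (Killed.off killed a≢1 a≢2 q) (off₂ a≢2 q)
          ; path   = Killed.path killed ∘ subst (λ D → Star (Step D) source target) (sym dead₂)
          ; live   = Killed.live killed ∘ subst (λ D → Live D source) (sym dead₂)
          } , inj₂ lt′ , <⇒≤ lt′
        where
        lt′ = subst (λ D → ∣ fresh (dead (killC 0 M₂)) ∣ < ∣ fresh D ∣) dead₂ lt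
      finish (inj₂ (few , refl)) = record
          { inputs = Passed.inputs passed
          ; off    = λ _ → off₂
          ; path   = subst (λ D → Star (Step D) source target) (sym dead₂)
          ; live   = subst (λ D → Live D source) (sym dead₂)
          -- The thinning began with the set of all fresh vertices; as it ended with a small set,
          -- that whole set obeys the bound.
          } , inj₁ (subst (λ D → ∣ D ∣ ≤ bound r k) (trans pool₁ (cong fresh (sym dead₂)))
                     (thin-end (Passed.thin passed (thin-start (pool M₁))) (≮⇒≥ few)))
            , ≤-reflexive (cong (∣_∣ ∘ fresh) dead₂)

    round-correct : ∀ {M} j → Inputs I M → let M′ = ⟪ roundC ⟫ (j ∷ big ∷ n ∷ k ∷ []) M in
      Killed M M′ × (∣ fresh (dead M′) ∣ ≤ bound r k ⊎ ∣ fresh (dead M′) ∣ < ∣ fresh (dead M) ∣) ×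
      ∣ fresh (dead M′) ∣ ≤ ∣ fresh (dead M) ∣
    round-correct {M} j i = round-end {M} {M₁} {M₂} {j} filled (passes-correct j (inputs-cong (proj₁ filled (λ ())) i))
      where
      M₁ M₂ : Mem
      M₁ = ⟪ fill poolA v2 freshE ⟫ (j ∷ big ∷ n ∷ k ∷ []) M
      M₂ = forTo n (λ p → passM p j) M₁
      filled : OffPool M M₁ × pool M₁ ≡ fresh (dead M)
      filled = pool-fresh {M} {j} i

    -- Source and target contribute `k` vertices each.
    ∁-bound : ∀ D → ∣ fresh D ∣ ≤ bound r k → ∣ ∁ D ∣ ≤ bound r k + (k + k)
    ∁-bound D le = ≤-trans (cover (∁ D) (fresh D) (source ∪ target) split)
      (+-mono-≤ le (≤-trans (cover (source ∪ target) source target λ x x∈ → x∈p∪q⁻ source target x∈)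
                   (≤-reflexive (cong₂ _+_ source-size target-size))))
      where
      split : ∀ x → x ∈ ∁ D → x ∈ fresh D ⊎ x ∈ source ∪ target
      split x x∈ with x ∈? source | x ∈? target
      ... | yes x∈s | _       = inj₂ (x∈p∪q⁺ (inj₁ x∈s))
      ... | no _    | yes x∈t = inj₂ (x∈p∪q⁺ (inj₂ x∈t))
      ... | no x∉s  | no x∉t  = inj₁ (fresh⁺ (x∈∁p⇒x∉p x∈) x∉s x∉t)

    -- Each of the `n` rounds deletes a fresh vertex or certifies the bound, which later deletions
    -- preserve. For paths only this direction is stated: the search will use moves of the original
    -- reconfiguration graph, so its findings are genuine anyway.
    kernel-correct : ∀ {M} → Inputs I M → (∀ v → M 1 v ≡ false) → let M′ = ⟪ kernelC ⟫ (big ∷ n ∷ k ∷ []) M in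
      Inputs I M′ × (∀ {a} → a ≢ 1 → a ≢ 2 → M′ a ≗ M a) × ∣ ∁ (dead M′) ∣ ≤ bound r k + (k + k) ×
      (Star _~_ source target → Star (Step (dead M′)) source target) × Live (dead M′) source
    kernel-correct {M} i none = finish (forTo-invariant Inv n step {M} start)
      where
      Inv : ℕ → Mem → Set
      Inv l M₁ = Killed M M₁ × (∣ fresh (dead M₁) ∣ ≤ bound r k ⊎ ∣ fresh (dead M₁) ∣ ≤ l)
      start : Inv n M
      start = record { inputs = i ; off = λ _ _ _ → refl ; path = id ; live = id } , inj₂ (∣p∣≤n (fresh (dead M)))
      step : ∀ j M₁ → j < n → Inv (suc j) M₁ → Inv j (⟪ roundC ⟫ (j ∷ big ∷ n ∷ k ∷ []) M₁)
      step j M₁ _ (ks , state) with round-correct j (Killed.inputs ks)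
      ... | killed , progress , le = record
          { inputs = Killed.inputs killed
          ; off    = λ a≢1 a≢2 q → trans (Killed.off killed a≢1 a≢2 q) (Killed.off ks a≢1 a≢2 q)
          ; path   = Killed.path killed ∘ Killed.path ks
          ; live   = λ l → Killed.live killed (Killed.live ks l)
          } , next state progress
        where
        M₂ = ⟪ roundC ⟫ (j ∷ big ∷ n ∷ k ∷ []) M₁
        next : ∣ fresh (dead M₁) ∣ ≤ bound r k ⊎ ∣ fresh (dead M₁) ∣ ≤ suc j →
               ∣ fresh (dead M₂) ∣ ≤ bound r k ⊎ ∣ fresh (dead M₂) ∣ < ∣ fresh (dead M₁) ∣ →
               ∣ fresh (dead M₂) ∣ ≤ bound r k ⊎ ∣ fresh (dead M₂) ∣ ≤ j
        next _           (inj₁ small) = inj₁ small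
        next (inj₁ small) (inj₂ _)    = inj₁ (≤-trans le small)
        next (inj₂ ≤j)   (inj₂ lt)    = inj₂ (s≤s⁻¹ (≤-trans lt ≤j))
      nothing-dead : ∀ v → v ∉ dead M
      nothing-dead v v∈ = contradiction (trans (sym (none (toℕ v))) (∈slice⁻ (M 1) v v∈)) λ ()
      finish : ∀ {M₁} → Inv 0 M₁ → Inputs I M₁ × (∀ {a} → a ≢ 1 → a ≢ 2 → M₁ a ≗ M a) ×
        ∣ ∁ (dead M₁) ∣ ≤ bound r k + (k + k) × (Star _~_ source target → Star (Step (dead M₁)) source target) ×
        Live (dead M₁) source
      finish {M₁} (ks , state) = Killed.inputs ks , Killed.off ks , ∁-bound (dead M₁) (small state) ,
        (λ path → Killed.path ks (Star.map (λ st → st , (λ u _ → nothing-dead u) , (λ u _ → nothing-dead u)) path)) ,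
        Killed.live ks (λ u _ → nothing-dead u)
        where
        small : ∣ fresh (dead M₁) ∣ ≤ bound r k ⊎ ∣ fresh (dead M₁) ∣ ≤ 0 → ∣ fresh (dead M₁) ∣ ≤ bound r k
        small (inj₁ le) = le
        small (inj₂ le) = ≤-trans le z≤n

-- A table of all subsets of the kernel

module SubsetTable where

  open TapePrograms
  open Language
  open TruthValues
  open Kernelization using (v0; v1; v2; v3; v4; v5; inputA; deadA; poolA; tableA; unaryA; reachedA)
  open import Data.Bool.Base using (Bool; true; false; not)
  open import Data.Nat.Base
  open import Data.Nat.DivMod using (_%_; [m+kn]%n≡m%n; m<n⇒m%n≡m)
  open import Data.Nat.Properties
  open import Data.Product.Base using (∃-syntax; _×_; _,_; proj₁; proj₂)
  open import Data.Sum.Base using (_⊎_; inj₁; inj₂)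
  open import Data.Vec.Base as Vec using (Vec; []; _∷_)
  open import Function.Base using (_∘_)
  open import Relation.Binary.PropositionalEquality
  open import Relation.Nullary.Negation using (contradiction)

  -- Environment d , _ , v , a , N , n , k: the number d kept in unary loses its last bit,
  -- which decides whether row a contains v.
  halfE : Exp 7
  halfE = sum v0 (suc v0 ⊕ suc v0 ≤ₑ v1)

  splitC : Cmd 7
  splitC = tableA [ v3 ⊗ v5 ⊕ v2 ]:= v0 ⊖ (halfE ⊕ halfE)
         ⨾ fill unaryA v4 (v0 <ₑ wk halfE)

  -- Environment v , a , N , n , k.
  cellC : Cmd 5
  cellC = for (¬ₑ (deadA ! v0)) (bind (sum v3 (unaryA ! v0)) splitC)

  -- Environment a , N , n , k.
  rowC : Cmd 4
  rowC = fill unaryA v1 (v0 <ₑ v1) ⨾ for v2 cellC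

  -- Environment N , n , k.
  tableC : Cmd 3
  tableC = for v0 rowC

  sumTo-below : ∀ m h (f : ℕ → ℕ) → h ≤ m → (∀ i → i < m → Truth (f i) (i < h)) → sumTo m f ≡ h
  sumTo-below zero zero f _ t = refl
  sumTo-below (suc m) h f h≤1+m t with m≤n⇒m<n∨m≡n h≤1+m
  ... | inj₁ (s≤s h≤m) with t m ≤-refl
  ...   | holds _ m<h = contradiction h≤m (<⇒≱ m<h)
  ...   | fails e _   = trans (cong (sumTo m f +_) e) (trans (+-identityʳ _)
                          (sumTo-below m h f h≤m λ i i<m → t i (m<n⇒m<1+n i<m)))
  sumTo-below (suc m) .(suc m) f _ t | inj₂ refl with t m ≤-refl
  ...   | fails _ m≮1+m = contradiction ≤-refl m≮1+m
  ...   | holds e _     = trans (cong₂ _+_ (sumTo-below m m f ≤-refl λ i i<m →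
                            truth-map (λ _ → i<m) m<n⇒m<1+n (t i (m<n⇒m<1+n i<m))) e) (+-comm m 1)

  b2n-<ᵇ : ∀ b → (0 <ᵇ b2n b) ≡ b
  b2n-<ᵇ true  = refl
  b2n-<ᵇ false = refl

  -- Division by 2 by counting: exactly `h` numbers `i` pass this test, whatever the last bit is.
  double≤ : ∀ h b i → Truth (1 ∸ ((suc i + suc i) ∸ (h + h + b2n b))) (i < h)
  double≤ h b i = truth-map to from (truth-≤ (suc i + suc i) (h + h + b2n b))
    where
    to : suc i + suc i ≤ h + h + b2n b → i < h
    to le = ≰⇒> λ h≤i → <⇒≱ (begin-strict
      h + h + b2n b ≤⟨ +-mono-≤ (+-mono-≤ h≤i h≤i) (b2n≤1 b) ⟩
      i + i + 1     ≡⟨ +-comm (i + i) 1 ⟩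
      suc i + i     <⟨ +-monoʳ-< (suc i) ≤-refl ⟩
      suc i + suc i ∎) le
      where open ≤-Reasoning
    from : i < h → suc i + suc i ≤ h + h + b2n b
    from i<h = ≤-trans (+-mono-≤ i<h i<h) (m≤m+n (h + h) _)

  module Table (N n k : ℕ) where

    env : ℕ → ℕ → ℕ → ℕ → Vec ℕ 7
    env d c v a = d ∷ c ∷ v ∷ a ∷ N ∷ n ∷ k ∷ []

    Unary : Mem → ℕ → Set
    Unary M d = d ≤ N × ∀ i → i < N → (M 4 i ≡ true → i < d) × (i < d → M 4 i ≡ true)

    Frame : ℕ → ℕ → Mem → Mem → Set
    Frame a v M M′ = (∀ {b} → b ≢ 3 → b ≢ 4 → M′ b ≗ M b) × (∀ q → q ≢ a * n + v → M′ 3 q ≡ M 3 q)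

    frame-refl : ∀ {a v M} → Frame a v M M
    frame-refl = (λ _ _ _ → refl) , (λ _ _ → refl)

    half-correct : ∀ {h b c v a M} → ⟦ halfE ⟧ (env (h + h + b2n b) c v a) M ≡ h
    half-correct {h} {b} = sumTo-below (h + h + b2n b) h _ (≤-trans (m≤m+n h h) (m≤m+n (h + h) _)) λ i _ → double≤ h b i

    split-frame : ∀ d c v a M → Frame a v M (⟪ splitC ⟫ (env d c v a) M)
    split-frame d c v a M = go refl (filled d)
      where
      M₁ = ⟪ tableA [ v3 ⊗ v5 ⊕ v2 ]:= v0 ⊖ (halfE ⊕ halfE) ⟫ (env d c v a) M
      filled : ∀ d → Filled 4 N (_< ⟦ halfE ⟧ (env d c v a) M) M₁ (⟪ fill unaryA v4 (v0 <ₑ wk halfE) ⟫ (env d c v a) M₁)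
      filled d = fill-correct 4 N _ _ M₁ λ j M′ _ _ _ → truth-≤ (suc j) (⟦ halfE ⟧ (env d c v a) M)
      go : ∀ {x M′} → x ≡ sumTo a (λ _ → n) + v → Filled 4 N (_< ⟦ halfE ⟧ (env d c v a) M) (set M 3 x (0 <ᵇ (d ∸ (⟦ halfE ⟧ (env d c v a) M + ⟦ halfE ⟧ (env d c v a) M)))) M′ → Frame a v M M′
      go {x} {M′} eq f = (λ b≢3 b≢4 q → trans (Filled.off f b≢4 q) (set-array M 3 x _ b≢3 q)) ,
        λ q q≢ → trans (Filled.off f (λ ()) q) (set-index M 3 x _ λ q≡x → q≢ (trans q≡x (trans eq (cong (_+ v) (sumTo-const a n)))))

    split-correct : ∀ {h b c v a M} → h ≤ N → let M′ = ⟪ splitC ⟫ (env (h + h + b2n b) c v a) M in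
      Unary M′ h × M′ 3 (a * n + v) ≡ b
    split-correct {h} {b} {c} {v} {a} {M} h≤N = go refl filled
      where
      d = h + h + b2n b
      ρ = env d c v a
      M₁ = ⟪ tableA [ v3 ⊗ v5 ⊕ v2 ]:= v0 ⊖ (halfE ⊕ halfE) ⟫ ρ M
      half≡ : ⟦ halfE ⟧ ρ M ≡ h
      half≡ = half-correct {h} {b} {c} {v} {a} {M}
      filled : Filled 4 N (_< h) M₁ (⟪ fill unaryA v4 (v0 <ₑ wk halfE) ⟫ ρ M₁)
      filled = fill-correct 4 N _ _ M₁ λ j M′ _ _ _ →
        truth-map (λ lt → ≤-trans lt (≤-reflexive half≡)) (λ lt → ≤-trans lt (≤-reflexive (sym half≡))) (truth-≤ (suc j) (⟦ halfE ⟧ ρ M))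
      stored : (0 <ᵇ (d ∸ (⟦ halfE ⟧ ρ M + ⟦ halfE ⟧ ρ M))) ≡ b
      stored = trans (cong (λ z → 0 <ᵇ (d ∸ (z + z))) half≡) (trans (cong (0 <ᵇ_) (m+n∸m≡n (h + h) (b2n b))) (b2n-<ᵇ b))
      go : ∀ {x M′} → x ≡ sumTo a (λ _ → n) + v →
        Filled 4 N (_< h) (set M 3 x (0 <ᵇ (d ∸ (⟦ halfE ⟧ ρ M + ⟦ halfE ⟧ ρ M)))) M′ →
        Unary M′ h × M′ 3 (a * n + v) ≡ b
      go {x} {M′} eq f = (h≤N , λ i i<N → Filled.on⁻ f i i<N , Filled.on⁺ f i i<N) ,
        trans (cong (M′ 3) (trans (cong (_+ v) (sym (sumTo-const a n))) (sym eq)))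
              (trans (Filled.off f (λ ()) x) (trans (set-at M 3 x _) stored))

    unary-value : ∀ {M d} → Unary M d → sumTo N (b2n ∘ M 4) ≡ d
    unary-value {M} {d} (d≤N , u) = sumTo-below N d _ d≤N λ i i<N → truth-map (proj₁ (u i i<N)) (proj₂ (u i i<N)) (truth-read (M 4 i))

    cell : ℕ → ℕ → Mem → Mem
    cell a v = ⟪ cellC ⟫ (v ∷ a ∷ N ∷ n ∷ k ∷ [])

    cell-cases : ∀ a v M → (M 1 v ≡ true × cell a v M ≡ M) ⊎
      (M 1 v ≡ false × cell a v M ≡ ⟪ splitC ⟫ (env (sumTo N (b2n ∘ M 4)) 0 v a) M)
    cell-cases a v M with M 1 v
    ... | true  = inj₁ (refl , refl)
    ... | false = inj₂ (refl , refl)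

    cell-frame : ∀ a v M → Frame a v M (cell a v M)
    cell-frame a v M with cell-cases a v M
    ... | inj₁ (_ , eq) = subst (Frame a v M) (sym eq) (frame-refl {a} {v} {M})
    ... | inj₂ (_ , eq) = subst (Frame a v M) (sym eq) (split-frame (sumTo N (b2n ∘ M 4)) 0 v a M)

    module Code (dead : ℕ → Bool) (X : ℕ → Bool) where

      -- The row number whose bits spell out `X` on the live vertices. The cells of a row are
      -- treated from the highest vertex down, so the highest live vertex gets the last bit. Deleted
      -- vertices get no bit, which keeps the code below 2 ^ live.
      code live : ℕ → ℕ
      code zero    = 0
      code (suc l) with dead l
      ... | true  = code l
      ... | false = code l + code l + b2n (X l)
      live l = sumTo l (b2n ∘ not ∘ dead)

      code< : ∀ l → code l < 2 ^ live l
      code< zero = s≤s z≤n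
      code< (suc l) with dead l
      ... | true  = ≤-trans (code< l) (≤-reflexive (cong (2 ^_) (sym (+-identityʳ (live l)))))
      ... | false = ≤-trans (s≤s (+-monoʳ-≤ (code l + code l) (b2n≤1 (X l)))) (begin
        suc (code l + code l + 1)             ≡⟨ cong suc (+-comm (code l + code l) 1) ⟩
        suc (suc (code l + code l))           ≡⟨ cong suc (+-suc (code l) (code l)) ⟨
        suc (code l) + suc (code l)           ≤⟨ +-mono-≤ (code< l) (code< l) ⟩
        2 ^ live l + 2 ^ live l               ≡⟨ cong (2 ^ live l +_) (+-identityʳ _) ⟨
        2 ^ suc (live l)                      ≡⟨ cong (2 ^_) (+-comm 1 (live l)) ⟩
        2 ^ (live l + 1)                      ∎)
        where open ≤-Reasoning

      cell-correct : ∀ a l M → M 1 ≗ dead → Unary M (code (suc l)) →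
        Unary (cell a l M) (code l) × (dead l ≡ false → cell a l M 3 (a * n + l) ≡ X l)
      cell-correct a l M dead≗ u with dead l in dl | cell-cases a l M
      ... | true  | inj₁ (_ , eq) = subst (λ M → Unary M (code l)) (sym eq) u , λ ()
      ... | true  | inj₂ (e , _)  = contradiction (trans (sym e) (trans (dead≗ l) dl)) λ ()
      ... | false | inj₁ (e , _)  = contradiction (trans (sym e) (trans (dead≗ l) dl)) λ ()
      ... | false | inj₂ (_ , eq) = proj₁ both , λ _ → proj₂ both
        where
        both : Unary (cell a l M) (code l) × cell a l M 3 (a * n + l) ≡ X l
        both = subst (λ M → Unary M (code l) × M 3 (a * n + l) ≡ X l)
          (sym (trans eq (cong (λ d → ⟪ splitC ⟫ (env d 0 l a) M) (unary-value {M} u))))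
          (split-correct {code l} {X l} {0} {l} {a} {M} (≤-trans (≤-trans (m≤m+n (code l) (code l)) (m≤m+n _ _)) (proj₁ u)))

      row-correct : ∀ a l M → l ≤ n → M 1 ≗ dead → Unary M (code l) →
        let M′ = forTo l (cell a) M in
        (∀ {b} → b ≢ 3 → b ≢ 4 → M′ b ≗ M b) × (∀ v → v < l → dead v ≡ false → M′ 3 (a * n + v) ≡ X v) ×
        (∀ v → l ≤ v → M′ 3 (a * n + v) ≡ M 3 (a * n + v))
      row-correct a zero M _ _ _ = (λ _ _ _ → refl) , (λ _ ()) , (λ _ _ → refl)
      row-correct a (suc l) M l<n dead≗ u
        with row-correct a l (cell a l M) (<⇒≤ l<n) (λ q → trans (proj₁ (cell-frame a l M) (λ ()) (λ ()) q) (dead≗ q)) (proj₁ (cell-correct a l M dead≗ u))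
      ... | off , on , above = off′ , on′ , above′
        where
        M₁ = cell a l M
        M′ = forTo l (cell a) M₁
        off′ : ∀ {b} → b ≢ 3 → b ≢ 4 → M′ b ≗ M b
        off′ b≢3 b≢4 q = trans (off b≢3 b≢4 q) (proj₁ (cell-frame a l M) b≢3 b≢4 q)
        on′ : ∀ v → v < suc l → dead v ≡ false → M′ 3 (a * n + v) ≡ X v
        on′ v (s≤s v≤l) alive with m≤n⇒m<n∨m≡n v≤l
        ... | inj₁ v<l  = on v v<l alive
        ... | inj₂ refl = trans (above l ≤-refl) (proj₂ (cell-correct a l M dead≗ u) alive)
        above′ : ∀ v → suc l ≤ v → M′ 3 (a * n + v) ≡ M 3 (a * n + v)
        above′ v l<v = trans (above v (<⇒≤ l<v))
          (proj₂ (cell-frame a l M) (a * n + v) λ e → <⇒≢ l<v (sym (+-cancelˡ-≡ (a * n) v l e)))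

    row : ℕ → Mem → Mem
    row a = ⟪ rowC ⟫ (a ∷ N ∷ n ∷ k ∷ [])

    row-start : ∀ a M → Filled 4 N (_< a) M (⟪ fill unaryA v1 (v0 <ₑ v1) ⟫ (a ∷ N ∷ n ∷ k ∷ []) M)
    row-start a M = fill-correct 4 N _ _ M λ j M′ _ _ _ → truth-≤ (suc j) a

    cells-frame : ∀ a l M → let M′ = forTo l (cell a) M in
      (∀ {b} → b ≢ 3 → b ≢ 4 → M′ b ≗ M b) × (∀ q → (∀ v → v < l → q ≢ a * n + v) → M′ 3 q ≡ M 3 q)
    cells-frame a zero    M = (λ _ _ _ → refl) , (λ _ _ → refl)
    cells-frame a (suc l) M with cells-frame a l (cell a l M)
    ... | off , on = (λ b≢3 b≢4 q → trans (off b≢3 b≢4 q) (proj₁ (cell-frame a l M) b≢3 b≢4 q)) ,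
      λ q away → trans (on q λ v v<l → away v (m<n⇒m<1+n v<l)) (proj₂ (cell-frame a l M) q (away l ≤-refl))

    row-frame : ∀ a M → (∀ {b} → b ≢ 3 → b ≢ 4 → row a M b ≗ M b) ×
      (∀ q → (∀ v → v < n → q ≢ a * n + v) → row a M 3 q ≡ M 3 q)
    row-frame a M = go (row-start a M)
      where
      go : ∀ {M₁} → Filled 4 N (_< a) M M₁ → let M′ = forTo n (cell a) M₁ in
        (∀ {b} → b ≢ 3 → b ≢ 4 → M′ b ≗ M b) × (∀ q → (∀ v → v < n → q ≢ a * n + v) → M′ 3 q ≡ M 3 q)
      go {M₁} f with cells-frame a n M₁
      ... | off , on = (λ b≢3 b≢4 q → trans (off b≢3 b≢4 q) (Filled.off f b≢4 q)) ,
        λ q away → trans (on q away) (Filled.off f (λ ()) q)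

    -- The remainder modulo `n` recovers the column. This keeps the rows from overwriting each
    -- other.
    index-injective : ∀ {a a′ v v′} → v < n → v′ < n → a * n + v ≡ a′ * n + v′ → a ≡ a′
    index-injective {a} {a′} {v} {v′} v<n v′<n e = *-cancelʳ-≡ a a′ n
      (+-cancelʳ-≡ v (a * n) (a′ * n) (trans e (cong (a′ * n +_) (sym v≡v′))))
      where
      instance
        n≢0 : NonZero n
        n≢0 = >-nonZero (≤-trans (s≤s z≤n) v<n)
      residue : ∀ a {v} → v < n → (a * n + v) % n ≡ v
      residue a {v} v<n = trans (cong (_% n) (+-comm (a * n) v)) (trans ([m+kn]%n≡m%n v a n) (m<n⇒m%n≡m v<n))
      v≡v′ : v ≡ v′
      v≡v′ = trans (sym (residue a v<n)) (trans (cong (_% n) e) (residue a′ v′<n))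

    table : Mem → Mem
    table = ⟪ tableC ⟫ (N ∷ n ∷ k ∷ [])

    table-frame : ∀ M {b} → b ≢ 3 → b ≢ 4 → table M b ≗ M b
    table-frame M = forTo-invariant (λ _ M₁ → ∀ {b} → b ≢ 3 → b ≢ 4 → M₁ b ≗ M b) N
      (λ a M₁ _ same b≢3 b≢4 q → trans (proj₁ (row-frame a M₁) b≢3 b≢4 q) (same b≢3 b≢4 q)) {M} (λ _ _ _ → refl)

    -- The row sought is `code n`. Nothing is claimed about its entries at deleted vertices, where
    -- `X` is not encoded.
    table-correct : ∀ M → 2 ^ sumTo n (b2n ∘ not ∘ M 1) ≤ N → (X : ℕ → Bool) →
      ∃[ a ] (a < N × ∀ v → v < n → M 1 v ≡ false → table M 3 (a * n + v) ≡ X v)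
    table-correct M big X = code n , c<N , λ v v<n alive →
      proj₂ (forTo-invariant Inv N step {M} ((λ _ → refl) , λ N≤c → contradiction N≤c (<⇒≱ c<N))) z≤n v v<n alive
      where
      open Code (M 1) X
      c<N : code n < N
      c<N = ≤-trans (code< n) big
      Inv : ℕ → Mem → Set
      Inv l M₁ = M₁ 1 ≗ M 1 × (l ≤ code n → ∀ v → v < n → M 1 v ≡ false → M₁ 3 (code n * n + v) ≡ X v)
      step : ∀ a M₁ → a < N → Inv (suc a) M₁ → Inv a (row a M₁)
      step a M₁ a<N (same , done) = (λ q → trans (proj₁ (row-frame a M₁) (λ ()) (λ ()) q) (same q)) , at
        where
        here : ∀ {M₂} → a ≡ code n → Filled 4 N (_< a) M₁ M₂ →
          ∀ v → v < n → M 1 v ≡ false → forTo n (cell a) M₂ 3 (a * n + v) ≡ X v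
        here {M₂} refl f = proj₁ (proj₂ (row-correct a n M₂ ≤-refl (λ q → trans (Filled.off f (λ ()) q) (same q))
          (<⇒≤ a<N , λ i i<N → Filled.on⁻ f i i<N , Filled.on⁺ f i i<N)))
        at : a ≤ code n → ∀ v → v < n → M 1 v ≡ false → row a M₁ 3 (code n * n + v) ≡ X v
        at a≤c v v<n alive with m≤n⇒m<n∨m≡n a≤c
        ... | inj₁ a<c = trans (proj₂ (row-frame a M₁) _ λ v′ v′<n e → <⇒≢ a<c (sym (index-injective v<n v′<n e)))
                               (done a<c v v<n alive)
        ... | inj₂ a≡c = subst (λ c → row a M₁ 3 (c * n + v) ≡ X v) a≡c (here a≡c (row-start a M₁) v v<n alive)

-- Searching the reconfiguration graph on the rows of the table

module Exploration where

  open TapePrograms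
  open Language
  open TokenReplacement
  open TruthValues
  open Kernelization
  open import Data.Bool.Base using (Bool; true; false; not; _xor_; _∧_)
  open import Data.Bool.Properties as Boolₚ using ()
  open import Data.Fin.Base as Fin using (Fin; toℕ; fromℕ<)
  open import Data.Fin.Properties as Finₚ using (toℕ<n; toℕ-fromℕ<; toℕ-injective)
  open import Data.Fin.Subset using (Subset; _∈_; _∉_; ∣_∣; _⊆_)
  open import Data.Fin.Subset.Properties using (_∈?_; ∣p∣≤n; ∣p∣≡n⇒p≡⊤; ∈⊤)
  open import Data.Nat.Base
  open import Data.Nat.Properties
  open import Data.Product.Base using (∃-syntax; _×_; _,_)
  open import Data.Sum.Base using (_⊎_; inj₁; inj₂)
  open import Data.Vec.Base as Vec using (Vec; []; _∷_)
  open import Data.Vec.Properties using ([]=⇒lookup; lookup⇒[]=; lookup-zipWith)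
  open import Function.Base using (_∘_; id)
  open import Relation.Binary.Construct.Closure.ReflexiveTransitive as Star using (Star; ε; _◅_; _◅◅_)
  open import Relation.Binary.PropositionalEquality
  open import Relation.Nullary.Decidable using (yes; no)
  open import Relation.Nullary.Negation using (¬_; contradiction)

  iffE xorE : ∀ {m} → Exp m → Exp m → Exp m
  iffE x y = (x ∧ₑ y) ∨ₑ ((¬ₑ x) ∧ₑ (¬ₑ y))
  xorE x y = (x ∧ₑ (¬ₑ y)) ∨ₑ ((¬ₑ x) ∧ₑ y)

  -- The table is not written at deleted vertices, so they are masked.
  memberE : ∀ {m} → Exp m → Exp m → Exp m → Exp m
  memberE n a v = (¬ₑ (deadA ! v)) ∧ₑ (tableA ! (a ⊗ n ⊕ v))

  sizeE independentE : ∀ {m} → Exp m → Exp m → Exp m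
  sizeE n a = sum n (memberE (wk n) (wk a) v0)
  independentE n a = allₑ n (allₑ (wk n)
    (¬ₑ (memberE (wk (wk n)) (wk (wk a)) v1 ∧ₑ (memberE (wk (wk n)) (wk (wk a)) v0 ∧ₑ edgeE (wk (wk n)) v1 v0))))

  nodeE : ∀ {m} → Exp m → Exp m → Exp m → Exp m
  nodeE n k a = independentE n a ∧ₑ ((sizeE n a =ₑ k ⊖ lit 1) ∨ₑ (sizeE n a =ₑ k))

  stepE : ∀ {m} → Exp m → Exp m → Exp m → Exp m → Exp m
  stepE n k a b = nodeE n k a ∧ₑ (nodeE n k b ∧ₑ
    (sum n (xorE (memberE (wk n) (wk a) v0) (memberE (wk n) (wk b) v0)) =ₑ lit 1))

  -- Environment b , a , round , N , n , k.
  relaxE : Exp 6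
  relaxE = (reachedA ! v0) ∨ₑ ((reachedA ! v1) ∧ₑ stepE v4 v5 v1 v0)

  relaxC : Cmd 6
  relaxC = reachedA [ v0 ]:= relaxE

  -- Environment N , n , k.
  reachC : Cmd 3
  reachC = fill reachedA v0 (allₑ v2 (iffE (memberE v3 v1 v0) (sourceE v3 v0)))
         ⨾ for v0 (for v1 (for v2 relaxC))

  answerE : Exp 3
  answerE = anyₑ v0 ((reachedA ! v0) ∧ₑ allₑ v2 (iffE (memberE v3 v1 v0) (targetE v3 v0)))

  truth-iff : ∀ {x y P Q} → Truth x P → Truth y Q →
    Truth (1 ∸ (1 ∸ (sumTo x (λ _ → y) + sumTo (1 ∸ x) (λ _ → 1 ∸ y)))) ((P × Q) ⊎ (¬ P × ¬ Q))
  truth-iff p q = truth-or (truth-and p q) (truth-and (truth-not p) (truth-not q))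

  truth-xor : ∀ {x y P Q} → Truth x P → Truth y Q →
    Truth (1 ∸ (1 ∸ (sumTo x (λ _ → 1 ∸ y) + sumTo (1 ∸ x) (λ _ → y)))) ((P × ¬ Q) ⊎ (¬ P × Q))
  truth-xor p q = truth-or (truth-and p (truth-not q)) (truth-and (truth-not p) q)

  ∈△⁺ : ∀ {n} {A B : Subset n} {v} → (v ∈ A × v ∉ B) ⊎ (v ∉ A × v ∈ B) → v ∈ A △ B
  ∈△⁺ {A = A} {B} {v} (inj₁ (a , b)) = lookup⇒[]= v (A △ B)
    (trans (lookup-zipWith _xor_ v A B) (cong₂ _xor_ ([]=⇒lookup a) (∉⇒lookup b)))
  ∈△⁺ {A = A} {B} {v} (inj₂ (a , b)) = lookup⇒[]= v (A △ B)
    (trans (lookup-zipWith _xor_ v A B) (cong₂ _xor_ (∉⇒lookup a) ([]=⇒lookup b)))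

  ∈△⁻ : ∀ {n} {A B : Subset n} {v} → v ∈ A △ B → (v ∈ A × v ∉ B) ⊎ (v ∉ A × v ∈ B)
  ∈△⁻ {A = A} {B} {v} v∈ with v ∈? A | v ∈? B
  ... | yes a | no b  = inj₁ (a , b)
  ... | no a  | yes b = inj₂ (a , b)
  ... | yes a | yes b = contradiction (trans (sym ([]=⇒lookup v∈)) (trans (lookup-zipWith _xor_ v A B) (cong₂ _xor_ ([]=⇒lookup a) ([]=⇒lookup b)))) λ ()
  ... | no a  | no b  = contradiction (trans (sym ([]=⇒lookup v∈)) (trans (lookup-zipWith _xor_ v A B) (cong₂ _xor_ (∉⇒lookup a) (∉⇒lookup b)))) λ ()

  module Reach (I : ISRInstance) (r : ℕ)
    (biclique-free : ∀ (A B : Subset (Graph.order (ISRInstance.graph I))) →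
      (∀ a b → a ∈ A → b ∈ B → Graph.Adjacent (ISRInstance.graph I) a b) → r < ∣ A ∣ → ¬ r < ∣ B ∣)
    (N : ℕ) where

    open ISRInstance I
    open Graph graph using (Vertex; Adjacent; adj) renaming (order to n)
    open ReconfigurationGraph graph k
    open Reduction I r biclique-free N using (truth-edge; truth-source; truth-target; truth-slice; slice-size; below; inputs-cong)

    contains : Mem → ℕ → ℕ → Bool
    contains M a v = not (M 1 v) ∧ M 3 (a * n + v)

    row : Mem → ℕ → Subset n
    row M a = slice (contains M a)

    row-cong : ∀ {M M′} → M′ 1 ≗ M 1 → M′ 3 ≗ M 3 → ∀ a → row M′ a ≡ row M a
    row-cong d t a = slice-cong λ v → cong₂ (λ x y → not x ∧ y) (d v) (t (a * n + v))

    truth-member : ∀ M a (v : Vertex) →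
      Truth (sumTo (1 ∸ b2n (M 1 (toℕ v))) (λ _ → b2n (M 3 (sumTo a (λ _ → n) + toℕ v)))) (v ∈ row M a)
    truth-member M a v rewrite sumTo-const a n = truth-map
      (λ (alive , t) → ∈slice⁺ (contains M a) v (both alive t))
      (λ v∈ → split (∈slice⁻ (contains M a) v v∈))
      (truth-and (truth-not (truth-read (M 1 (toℕ v)))) (truth-read (M 3 (a * n + toℕ v))))
      where
      both : ∀ {x y} → ¬ x ≡ true → y ≡ true → not x ∧ y ≡ true
      both {true}  ¬x _    = contradiction refl ¬x
      both {false} ¬x refl = refl
      split : ∀ {x y} → not x ∧ y ≡ true → ¬ x ≡ true × y ≡ true
      split {false} {true} _ = (λ ()) , refl

    truth-vertices : ∀ {f : ℕ → ℕ} {P : Vertex → Set} → (∀ v → Truth (f (toℕ v)) (P v)) →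
      Truth (1 ∸ sumTo n (λ j → 1 ∸ f j)) (∀ v → P v)
    truth-vertices {f} {P} h = truth-map
      (λ all v → all (toℕ v) (toℕ<n v) v refl)
      (λ all j _ v _ → all v)
      (truth-all n {f} {λ j → ∀ v → toℕ v ≡ j → P v}
        (below {λ j → Truth (f j) (∀ v → toℕ v ≡ j → P v)} λ v →
          truth-map (λ p u e → subst P (sym (toℕ-injective e)) p) (λ all → all v refl) (h v)))

    memberV : Mem → ℕ → ℕ → ℕ
    memberV M a v = sumTo (1 ∸ b2n (M 1 v)) (λ _ → b2n (M 3 (sumTo a (λ _ → n) + v)))

    iffV : (ℕ → ℕ) → (ℕ → ℕ) → ℕ → ℕ
    iffV f g v = 1 ∸ (1 ∸ (sumTo (f v) (λ _ → g v) + sumTo (1 ∸ f v) (λ _ → 1 ∸ g v)))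

    truth-≡-row : ∀ M a {f : ℕ → ℕ} (A : Subset n) → (∀ v → Truth (f (toℕ v)) (v ∈ A)) →
      Truth (1 ∸ sumTo n (λ v → 1 ∸ iffV (memberV M a) f v)) (row M a ≡ A)
    truth-≡-row M a {f} A h = truth-map
      (λ all → ∈-≡ (λ v v∈ → to (all v) v∈) (λ v v∈ → from (all v) v∈))
      (λ { refl v → same v })
      (truth-vertices {iffV (memberV M a) f} λ v → truth-iff (truth-member M a v) (h v))
      where
      to : ∀ {P Q : Set} → (P × Q) ⊎ (¬ P × ¬ Q) → P → Q
      to (inj₁ (_ , q)) _  = q
      to (inj₂ (¬p , _)) p = contradiction p ¬p
      from : ∀ {P Q : Set} → (P × Q) ⊎ (¬ P × ¬ Q) → Q → P
      from (inj₁ (p , _)) _  = p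
      from (inj₂ (_ , ¬q)) q = contradiction q ¬q
      same : ∀ v → (v ∈ row M a × v ∈ row M a) ⊎ (v ∉ row M a × v ∉ row M a)
      same v with v ∈? row M a
      ... | yes p = inj₁ (p , p)
      ... | no ¬p = inj₂ (¬p , ¬p)

    nodeV : Mem → ℕ → ℕ
    nodeV M a = ⟦ nodeE v1 v2 v0 ⟧ (a ∷ n ∷ k ∷ []) M

    truth-node : ∀ {M} → Inputs I M → ∀ a → Truth (nodeV M a) (IsNode (row M a))
    truth-node {M} i a = truth-and independent
      (truth-or (subst (λ s → Truth (sumTo (1 ∸ (sz ∸ (k ∸ 1))) (λ _ → 1 ∸ ((k ∸ 1) ∸ sz))) (s ≡ k ∸ 1)) sz≡ (truth-= sz (k ∸ 1)))
                (subst (λ s → Truth (sumTo (1 ∸ (sz ∸ k)) (λ _ → 1 ∸ (k ∸ sz))) (s ≡ k)) sz≡ (truth-= sz k)))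
      where
      sz = sumTo n (memberV M a)
      pair : ℕ → ℕ → ℕ
      pair u v = 1 ∸ sumTo (memberV M a u) (λ _ → sumTo (memberV M a v) (λ _ → b2n (M 0 (sumTo u (λ _ → n) + v))))
      sz≡ : sz ≡ ∣ row M a ∣
      sz≡ = truth-count (memberV M a) (row M a) (truth-member M a)
      independent : Truth (⟦ independentE v1 v0 ⟧ (a ∷ n ∷ k ∷ []) M) (Independent graph (row M a))
      independent = truth-map (λ h u v u∈ v∈ uv → h u v (u∈ , v∈ , uv)) (λ h u v (u∈ , v∈ , uv) → h u v u∈ v∈ uv)
        (truth-vertices {λ u → 1 ∸ sumTo n (λ v → 1 ∸ pair u v)} λ u → truth-vertices {pair (toℕ u)} λ v →
          truth-not (truth-and (truth-member M a u) (truth-and (truth-member M a v) (truth-edge i u v))))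

    stepV : Mem → ℕ → ℕ → ℕ
    stepV M a b = ⟦ stepE v2 v3 v1 v0 ⟧ (b ∷ a ∷ n ∷ k ∷ []) M

    truth-step : ∀ {M} → Inputs I M → ∀ a b → Truth (stepV M a b) (row M a ~ row M b)
    truth-step {M} i a b = truth-and (truth-node i a) (truth-and (truth-node i b)
      (subst (λ s → Truth (sumTo (1 ∸ (d ∸ 1)) (λ _ → 1 ∸ (1 ∸ d))) (s ≡ 1)) difference (truth-= d 1)))
      where
      x : ℕ → ℕ
      x v = 1 ∸ (1 ∸ (sumTo (memberV M a v) (λ _ → 1 ∸ memberV M b v) + sumTo (1 ∸ memberV M a v) (λ _ → memberV M b v)))
      d = sumTo n x
      difference : d ≡ ∣ row M a △ row M b ∣
      difference = truth-count x (row M a △ row M b) λ v →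
        truth-map ∈△⁺ ∈△⁻ (truth-xor (truth-member M a v) (truth-member M b v))

    reached : Mem → Subset N
    reached M = slice (M 5)

    Off5 : Mem → Mem → Set
    Off5 M M′ = ∀ {b} → b ≢ 5 → M′ b ≗ M b

    relax : ℕ → ℕ → ℕ → Mem → Mem
    relax j a b = ⟪ relaxC ⟫ (b ∷ a ∷ j ∷ N ∷ n ∷ k ∷ [])

    relax-correct : ∀ {M} j → Inputs I M → (a b : Fin N) → let M′ = relax j (toℕ a) (toℕ b) M in
      Off5 M M′ ×
      ((reached M′ ≡ reached M × (a ∈ reached M → row M (toℕ a) ~ row M (toℕ b) → b ∈ reached M)) ⊎
       (b ∉ reached M × reached M′ ≡ reached M +ₛ b × a ∈ reached M × row M (toℕ a) ~ row M (toℕ b)))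
    relax-correct {M} j i a b = finish truth refl
      where
      val = ⟦ relaxE ⟧ (toℕ b ∷ toℕ a ∷ j ∷ N ∷ n ∷ k ∷ []) M
      Fires : Set
      Fires = a ∈ reached M × row M (toℕ a) ~ row M (toℕ b)
      truthR : ∀ (c : Fin N) → Truth (b2n (M 5 (toℕ c))) (c ∈ reached M)
      truthR c = truth-map (∈slice⁺ (M 5) c) (∈slice⁻ (M 5) c) (truth-read (M 5 (toℕ c)))
      truth : Truth val (b ∈ reached M ⊎ Fires)
      truth = truth-or (truthR b) (truth-and (truthR a) (truth-step i (toℕ a) (toℕ b)))
      entry≡ : ∀ x {c : Fin N} → c ≢ b → set M 5 (toℕ b) x 5 (toℕ c) ≡ M 5 (toℕ c)
      entry≡ x c≢b = set-index M 5 (toℕ b) x (c≢b ∘ toℕ-injective)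
      added : reached (set M 5 (toℕ b) true) ≡ reached M +ₛ b
      added = ∈-≡ to from
        where
        to : ∀ c → c ∈ reached (set M 5 (toℕ b) true) → c ∈ reached M +ₛ b
        to c c∈ with c Finₚ.≟ b
        ... | yes refl = ∈-add (reached M) c
        ... | no c≢b   = ∈-add⁺ b (∈slice⁺ (M 5) c (trans (sym (entry≡ true c≢b)) (∈slice⁻ (set M 5 (toℕ b) true 5) c c∈)))
        from : ∀ c → c ∈ reached M +ₛ b → c ∈ reached (set M 5 (toℕ b) true)
        from c c∈ with c Finₚ.≟ b | ∈-add⁻ {A = reached M} c∈
        ... | yes refl | _         = ∈slice⁺ (set M 5 (toℕ b) true 5) c (set-at M 5 (toℕ c) true)
        ... | no c≢b   | inj₁ c≡b  = contradiction c≡b c≢b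
        ... | no c≢b   | inj₂ c∈R  = ∈slice⁺ (set M 5 (toℕ b) true 5) c (trans (entry≡ true c≢b) (∈slice⁻ (M 5) c c∈R))
      unchanged : ∀ {x} → x ≡ M 5 (toℕ b) → reached (set M 5 (toℕ b) x) ≡ reached M
      unchanged {x} eq = ∈-≡
        (λ c c∈ → ∈slice⁺ (M 5) c (trans (sym (same c)) (∈slice⁻ (set M 5 (toℕ b) x 5) c c∈)))
        (λ c c∈ → ∈slice⁺ (set M 5 (toℕ b) x 5) c (trans (same c) (∈slice⁻ (M 5) c c∈)))
        where
        same : ∀ c → set M 5 (toℕ b) x 5 (toℕ c) ≡ M 5 (toℕ c)
        same c with c Finₚ.≟ b
        ... | yes refl = trans (set-at M 5 (toℕ c) x) eq
        ... | no c≢b   = entry≡ x c≢b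
      finish : ∀ {v} → Truth v (b ∈ reached M ⊎ Fires) → v ≡ val → let M′ = set M 5 (toℕ b) (0 <ᵇ val) in
        Off5 M M′ ×
        ((reached M′ ≡ reached M × (a ∈ reached M → row M (toℕ a) ~ row M (toℕ b) → b ∈ reached M)) ⊎
         (b ∉ reached M × reached M′ ≡ reached M +ₛ b × a ∈ reached M × row M (toℕ a) ~ row M (toℕ b)))
      finish {v} t e rewrite sym e = set-array M 5 (toℕ b) (0 <ᵇ v) , outcome t
        where
        outcome : Truth v (b ∈ reached M ⊎ Fires) → _
        outcome t with b ∈? reached M
        outcome (holds refl _) | yes b∈ = inj₁ (unchanged (sym (∈slice⁻ (M 5) b b∈)) , λ _ _ → b∈)
        outcome (fails _ ¬p)   | yes b∈ = contradiction (inj₁ b∈) ¬p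
        outcome (holds _ (inj₁ b∈)) | no b∉ = contradiction b∈ b∉
        outcome (holds refl (inj₂ (a∈ , st))) | no b∉ = inj₂ (b∉ , added , a∈ , st)
        outcome (fails refl ¬p) | no b∉ = inj₁ (unchanged (sym (Boolₚ.¬-not (b∉ ∘ ∈slice⁺ (M 5) b))) , λ a∈ st → contradiction (inj₂ (a∈ , st)) ¬p)

    forTo-Fin : ∀ {X : Set} (P : ℕ → X → Set) {f : ℕ → X → X} →
      (∀ (a : Fin N) x → P (suc (toℕ a)) x → P (toℕ a) (f (toℕ a) x)) → ∀ {x} → P N x → P 0 (forTo N f x)
    forTo-Fin P {f} h = forTo-invariant P N λ j x j<N →
      subst (λ j → P (suc j) x → P j (f j x)) (toℕ-fromℕ< j<N) (h (fromℕ< j<N) x)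

    module Search (M₀ : Mem) where

      Closed Sound : Subset N → Set
      Closed R = ∀ a b → a ∈ R → row M₀ (toℕ a) ~ row M₀ (toℕ b) → b ∈ R
      Sound R = ∀ a → a ∈ R → Star _~_ source (row M₀ (toℕ a))

      record Kept (M : Mem) : Set where
        field
          inputs  : Inputs I M
          off     : Off5 M₀ M
          sound   : Sound (reached M)
          started : reached M₀ ⊆ reached M

        rows : ∀ a → row M a ≡ row M₀ a
        rows = row-cong {M₀} {M} (off λ ()) (off λ ())

      -- As for the passes of the thinning: a loop that changes nothing has checked its condition
      -- `C` for the set it started from, and a change shows that this set was not closed and has
      -- grown.
      Progress : Subset N → Subset N → Set → Set
      Progress R R′ C = (R′ ≡ R × C) ⊎ (¬ Closed R × ∣ R ∣ < ∣ R′ ∣)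

      relax-kept : ∀ {M} j (a b : Fin N) → Kept M → let M′ = relax j (toℕ a) (toℕ b) M in
        Kept M′ × Progress (reached M) (reached M′) (a ∈ reached M → row M₀ (toℕ a) ~ row M₀ (toℕ b) → b ∈ reached M)
      relax-kept {M} j a b kept = conclude (relax-correct j (Kept.inputs kept) a b)
        where
        open Kept kept
        conclude : ∀ {M′} → Off5 M M′ ×
          ((reached M′ ≡ reached M × (a ∈ reached M → row M (toℕ a) ~ row M (toℕ b) → b ∈ reached M)) ⊎
           (b ∉ reached M × reached M′ ≡ reached M +ₛ b × a ∈ reached M × row M (toℕ a) ~ row M (toℕ b))) →
          Kept M′ × Progress (reached M) (reached M′) (a ∈ reached M → row M₀ (toℕ a) ~ row M₀ (toℕ b) → b ∈ reached M)
        conclude {M′} (off′ , inj₁ (same , closed)) = record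
          { inputs  = inputs-cong (off′ λ ()) inputs
          ; off     = λ b≢5 q → trans (off′ b≢5 q) (off b≢5 q)
          ; sound   = subst Sound (sym same) sound
          ; started = subst (_ ∈_) (sym same) ∘ started
          } , inj₁ (same , subst₂ (λ A B → a ∈ reached M → A ~ B → b ∈ reached M) (rows (toℕ a)) (rows (toℕ b)) closed)
        conclude {M′} (off′ , inj₂ (b∉ , new , a∈ , st)) = record
          { inputs  = inputs-cong (off′ λ ()) inputs
          ; off     = λ b≢5 q → trans (off′ b≢5 q) (off b≢5 q)
          ; sound   = subst Sound (sym new) sound′
          ; started = subst (_ ∈_) (sym new) ∘ ∈-add⁺ b ∘ started
          } , inj₂ ((λ closed → b∉ (closed a b a∈ st₀)) , ≤-reflexive (sym (trans (cong ∣_∣ new) (∣add∣ b∉))))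
          where
          st₀ : row M₀ (toℕ a) ~ row M₀ (toℕ b)
          st₀ = subst₂ _~_ (rows (toℕ a)) (rows (toℕ b)) st
          sound′ : Sound (reached M +ₛ b)
          sound′ c c∈ with ∈-add⁻ {A = reached M} c∈
          ... | inj₁ refl = sound a a∈ ◅◅ (st₀ ◅ ε)
          ... | inj₂ c∈R  = sound c c∈R

      progress-step : ∀ {R R₁ R₂ C D} → Progress R R₁ C → Progress R₁ R₂ D → Progress R R₂ (C × R₁ ≡ R × D)
      progress-step (inj₁ (e , c)) (inj₁ (e′ , d)) = inj₁ (trans e′ e , c , e , d)
      progress-step (inj₁ (refl , _)) (inj₂ p) = inj₂ p
      progress-step (inj₂ p) (inj₁ (refl , _)) = inj₂ p
      progress-step (inj₂ (¬c , lt)) (inj₂ (_ , lt′)) = inj₂ (¬c , <-trans lt lt′)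

      progress-map : ∀ {R R′ C D} → (C → D) → Progress R R′ C → Progress R R′ D
      progress-map f (inj₁ (e , c)) = inj₁ (e , f c)
      progress-map f (inj₂ p)       = inj₂ p

      split-≤ : ∀ {x} {P : Fin N → Set} {a : Fin N} → x ≡ toℕ a → P a → (∀ c → suc x ≤ toℕ c → P c) → ∀ c → x ≤ toℕ c → P c
      split-≤ {x} {P} refl p above c x≤c with m≤n⇒m<n∨m≡n x≤c
      ... | inj₁ x<c = above c x<c
      ... | inj₂ x≡c = subst P (toℕ-injective x≡c) p

      inner : ∀ {M} j (a : Fin N) → Kept M → let M′ = forTo N (λ b → relax j (toℕ a) b) M in
        Kept M′ × Progress (reached M) (reached M′) (∀ b → a ∈ reached M → row M₀ (toℕ a) ~ row M₀ (toℕ b) → b ∈ reached M)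
      inner {M} j a kept = finish (forTo-Fin Inv step {M} (kept , inj₁ (refl , λ b N≤b → contradiction N≤b (<⇒≱ (toℕ<n b)))))
        where
        C : Fin N → Set
        C b = a ∈ reached M → row M₀ (toℕ a) ~ row M₀ (toℕ b) → b ∈ reached M
        Inv : ℕ → Mem → Set
        Inv l M₁ = Kept M₁ × Progress (reached M) (reached M₁) (∀ b → l ≤ toℕ b → C b)
        step : ∀ b M₁ → Inv (suc (toℕ b)) M₁ → Inv (toℕ b) (relax j (toℕ a) (toℕ b) M₁)
        step b M₁ (kept₁ , p) with relax-kept j a b kept₁
        ... | kept₂ , q = kept₂ , progress-map
          (λ (above , same , here) → split-≤ {P = C} refl (subst (λ R → a ∈ R → _ → b ∈ R) same here) above)
          (progress-step {C = ∀ c → suc (toℕ b) ≤ toℕ c → C c} p q)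
        finish : ∀ {M₁} → Inv 0 M₁ → Kept M₁ × Progress (reached M) (reached M₁) (∀ b → C b)
        finish (kept , p) = kept , progress-map (λ f b → f b z≤n) p

      middle : ∀ {M} j → Kept M → let M′ = forTo N (λ a M → forTo N (λ b → relax j a b) M) M in
        Kept M′ × Progress (reached M) (reached M′) (Closed (reached M))
      middle {M} j kept = finish (forTo-Fin Inv step {M} (kept , inj₁ (refl , λ b N≤b → contradiction N≤b (<⇒≱ (toℕ<n b)))))
        where
        C : Fin N → Set
        C a = ∀ b → a ∈ reached M → row M₀ (toℕ a) ~ row M₀ (toℕ b) → b ∈ reached M
        Inv : ℕ → Mem → Set
        Inv l M₁ = Kept M₁ × Progress (reached M) (reached M₁) (∀ a → l ≤ toℕ a → C a)
        step : ∀ a M₁ → Inv (suc (toℕ a)) M₁ → Inv (toℕ a) (forTo N (λ b → relax j (toℕ a) b) M₁)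
        step a M₁ (kept₁ , p) with inner j a kept₁
        ... | kept₂ , q = kept₂ , progress-map
          (λ (above , same , here) → split-≤ {P = C} refl (subst (λ R → ∀ b → a ∈ R → row M₀ (toℕ a) ~ row M₀ (toℕ b) → b ∈ R) same here) above)
          (progress-step {C = ∀ c → suc (toℕ a) ≤ toℕ c → C c} p q)
        finish : ∀ {M₁} → Inv 0 M₁ → Kept M₁ × Progress (reached M) (reached M₁) (Closed (reached M))
        finish (kept , p) = kept , progress-map (λ f a → f a z≤n) p

      -- A round from a set that is not closed reaches a new row. After `N` such rounds all `N` rows
      -- are reached, and the full set is closed.
      outer : Kept M₀ → let M′ = forTo N (λ j M → forTo N (λ a M → forTo N (λ b → relax j a b) M) M) M₀ in
        Kept M′ × Closed (reached M′)
      outer kept = finish (forTo-invariant Inv N step {M₀} (kept , inj₂ (m≤n+m N ∣ reached M₀ ∣)))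
        where
        Inv : ℕ → Mem → Set
        Inv l M₁ = Kept M₁ × (Closed (reached M₁) ⊎ N ≤ ∣ reached M₁ ∣ + l)
        step : ∀ j M₁ → j < N → Inv (suc j) M₁ → Inv j (forTo N (λ a M → forTo N (λ b → relax j a b) M) M₁)
        step j M₁ _ (kept₁ , s) with middle j kept₁
        ... | kept₂ , q = kept₂ , next {forTo N (λ a M → forTo N (λ b → relax j a b) M) M₁} s q
          where
          next : ∀ {M₂} → Closed (reached M₁) ⊎ N ≤ ∣ reached M₁ ∣ + suc j → Progress (reached M₁) (reached M₂) (Closed (reached M₁)) →
                 Closed (reached M₂) ⊎ N ≤ ∣ reached M₂ ∣ + j
          next _        (inj₁ (e , c))   = inj₁ (subst Closed (sym e) c)
          next (inj₁ c) (inj₂ (¬c , _))  = contradiction c ¬c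
          next (inj₂ le) (inj₂ (_ , lt)) = inj₂ (≤-trans le (≤-trans (≤-reflexive (+-suc _ j)) (+-monoˡ-≤ j lt)))
        finish : ∀ {M₁} → Inv 0 M₁ → Kept M₁ × Closed (reached M₁)
        finish (kept , inj₁ c) = kept , c
        finish {M₁} (kept , inj₂ le) = kept , λ a b _ _ → subst (b ∈_)
          (sym (∣p∣≡n⇒p≡⊤ (≤-antisym (∣p∣≤n (reached M₁)) (≤-trans le (≤-reflexive (+-identityʳ _)))))) ∈⊤

    -- Several rows may describe the same set, so the fields speak of every such row and not of a
    -- chosen one.
    record Explored (M M′ : Mem) : Set where
      field
        sound  : ∀ a → a ∈ reached M′ → Star _~_ source (row M (toℕ a))
        closed : ∀ a b → a ∈ reached M′ → row M (toℕ a) ~ row M (toℕ b) → b ∈ reached M′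
        start  : ∀ a → row M (toℕ a) ≡ source → a ∈ reached M′
        inputs : Inputs I M′
        rows   : ∀ a → row M′ a ≡ row M a

    explore-from : ∀ {M M₁} → Inputs I M → Filled 5 N (λ a → row M a ≡ source) M M₁ →
      Explored M (forTo N (λ j M → forTo N (λ a M → forTo N (λ b → relax j a b) M) M) M₁)
    explore-from {M} {M₁} i f = conclude (outer kept₀)
      where
      open Search M₁
      rows₁ : ∀ a → row M₁ a ≡ row M a
      rows₁ = row-cong {M} {M₁} (Filled.off f λ ()) (Filled.off f λ ())
      kept₀ : Kept M₁
      kept₀ = record
        { inputs  = inputs-cong (Filled.off f λ ()) i
        ; off     = λ _ _ → refl
        ; sound   = λ a a∈ → subst (Star _~_ source)
                      (sym (trans (rows₁ (toℕ a)) (Filled.on⁻ f (toℕ a) (toℕ<n a) (∈slice⁻ (M₁ 5) a a∈)))) ε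
        ; started = id
        }
      conclude : ∀ {M′} → Kept M′ × Closed (reached M′) → Explored M M′
      conclude (kept , closed) = record
        { sound  = λ a a∈ → subst (Star _~_ source) (rows₁ (toℕ a)) (Kept.sound kept a a∈)
        ; closed = λ a b a∈ st → closed a b a∈ (subst₂ _~_ (sym (rows₁ (toℕ a))) (sym (rows₁ (toℕ b))) st)
        ; start  = λ a e → Kept.started kept (∈slice⁺ (M₁ 5) a (Filled.on⁺ f (toℕ a) (toℕ<n a) e))
        ; inputs = Kept.inputs kept
        ; rows   = λ a → trans (Kept.rows kept a) (rows₁ a)
        }

    ρ₀ : Vec ℕ 3
    ρ₀ = N ∷ n ∷ k ∷ []

    explore : ∀ {M} → Inputs I M → Explored M (⟪ reachC ⟫ ρ₀ M)
    explore {M} i = explore-from i filled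
      where
      filled : Filled 5 N (λ a → row M a ≡ source) M
                 (⟪ fill reachedA v0 (allₑ v2 (iffE (memberE v3 v1 v0) (sourceE v3 v0))) ⟫ ρ₀ M)
      filled = fill-correct 5 N (λ a M → ⟦ allₑ v2 (iffE (memberE v3 v1 v0) (sourceE v3 v0)) ⟧ (a ∷ ρ₀) M) _ M
        λ a M′ _ off _ → subst (λ R → Truth (⟦ allₑ v2 (iffE (memberE v3 v1 v0) (sourceE v3 v0)) ⟧ (a ∷ ρ₀) M′) (R ≡ source))
          (row-cong {M} {M′} (off λ ()) (off λ ()) a)
          (truth-≡-row M′ a source (truth-source {M′} (inputs-cong {M} {M′} (off λ ()) i)))

    truth-answer : ∀ {M} → Inputs I M → Truth (⟦ answerE ⟧ ρ₀ M) (∃[ a ] (a < N × (M 5 a ≡ true × row M a ≡ target)))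
    truth-answer {M} i = truth-any N λ a _ → truth-and (truth-read (M 5 a)) (truth-≡-row M a target (truth-target {M} i))

-- Layout of the encoding, and correctness of the whole program

module Correctness where

  open TapePrograms
  open Language
  open CostsAndInput
  open Decision
  open TreeDecompositions
  open TokenReplacement
  open Thinning
  open TruthValues
  open Kernelization
  open SubsetTable
  open Exploration
  open import Data.Bool.Base using (Bool; true; false; not; _∧_)
  open import Data.Fin.Base as Fin using (Fin; toℕ; fromℕ<)
  open import Data.Fin.Properties using (toℕ<n; toℕ-fromℕ<)
  open import Data.Fin.Subset using (Subset; _∈_; ∣_∣; ∁)
  open import Data.Fin.Subset.Properties using (x∈∁p⇒x∉p; x∉p⇒x∈∁p)
  open import Data.List.Base as List using (List; []; _∷_; _++_; length; concat)
  open import Data.List.Properties using (++-assoc; length-++; length-tabulate)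
  open import Data.Nat.Base
  open import Data.Nat.Properties
  open import Data.Product.Base using (∃-syntax; _×_; _,_; proj₁; proj₂)
  open import Data.Vec.Base as Vec using (Vec; []; _∷_; lookup; toList)
  open import Data.Vec.Properties using ([]=⇒lookup; lookup⇒[]=; length-toList)
  open import Function.Base using (_∘_)
  open import Relation.Binary.Construct.Closure.ReflexiveTransitive as Star using (Star; ε; _◅_)
  open import Relation.Binary.PropositionalEquality
  open import Relation.Nullary.Negation using (¬_; contradiction)
  open import Relation.Nullary.Reflects using (Reflects; ofʸ; ofⁿ)

  entry-++ˡ : ∀ xs ys {i} → i < length xs → entry (xs ++ ys) i ≡ entry xs i
  entry-++ˡ (x ∷ xs) ys {zero}  _         = refl
  entry-++ˡ (x ∷ xs) ys {suc i} (s≤s lt) = entry-++ˡ xs ys lt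

  entry-++ʳ : ∀ xs ys i → entry (xs ++ ys) (length xs + i) ≡ entry ys i
  entry-++ʳ []       ys i = refl
  entry-++ʳ (x ∷ xs) ys i = entry-++ʳ xs ys i

  entry-tabulate : ∀ {n} (f : Fin n → Bool) i → entry (List.tabulate f) (toℕ i) ≡ f i
  entry-tabulate f Fin.zero    = refl
  entry-tabulate f (Fin.suc i) = entry-tabulate (f ∘ Fin.suc) i

  entry-toList : ∀ {n} (xs : Vec Bool n) i → entry (toList xs) (toℕ i) ≡ lookup xs i
  entry-toList (x ∷ xs) Fin.zero    = refl
  entry-toList (x ∷ xs) (Fin.suc i) = entry-toList xs i

  length-concat : ∀ {m n} (rows : Fin m → List Bool) → (∀ x → length (rows x) ≡ n) →
    length (concat (List.tabulate rows)) ≡ m * n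
  length-concat {zero}  rows h = refl
  length-concat {suc m} rows h = trans (length-++ (rows Fin.zero))
    (cong₂ _+_ (h Fin.zero) (length-concat (rows ∘ Fin.suc) (h ∘ Fin.suc)))

  entry-concat : ∀ {m n} (rows : Fin m → List Bool) ys → (∀ x → length (rows x) ≡ n) → ∀ x {j} → j < n →
    entry (concat (List.tabulate rows) ++ ys) (toℕ x * n + j) ≡ entry (rows x) j
  entry-concat {suc m} {n} rows ys h x {j} j<n =
    trans (cong (λ l → entry l (toℕ x * n + j)) (++-assoc (rows Fin.zero) _ ys)) (go x)
    where
    rest = concat (List.tabulate (rows ∘ Fin.suc)) ++ ys
    go : ∀ x → entry (rows Fin.zero ++ rest) (toℕ x * n + j) ≡ entry (rows x) j
    go Fin.zero    = entry-++ˡ (rows Fin.zero) rest (≤-trans j<n (≤-reflexive (sym (h Fin.zero))))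
    go (Fin.suc x) = begin
      entry (rows Fin.zero ++ rest) (n + toℕ x * n + j)
        ≡⟨ cong (entry (rows Fin.zero ++ rest)) (trans (+-assoc n _ j) (cong (_+ (toℕ x * n + j)) (sym (h Fin.zero)))) ⟩
      entry (rows Fin.zero ++ rest) (length (rows Fin.zero) + (toℕ x * n + j))
        ≡⟨ entry-++ʳ (rows Fin.zero) rest _ ⟩
      entry rest (toℕ x * n + j)
        ≡⟨ entry-concat (rows ∘ Fin.suc) ys (h ∘ Fin.suc) x j<n ⟩
      entry (rows (Fin.suc x)) j ∎
      where open ≡-Reasoning

  body : ISRInstance → List Bool
  body I = concat (List.tabulate λ u → List.tabulate λ v → Graph.adj graph u v) ++ encodeSubset source ++ encodeSubset target
    where open ISRInstance I

  encode-body : ∀ I → unary (Graph.order (ISRInstance.graph I)) ++ body I ≡ encodeISR I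
  encode-body I = sym (++-assoc (unary (Graph.order graph)) (concat (List.tabulate λ u → List.tabulate λ v → Graph.adj graph u v)) _)
    where open ISRInstance I

  load-inputs : ∀ I → Inputs I (load (body I))
  load-inputs I = record
    { adj-read    = λ x v → trans (entry-concat rows (toList source ++ toList target) (λ u → length-tabulate (adj u)) x (toℕ<n v))
                                  (entry-tabulate (adj x) v)
    ; source-read = λ v → trans (past (toℕ v)) (trans (entry-++ˡ (toList source) (toList target)
                      (≤-trans (toℕ<n v) (≤-reflexive (sym (length-toList source))))) (entry-toList source v))
    ; target-read = λ v → trans (past (n + toℕ v)) (trans (cong (λ l → entry (toList source ++ toList target) (l + toℕ v)) (sym (length-toList source)))
                      (trans (entry-++ʳ (toList source) (toList target) (toℕ v)) (entry-toList target v)))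
    }
    where
    open ISRInstance I
    open Graph graph using (adj) renaming (order to n)
    rows : Fin n → List Bool
    rows u = List.tabulate (adj u)
    past : ∀ i → entry (body I) (n * n + i) ≡ entry (toList source ++ toList target) i
    past i = trans (cong (λ l → entry (body I) (l + i)) (sym (length-concat rows λ u → length-tabulate (adj u))))
                   (entry-++ʳ (concat (List.tabulate rows)) (toList source ++ toList target) i)

  kernelSize : ℕ → ℕ → ℕ
  kernelSize r k = bound r k + (k + k)

  powE : ∀ {m} → Exp m → ℕ → Exp m
  powE e zero    = lit 1
  powE e (suc i) = e ⊗ powE e i

  ⟦powE⟧ : ∀ {m} (e : Exp m) i {ρ M} → ⟦ powE e i ⟧ ρ M ≡ ⟦ e ⟧ ρ M ^ i
  ⟦powE⟧ e zero = refl
  ⟦powE⟧ e (suc i) {ρ} {M} = trans (sumTo-const (⟦ e ⟧ ρ M) _) (cong (⟦ e ⟧ ρ M *_) (⟦powE⟧ e i))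

  -- `r` depends on `t` alone, so the power with exponent `1 + r` is written out as a product of
  -- fixed length; only `k` is a variable.
  kernelSizeE : ℕ → Exp 1
  kernelSizeE r = powE (suc (suc v0)) (1 + r) ⊗ (lit r ⊕ suc v0 ⊗ suc v0) ⊕ (v0 ⊕ v0)

  ⟦kernelSizeE⟧ : ∀ r k M → ⟦ kernelSizeE r ⟧ (k ∷ []) M ≡ kernelSize r k
  ⟦kernelSizeE⟧ r k M = cong (_+ (k + k)) (trans (sumTo-const (⟦ powE (suc (suc v0)) (1 + r) ⟧ (k ∷ []) M) _)
    (cong₂ _*_ (⟦powE⟧ (suc (suc v0)) (1 + r) {k ∷ []} {M}) (cong₂ _+_ (⟦lit⟧ r {k ∷ []} {M}) (sumTo-const (suc k) (suc k)))))

  searchC : Cmd 3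
  searchC = kernelC ⨾ tableC ⨾ reachC

  module Correct (I : ISRInstance) (r : ℕ)
    (biclique-free : ∀ (A B : Subset (Graph.order (ISRInstance.graph I))) →
      (∀ a b → a ∈ A → b ∈ B → Graph.Adjacent (ISRInstance.graph I) a b) → r < ∣ A ∣ → ¬ r < ∣ B ∣) where

    open ISRInstance I
    open Graph graph using () renaming (order to n)
    open Kernel graph k k-positive using (Step; Live)
    open ReconfigurationGraph graph k

    N : ℕ
    N = 2 ^ kernelSize r k

    open Reduction I r biclique-free N using (kernel-correct; dead; truth-slice; inputs-cong)
    open Reach I r biclique-free N
    open Table N n k using (table; table-frame; table-correct)

    live-count : ∀ M → sumTo n (b2n ∘ not ∘ M 1) ≡ ∣ ∁ (dead M) ∣
    live-count M = truth-count (b2n ∘ not ∘ M 1) (∁ (dead M)) λ v → truth-map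
      (λ alive → x∉p⇒x∈∁p λ v∈ → contradiction (trans (sym alive) (cong not (∈slice⁻ (M 1) v v∈))) λ ())
      (λ v∈ → lift (x∈∁p⇒x∉p v∈ ∘ ∈slice⁺ (M 1) v))
      (truth-read (not (M 1 (toℕ v))))
      where
      lift : ∀ {b} → ¬ b ≡ true → not b ≡ true
      lift {true}  ¬t = contradiction refl ¬t
      lift {false} _  = refl

    -- The 2 ^ kernelSize rows suffice for all sets of surviving vertices. At deleted vertices both
    -- sides are empty, the row by masking and `A` because it is live.
    live-row : ∀ {M} → ∣ ∁ (dead M) ∣ ≤ kernelSize r k → ∀ A → Live (dead M) A →
      ∃[ a ] (row (table M) (toℕ {N} a) ≡ A)
    live-row {M} small A live with table-correct M (^-monoʳ-≤ 2 (≤-trans (≤-reflexive (live-count M)) small)) (entry (toList A))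
    ... | a , a<N , correct = fromℕ< a<N , trans (cong (row (table M)) (toℕ-fromℕ< a<N)) (∈-≡ to from)
      where
      dead≡ : ∀ v → table M 1 v ≡ M 1 v
      dead≡ = table-frame M (λ ()) (λ ())
      contains≡ : ∀ (v : Fin n) → M 1 (toℕ v) ≡ false → contains (table M) a (toℕ v) ≡ lookup A v
      contains≡ v alive = trans (cong₂ (λ x y → not x ∧ y) (trans (dead≡ (toℕ v)) alive) (correct (toℕ v) (toℕ<n v) alive))
                                (entry-toList A v)
      to : ∀ v → v ∈ row (table M) a → v ∈ A
      to v v∈ with M 1 (toℕ v) in e
      ... | false = lookup⇒[]= v A (trans (sym (contains≡ v e)) (∈slice⁻ (contains (table M) a) v v∈))
      ... | true  = contradiction (trans (sym (cong (λ x → not x ∧ table M 3 (a * n + toℕ v)) (trans (dead≡ (toℕ v)) e)))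
                                         (∈slice⁻ (contains (table M) a) v v∈)) λ ()
      from : ∀ v → v ∈ A → v ∈ row (table M) a
      from v v∈ with M 1 (toℕ v) in e
      ... | false = ∈slice⁺ (contains (table M) a) v (trans (contains≡ v e) ([]=⇒lookup v∈))
      ... | true  = contradiction (∈slice⁺ (M 1) v e) (live v v∈)

    -- Every set on the path avoids the deleted vertices and is thus a row; closedness hands
    -- reachability on from row to row.
    follow : ∀ {M M′} → (∀ A → Live (dead M) A → ∃[ a ] (row (table M) (toℕ {N} a) ≡ A)) → Explored (table M) M′ →
      ∀ {A B} → Star (Step (dead M)) A B → ∃[ a ] (row (table M) (toℕ a) ≡ A × a ∈ reached M′) →
      ∃[ b ] (row (table M) (toℕ b) ≡ B × b ∈ reached M′)
    follow rows ex ε found = found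
    follow rows ex ((st , _ , live) ◅ path) (a , refl , a∈) with rows _ live
    ... | b , refl = follow rows ex path (b , refl , Explored.closed ex a b a∈ st)

    Answer : Mem → Set
    Answer M = ∃[ a ] (a < N × (M 5 a ≡ true × row M a ≡ target))

    -- M is the memory after the kernelization.
    answer-correct : ∀ {M M′} → ∣ ∁ (dead M) ∣ ≤ kernelSize r k → (Star _~_ source target → Star (Step (dead M)) source target) →
      Live (dead M) source → Explored (table M) M′ → (Answer M′ → Reconfigurable) × (Reconfigurable → Answer M′)
    answer-correct {M} {M′} small path live ex = sound , complete
      where
      sound : Answer M′ → Reconfigurable
      sound (a , a<N , e , row≡) = subst (Star _~_ source) (trans (sym (Explored.rows ex (toℕ a′))) (trans (cong (row M′) (toℕ-fromℕ< a<N)) row≡))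
        (Explored.sound ex a′ (∈slice⁺ (M′ 5) a′ (trans (cong (M′ 5) (toℕ-fromℕ< a<N)) e)))
        where
        a′ = fromℕ< a<N
      complete : Reconfigurable → Answer M′
      complete p with live-row {M} small source live
      ... | a , row≡ with follow {M} {M′} (live-row {M} small) ex (path p) (a , row≡ , Explored.start ex a row≡)
      ...   | b , row≡′ , b∈ = toℕ b , toℕ<n b , ∈slice⁻ (M′ 5) b b∈ , trans (Explored.rows ex (toℕ b)) row≡′

    values : Vec ℕ 3
    values = N ∷ n ∷ k ∷ []

    result : ℕ
    result = ⟦ answerE ⟧ values (⟪ searchC ⟫ values (load (body I)))

    truth-result : Truth result Reconfigurable
    truth-result = finish (kernel-correct (load-inputs I) (λ _ → refl))
      where
      finish : ∀ {M} → Inputs I M × (∀ {a} → a ≢ 1 → a ≢ 2 → M a ≗ load (body I) a) × ∣ ∁ (dead M) ∣ ≤ kernelSize r k ×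
        (Star _~_ source target → Star (Step (dead M)) source target) × Live (dead M) source →
        Truth (⟦ answerE ⟧ values (⟪ reachC ⟫ values (table M))) Reconfigurable
      finish {M} (inputs , _ , small , path , live) =
        truth-map (proj₁ correct) (proj₂ correct) (truth-answer {⟪ reachC ⟫ values (table M)} (Explored.inputs explored))
        where
        explored : Explored (table M) (⟪ reachC ⟫ values (table M))
        explored = explore {table M} (inputs-cong (table-frame M (λ ()) (λ ())) inputs)
        correct : (Answer (⟪ reachC ⟫ values (table M)) → Reconfigurable) × (Reconfigurable → Answer (⟪ reachC ⟫ values (table M)))
        correct = answer-correct {M} small path live explored

    reflects : Reflects Reconfigurable (0 <ᵇ result)
    reflects = from-truth truth-result
      where
      from-truth : ∀ {x P} → Truth x P → Reflects P (0 <ᵇ x)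
      from-truth (holds refl p) = ofʸ p
      from-truth (fails refl ¬p) = ofⁿ ¬p

open TapePrograms
open Language
open CostsAndInput
open Decision
open TreeDecompositions
open Exploration
open Correctness
open import Data.List.Base using (length; _++_)
open import Data.Maybe.Base using (just)
open import Data.Nat.Base
open import Data.Nat.Properties using (≤-trans)
open import Data.Product.Base using (_,_)
open import Relation.Binary.PropositionalEquality using (_≡_; subst)

mainTheorem5 : ∀ (t : ℕ) → FixedParameterTractable (ISR-treewidth≤ t)
mainTheorem5 t = machine , factor , suc p , λ (I , D , width≤t) →
  let open ISRInstance I
      -- A bag has at most `t + 1` vertices. The decomposition enters at this point only, as part of
      -- the promise, while the machine is fixed by `t`.
      open Correct I (suc t) (λ A B joined A> B> → Biclique.no-biclique graph D joined
                                (≤-trans (s≤s (s≤s width≤t)) A>) (≤-trans (s≤s (s≤s width≤t)) B>))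
  in (0 <ᵇ result) ,
     subst (λ w → TuringMachine.runFor machine (factor k * length w ^ suc p)
                    (TuringMachine.initial machine (unary k ++ w)) ≡ just (0 <ᵇ result))
           (encode-body I) (decides k (Graph.order graph) (body I)) ,
     reflects
  where
  open Program (kernelSizeE (suc t)) (kernelSize (suc t)) (⟦kernelSizeE⟧ (suc t)) searchC answerE
    using (machine; factor; p; decides)
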